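{- There is an exact (deterministic) algorithm that, given a metric space $(X,d)$ with $|X|=n$ points and a positive integer $k$, solves the $k$-median problem on $(X,d,k)$ optimally in time $(1.89)^{n}\, n^{O(1)}$. The same holds for the $k$-means problem.
   Context: $k$-median: the input is a finite metric space $(X,d)$ with $X=\{x_1,\dots,x_n\}$ and a positive integer $k$. A solution is a pair $(C,P)$ where $C=\{c_1,\dots,c_k\}\subseteq X$ is a set of $k$ centers and $P$ is a partition of $X$ into $k$ subsets (clusters) $X_1,\dots,X_k$, with $X_i$ being the cluster corresponding to the center $c_i$. The task is to find a pair $(C,P)$ minimizing $\mathrm{cost}(C,P)=\sum_{i=1}^{k}\sum_{x\in X_i} d(c_i,x)$. $k$-means: the same problem, except that the quantity to be minimized is $\sum_{i=1}^{k}\sum_{x\in X_i} d(c_i,x)^2$. The integer $k$ is part of the input and the running time bound holds for every value of $k$. -}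

module Defs where

open import Algebra.Bundles using (CommutativeRing; Monoid)
import Algebra.Definitions.RawMonoid as RawMonoidDefs
open import Data.Bool using (Bool; true; false; if_then_else_)
open import Data.Fin using (Fin; toℕ; fromℕ<; remQuot)
import Data.Fin as Fin
open import Data.Nat as ℕ using (ℕ; suc; ⌊_/2⌋; _≡ᵇ_; _≤ᵇ_)
open import Data.Nat.Logarithm using (⌊log₂_⌋)
open import Data.Product using (_×_; _,_; ∃-syntax; Σ-syntax; uncurry)
open import Function.Definitions using (Injective; Surjective)
open import Function.Metric.Structures using (IsGeneralMetric)
open import Level using (0ℓ; _⊔_) renaming (suc to lsuc)
open import Relation.Binary.Core using (Rel)
open import Relation.Binary.PropositionalEquality using (_≡_; refl; trans; sym)
open import Relation.Binary.Structures using (IsDecTotalOrder)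
open import Relation.Nullary using (¬_; yes; no; contradiction)
open import Relation.Nullary.Decidable using (⌊_⌋)

-- Ordered fields play the role of the real numbers.  The order is decidable
-- because comparing two numbers is a primitive step of the machine below.

record OrderedField c ℓ₁ ℓ₂ : Set (lsuc (c ⊔ ℓ₁ ⊔ ℓ₂)) where
  infix 4 _≤_
  field
    commutativeRing : CommutativeRing c ℓ₁
  open CommutativeRing commutativeRing public
  field
    _≤_             : Rel Carrier ℓ₂
    isDecTotalOrder : IsDecTotalOrder _≈_ _≤_
    0≉1             : ¬ (0# ≈ 1#)
    inverse         : ∀ x → ¬ (x ≈ 0#) → ∃[ y ] (x * y ≈ 1#)
    +-monoʳ-≤       : ∀ x {y z} → y ≤ z → x + y ≤ x + z
    *-nonNegative   : ∀ {x y} → 0# ≤ x → 0# ≤ y → 0# ≤ x * y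
  open IsDecTotalOrder isDecTotalOrder public using (_≤?_)

-- Programs of a two-sorted random access machine.  One memory holds natural
-- numbers and one holds field elements; both are indexed by naturals.  A
-- program is finite syntax that mentions neither the field nor the input size.

infixl 6 _⊕_ _⊖_ _⊞_ _⊟_
infixl 7 _⊗_ _⊠_
infix  8 !_ ‼_
infix  4 _≤ₙ_ _≤ᵣ_
infix  3 _≔_ _≔ᵣ_
infixr 2 _⨾_

data NatExp : Set where
  lit         : ℕ → NatExp
  !_          : NatExp → NatExp            -- contents of the cell at an address
  _⊕_ _⊖_ _⊗_ : NatExp → NatExp → NatExp   -- _⊖_ is truncated subtraction
  half        : NatExp → NatExp

data FieldExp : Set where
  zeroᵣ oneᵣ  : FieldExp
  ‼_          : NatExp → FieldExp
  _⊞_ _⊟_ _⊠_ : FieldExp → FieldExp → FieldExp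

data Test : Set where
  _≤ₙ_ : NatExp → NatExp → Test
  _≤ᵣ_ : FieldExp → FieldExp → Test

data Program : Set where
  skip           : Program
  _≔_            : NatExp → NatExp → Program     -- the left side is the address
  _≔ᵣ_           : NatExp → FieldExp → Program
  _⨾_            : Program → Program → Program
  ifᵗ_then_else_ : Test → Program → Program → Program
  while_loop_    : Test → Program → Program

bits : ℕ → ℕ
bits v = suc ⌊log₂ v ⌋

update : ∀ {a} {A : Set a} → (ℕ → A) → ℕ → A → ℕ → A
update f a v b = if b ≡ᵇ a then v else f b

module Machine {c ℓ₁ ℓ₂} (F : OrderedField c ℓ₁ ℓ₂) where
  open OrderedField F hiding (refl; sym; trans)

  record State : Set c where
    constructor ⟨_,_⟩
    field
      nat  : ℕ → ℕ
      real : ℕ → Carrier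
  open State public

  evalₙ : NatExp → State → ℕ
  evalₙ (lit v)  s = v
  evalₙ (! e)    s = nat s (evalₙ e s)
  evalₙ (e ⊕ e′) s = evalₙ e s ℕ.+ evalₙ e′ s
  evalₙ (e ⊖ e′) s = evalₙ e s ℕ.∸ evalₙ e′ s
  evalₙ (e ⊗ e′) s = evalₙ e s ℕ.* evalₙ e′ s
  evalₙ (half e) s = ⌊ evalₙ e s /2⌋

  evalᵣ : FieldExp → State → Carrier
  evalᵣ zeroᵣ    s = 0#
  evalᵣ oneᵣ     s = 1#
  evalᵣ (‼ e)    s = real s (evalₙ e s)
  evalᵣ (q ⊞ q′) s = evalᵣ q s + evalᵣ q′ s
  evalᵣ (q ⊟ q′) s = evalᵣ q s - evalᵣ q′ s
  evalᵣ (q ⊠ q′) s = evalᵣ q s * evalᵣ q′ s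

  evalᵗ : Test → State → Bool
  evalᵗ (e ≤ₙ e′) s = evalₙ e s ≤ᵇ evalₙ e′ s
  evalᵗ (q ≤ᵣ q′) s = ⌊ evalᵣ q s ≤? evalᵣ q′ s ⌋

  -- Natural numbers are unbounded, so each operation on them is charged the bit
  -- length of its result (its operands having been charged already).  With unit
  -- cost, repeated multiplication would pack exponential work into one step.
  -- Operations on field elements have unit cost, as in the real RAM.

  timeₙ : NatExp → State → ℕ
  timeₙ (lit v)  s = bits v
  timeₙ (! e)    s = bits (evalₙ (! e) s) ℕ.+ timeₙ e s
  timeₙ (e ⊕ e′) s = bits (evalₙ (e ⊕ e′) s) ℕ.+ (timeₙ e s ℕ.+ timeₙ e′ s)
  timeₙ (e ⊖ e′) s = bits (evalₙ (e ⊖ e′) s) ℕ.+ (timeₙ e s ℕ.+ timeₙ e′ s)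
  timeₙ (e ⊗ e′) s = bits (evalₙ (e ⊗ e′) s) ℕ.+ (timeₙ e s ℕ.+ timeₙ e′ s)
  timeₙ (half e) s = bits (evalₙ (half e) s) ℕ.+ timeₙ e s

  timeᵣ : FieldExp → State → ℕ
  timeᵣ zeroᵣ    s = 1
  timeᵣ oneᵣ     s = 1
  timeᵣ (‼ e)    s = suc (timeₙ e s)
  timeᵣ (q ⊞ q′) s = suc (timeᵣ q s ℕ.+ timeᵣ q′ s)
  timeᵣ (q ⊟ q′) s = suc (timeᵣ q s ℕ.+ timeᵣ q′ s)
  timeᵣ (q ⊠ q′) s = suc (timeᵣ q s ℕ.+ timeᵣ q′ s)

  timeᵗ : Test → State → ℕ
  timeᵗ (e ≤ₙ e′) s = suc (timeₙ e s ℕ.+ timeₙ e′ s)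
  timeᵗ (q ≤ᵣ q′) s = suc (timeᵣ q s ℕ.+ timeᵣ q′ s)

  -- [ p , s ]⇓[ s′ , t ]: started in s, the program p halts in s′ after time t.

  infix 1 [_,_]⇓[_,_]

  data [_,_]⇓[_,_] : Program → State → State → ℕ → Set c where
    ⇓-skip : ∀ {s} → [ skip , s ]⇓[ s , 1 ]

    ⇓-≔ : ∀ {a e s} →
      [ a ≔ e , s ]⇓[ ⟨ update (nat s) (evalₙ a s) (evalₙ e s) , real s ⟩
                    , suc (timeₙ a s ℕ.+ timeₙ e s) ]

    ⇓-≔ᵣ : ∀ {a q s} →
      [ a ≔ᵣ q , s ]⇓[ ⟨ nat s , update (real s) (evalₙ a s) (evalᵣ q s) ⟩
                     , suc (timeₙ a s ℕ.+ timeᵣ q s) ]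

    ⇓-⨾ : ∀ {p p′ s s′ s″ t t′} →
      [ p , s ]⇓[ s′ , t ] → [ p′ , s′ ]⇓[ s″ , t′ ] →
      [ p ⨾ p′ , s ]⇓[ s″ , t ℕ.+ t′ ]

    ⇓-then : ∀ {b p p′ s s′ t} → evalᵗ b s ≡ true →
      [ p , s ]⇓[ s′ , t ] →
      [ ifᵗ b then p else p′ , s ]⇓[ s′ , timeᵗ b s ℕ.+ t ]

    ⇓-else : ∀ {b p p′ s s′ t} → evalᵗ b s ≡ false →
      [ p′ , s ]⇓[ s′ , t ] →
      [ ifᵗ b then p else p′ , s ]⇓[ s′ , timeᵗ b s ℕ.+ t ]

    ⇓-stop : ∀ {b p s} → evalᵗ b s ≡ false →
      [ while b loop p , s ]⇓[ s , timeᵗ b s ]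

    ⇓-loop : ∀ {b p s s′ s″ t t′} → evalᵗ b s ≡ true →
      [ p , s ]⇓[ s′ , t ] → [ while b loop p , s′ ]⇓[ s″ , t′ ] →
      [ while b loop p , s ]⇓[ s″ , timeᵗ b s ℕ.+ (t ℕ.+ t′) ]

  ⇓-deterministic : ∀ {p s s₁ s₂ t₁ t₂} →
    [ p , s ]⇓[ s₁ , t₁ ] → [ p , s ]⇓[ s₂ , t₂ ] → s₁ ≡ s₂ × t₁ ≡ t₂
  ⇓-deterministic ⇓-skip ⇓-skip = refl , refl
  ⇓-deterministic ⇓-≔    ⇓-≔    = refl , refl
  ⇓-deterministic ⇓-≔ᵣ   ⇓-≔ᵣ   = refl , refl
  ⇓-deterministic (⇓-⨾ x y) (⇓-⨾ x′ y′)
    with refl , refl ← ⇓-deterministic x x′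
    with refl , refl ← ⇓-deterministic y y′ = refl , refl
  ⇓-deterministic (⇓-then _ x) (⇓-then _ x′)
    with refl , refl ← ⇓-deterministic x x′ = refl , refl
  ⇓-deterministic (⇓-else _ x) (⇓-else _ x′)
    with refl , refl ← ⇓-deterministic x x′ = refl , refl
  ⇓-deterministic (⇓-then b _) (⇓-else b′ _) = contradiction (trans (sym b) b′) λ ()
  ⇓-deterministic (⇓-else b _) (⇓-then b′ _) = contradiction (trans (sym b) b′) λ ()
  ⇓-deterministic (⇓-stop _) (⇓-stop _) = refl , refl
  ⇓-deterministic (⇓-loop _ x y) (⇓-loop _ x′ y′)
    with refl , refl ← ⇓-deterministic x x′
    with refl , refl ← ⇓-deterministic y y′ = refl , refl
  ⇓-deterministic (⇓-stop b) (⇓-loop b′ _ _) = contradiction (trans (sym b) b′) λ ()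
  ⇓-deterministic (⇓-loop b _ _) (⇓-stop b′) = contradiction (trans (sym b) b′) λ ()

module Clustering {c ℓ₁ ℓ₂} (F : OrderedField c ℓ₁ ℓ₂) where
  open OrderedField F
  open Machine F
  open RawMonoidDefs (Monoid.rawMonoid +-monoid) using (sum)

  record FiniteMetricSpace (n : ℕ) : Set (c ⊔ ℓ₁ ⊔ ℓ₂) where
    field
      d        : Fin n → Fin n → Carrier
      isMetric : IsGeneralMetric _≡_ _≈_ _≤_ 0# _+_ d

  -- The partition X₁, …, Xₖ is given by the map sending each point to the index
  -- of its cluster; surjectivity says that no cluster is empty.

  record Solution (n k : ℕ) : Set where
    field
      center             : Fin k → Fin n
      center-injective   : Injective _≡_ _≡_ center
      cluster            : Fin n → Fin k
      cluster-surjective : Surjective _≡_ _≡_ cluster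

  module _ (w : Carrier → Carrier) {n k : ℕ} (X : FiniteMetricSpace n) where
    open FiniteMetricSpace X
    open Solution

    cost : Solution n k → Carrier
    cost S = sum λ i → sum λ x →
      if ⌊ cluster S x Fin.≟ i ⌋ then w (d (center S i) x) else 0#

    Optimal : Solution n k → Set ℓ₂
    Optimal S = ∀ S′ → cost S ≤ cost S′

  -- Natural memory starts with n and k; field memory starts with the n × n
  -- distance matrix in row-major order.  Everything else is zero.

  input : ∀ {n} → FiniteMetricSpace n → ℕ → State
  input {n} X k = ⟨ nats , distances ⟩
    where
    open FiniteMetricSpace X
    nats : ℕ → ℕ
    nats 0             = n
    nats 1             = k
    nats (suc (suc _)) = 0
    distances : ℕ → Carrier
    distances a with a ℕ.<? n ℕ.* n
    ... | yes a<n² = uncurry d (remQuot {n} n (fromℕ< a<n²))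
    ... | no  _    = 0#

  -- The k centers are written first, followed by the n cluster indices.

  Outputs : ∀ {n k} → State → Solution n k → Set
  Outputs {n} {k} s S =
    (∀ i → nat s (toℕ i) ≡ toℕ (center S i)) ×
    (∀ x → nat s (k ℕ.+ toℕ x) ≡ toℕ (cluster S x))
    where open Solution

-- The cost incurred by a point at distance x from its center.

Weight : Set₁
Weight = (F : OrderedField 0ℓ 0ℓ 0ℓ) → let open OrderedField F in Carrier → Carrier

medianWeight : Weight
medianWeight F x = x

meansWeight : Weight
meansWeight F x = let open OrderedField F in x * x

-- Time at most (α / β)ⁿ · n^O(1).  For k > n there is no solution, as the k
-- centers are distinct points of X.

SolvesInTime : Weight → ℕ → ℕ → Program → Set₁
SolvesInTime w α β p =
  ∃[ e ] ∀ (F : OrderedField 0ℓ 0ℓ 0ℓ) → let open Machine F; open Clustering F in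
  ∀ n (X : FiniteMetricSpace n) k → 1 ℕ.≤ k → k ℕ.≤ n →
  Σ[ s ∈ State ] Σ[ t ∈ ℕ ] Σ[ S ∈ Solution n k ]
    ([ p , input X k ]⇓[ s , t ]) ×
    Outputs s S ×
    Optimal (w F) X S ×
    t ℕ.* β ℕ.^ n ℕ.≤ α ℕ.^ n ℕ.* (e ℕ.* n ℕ.^ e)

{-# OPTIONS --safe #-}

-- Call a set of points heavy if it is likely under one of polynomially many product
-- measures; by Markov's inequality there are at most 1.89ⁿ · n^O(1) heavy sets, and a
-- breadth-first search lists them.  Each of them is tried as the set of centers of
-- the clusters with at least two points, the remaining centers being chosen greedily
-- among the farthest points, and along chains of heavy sets a dynamic program
-- completes clusters one after the other.
--
-- Let g be the number of clusters with at least two points.  If g ≤ n / 3, then the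
-- set of their centers is heavy, because (3 / 2)ⁿ · 2^(n / 3) ≤ 1.89ⁿ.  Otherwise
-- complete the clusters in the order of their first points.  The union of the
-- clusters met by the first i points stays heavy as long as it has at most
-- n / 3 + 3 i / 2 points, or as soon as i ≥ n / 10.  If this fails for some i, then
-- counting shows that there are many clusters of exactly two points.  In a pair
-- either point can serve as the center, and some word of a Hadamard code colors half
-- of the pairs with two colors; choosing the points of one color as the centers of
-- these pairs biases the set of centers enough to make it heavy.

module Submission where

open import Defs
open import Algebra.Bundles using (CommutativeMonoid; Monoid)
import Algebra.Definitions.RawMonoid as RawMonoidDefs
open import Data.Bool using (Bool; true; false; if_then_else_; not; _∧_; _∨_; T)
import Data.Bool.Properties as Boolₚ
open import Data.Empty using (⊥; ⊥-elim)
open import Data.Fin using (Fin; zero; suc; toℕ; fromℕ<)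
import Data.Fin as Fin
import Data.Fin.Properties as Finₚ
open import Data.Nat
open import Data.Nat.Properties
open import Data.Nat.DivMod using (m<n*o⇒m/o<n; m%n<n; m≡m%n+[m/n]*n)
open import Data.Nat.Logarithm using (⌊log₂_⌋; ⌊log₂⌋-mono-≤; ⌊log₂[2^n]⌋≡n)
open import Data.Nat.Tactic.RingSolver using (solve-∀)
open import Data.Product using (_×_; _,_; proj₁; proj₂; Σ-syntax; ∃-syntax; uncurry)
open import Data.Sum using (_⊎_; inj₁; inj₂)
open import Data.Unit using (⊤; tt)
open import Data.Vec using (Vec; []; _∷_; map)
open import Data.Vec.Relation.Unary.All using (All; []; _∷_)
import Data.Vec.Relation.Unary.All as All
open import Function using (_∘_; case_of_)
open import Function.Metric.Structures using (IsGeneralMetric)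
open import Level using (0ℓ)
open import Relation.Binary.PropositionalEquality hiding (J; setoid; [_])
open import Relation.Binary.Definitions using (tri<; tri≈; tri>)
open import Relation.Binary.Structures using (IsDecTotalOrder)
open import Relation.Nullary using (yes; no; does)
open import Relation.Nullary.Decidable using (⌊_⌋; _×-dec_)

-- Factors a and 756 - a at every point make the masses of all 2^n sets add up to 756^n, so the
-- threshold 400^n leaves at most 1.89^n sets per profile. The obstacle is that the search adds one
-- point at a time: a heavy set is found only if heavy sets link it to the empty set. The profiles
-- used for sets of centers therefore never favor putting a point in over leaving it out, so that
-- weight passes to subsets; the sets of a chain are linked by an order of completion that forces a
-- prefix of the points to be present, and the profiles with a prefix give it the full factor 756. A
-- coloring controls only the pairs that it splits, the colors of all other centers being arbitrary.
-- Hence it is considered together with its complement: the product of the two weights does not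
-- depend on those colors, and if it reaches 400^(2n), then one of the two weights reaches 400^n.
-- The numbers behind the cases are 2 < 1.26^3, 2^(3/2) < 3, 2^(9/10) < 1.89 and 2^4 < (3/2)^7.

foldn : ∀ {a} {A : Set a} → ℕ → A → (ℕ → A → A) → A
foldn zero    a f = a
foldn (suc n) a f = f n (foldn n a f)

foldn-ind : ∀ {a p} {A : Set a} (P : ℕ → A → Set p) (n : ℕ) {a₀ : A} {f : ℕ → A → A} →
  P 0 a₀ → (∀ i x → i < n → P i x → P (suc i) (f i x)) → P n (foldn n a₀ f)
foldn-ind P zero    base step = base
foldn-ind P (suc n) base step =
  step n _ (n<1+n n) (foldn-ind P n base λ i x i<n → step i x (m<n⇒m<1+n i<n))

foldn-cong : ∀ {a} {A : Set a} (n : ℕ) {a₀ b₀ : A} {f g : ℕ → A → A} →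
  a₀ ≡ b₀ → (∀ i x → i < n → f i x ≡ g i x) → foldn n a₀ f ≡ foldn n b₀ g
foldn-cong zero    base step = base
foldn-cong (suc n) {f = f} base step = trans
  (cong (f n) (foldn-cong n base λ i x i<n → step i x (m<n⇒m<1+n i<n)))
  (step n _ (n<1+n n))

-- Polynomials as syntax: running times are computed by recursion on the source
-- terms, and only the fact that they are polynomial matters.

infixl 6 _:+_
infixl 7 _:*_
infixr 9 _:∘_

data Poly : Set where
  :X             : Poly
  :c             : ℕ → Poly
  _:+_ _:*_ _:∘_ : Poly → Poly → Poly

⟪_⟫ : Poly → ℕ → ℕ
⟪ :X ⟫     m = m
⟪ :c v ⟫   m = v
⟪ p :+ q ⟫ m = ⟪ p ⟫ m + ⟪ q ⟫ m
⟪ p :* q ⟫ m = ⟪ p ⟫ m * ⟪ q ⟫ m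
⟪ p :∘ q ⟫ m = ⟪ p ⟫ (⟪ q ⟫ m)

⟪⟫-mono : ∀ p {m m′} → m ≤ m′ → ⟪ p ⟫ m ≤ ⟪ p ⟫ m′
⟪⟫-mono :X       m≤m′ = m≤m′
⟪⟫-mono (:c v)   m≤m′ = ≤-refl
⟪⟫-mono (p :+ q) m≤m′ = +-mono-≤ (⟪⟫-mono p m≤m′) (⟪⟫-mono q m≤m′)
⟪⟫-mono (p :* q) m≤m′ = *-mono-≤ (⟪⟫-mono p m≤m′) (⟪⟫-mono q m≤m′)
⟪⟫-mono (p :∘ q) m≤m′ = ⟪⟫-mono p (⟪⟫-mono q m≤m′)

n<2^n : ∀ n → n < 2 ^ n
n<2^n zero    = s≤s z≤n
n<2^n (suc n) = begin-strict
  suc n             ≤⟨ n<2^n n ⟩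
  2 ^ n             <⟨ m<m+n (2 ^ n) (≤-trans (m^n>0 2 n) (m≤m+n (2 ^ n) 0)) ⟩
  2 ^ suc n         ∎
  where open ≤-Reasoning


^-distribʳ-* : ∀ a b c → (a * b) ^ c ≡ a ^ c * b ^ c
^-distribʳ-* a b zero    = refl
^-distribʳ-* a b (suc c) = trans (cong (a * b *_) (^-distribʳ-* a b c))
  ([m*n]*[o*p]≡[m*o]*[n*p] a b (a ^ c) (b ^ c))

-- The restriction to m ≥ 1 lets a higher power dominate a lower one. The clause `1 ≤ K` is carried
-- along for composition, where the outer bound is used at `L * m ^ e` and this has to be at least
-- 1.
⟪⟫-bound : ∀ p → Σ[ K ∈ ℕ ] Σ[ d ∈ ℕ ] (1 ≤ K × ∀ m → 1 ≤ m → ⟪ p ⟫ m ≤ K * m ^ d)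
⟪⟫-bound :X = 1 , 1 , ≤-refl , λ m _ → ≤-reflexive (sym (trans (+-identityʳ _) (*-identityʳ m)))
⟪⟫-bound (:c v) = suc v , 0 , s≤s z≤n , λ m _ → ≤-trans (n≤1+n v) (≤-reflexive (sym (*-identityʳ (suc v))))
⟪⟫-bound (p :+ q) with ⟪⟫-bound p | ⟪⟫-bound q
... | K , d , 1≤K , P | L , e , 1≤L , Q = K + L , d + e , ≤-trans 1≤K (m≤m+n K L) , λ m 1≤m →
  let instance _ = >-nonZero 1≤m in begin
  ⟪ p ⟫ m + ⟪ q ⟫ m               ≤⟨ +-mono-≤ (P m 1≤m) (Q m 1≤m) ⟩
  K * m ^ d + L * m ^ e           ≤⟨ +-mono-≤ (*-monoʳ-≤ K (^-monoʳ-≤ m (m≤m+n d e)))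
                                              (*-monoʳ-≤ L (^-monoʳ-≤ m (m≤n+m e d))) ⟩
  K * m ^ (d + e) + L * m ^ (d + e) ≡⟨ *-distribʳ-+ (m ^ (d + e)) K L ⟨
  (K + L) * m ^ (d + e)           ∎
  where open ≤-Reasoning
⟪⟫-bound (p :* q) with ⟪⟫-bound p | ⟪⟫-bound q
... | K , d , 1≤K , P | L , e , 1≤L , Q = K * L , d + e , *-mono-≤ 1≤K 1≤L , λ m 1≤m → begin
  ⟪ p ⟫ m * ⟪ q ⟫ m               ≤⟨ *-mono-≤ (P m 1≤m) (Q m 1≤m) ⟩
  K * m ^ d * (L * m ^ e)         ≡⟨ [m*n]*[o*p]≡[m*o]*[n*p] K (m ^ d) L (m ^ e) ⟩
  K * L * (m ^ d * m ^ e)         ≡⟨ cong (K * L *_) (^-distribˡ-+-* m d e) ⟨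
  K * L * m ^ (d + e)             ∎
  where open ≤-Reasoning
⟪⟫-bound (p :∘ q) with ⟪⟫-bound p | ⟪⟫-bound q
... | K , d , 1≤K , P | L , e , 1≤L , Q =
  K * L ^ d , e * d , *-mono-≤ 1≤K (m^n>0 L {{>-nonZero 1≤L}} d) , λ m 1≤m →
  let 1≤Lm = *-mono-≤ 1≤L (m^n>0 m {{>-nonZero 1≤m}} e) in begin
  ⟪ p ⟫ (⟪ q ⟫ m)                 ≤⟨ ⟪⟫-mono p (Q m 1≤m) ⟩
  ⟪ p ⟫ (L * m ^ e)               ≤⟨ P _ 1≤Lm ⟩
  K * (L * m ^ e) ^ d             ≡⟨ cong (K *_) (^-distribʳ-* L (m ^ e) d) ⟩
  K * (L ^ d * (m ^ e) ^ d)       ≡⟨ cong (λ z → K * (L ^ d * z)) (^-*-assoc m e d) ⟩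
  K * (L ^ d * m ^ (e * d))       ≡⟨ *-assoc K (L ^ d) _ ⟨
  K * L ^ d * m ^ (e * d)         ∎
  where open ≤-Reasoning

-- A loop language and its compilation

-- A Term r has r variables in scope, top being the most recently bound; fold binds
-- the accumulator and then the index.  Every loop runs over the n points, so that
-- running times are polynomial by syntax.

data Term : ℕ → Set
data Cond : ℕ → Set

data Term where
  top       : ∀ {r} → Term (suc r)
  wk        : ∀ {r} → Term r → Term (suc r)
  con       : ∀ {r} → ℕ → Term r
  #n #k     : ∀ {r} → Term r
  get       : ∀ {r} → Fin 5 → Term r → Term r
  add sub   : ∀ {r} → Term r → Term r → Term r
  halve row : ∀ {r} → Term r → Term r
  times     : ∀ {r} → ℕ → Term r → Term r
  ite       : ∀ {r} → Cond r → Term r → Term r → Term r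
  fold      : ∀ {r} → Term r → Term (2 + r) → Term r

-- Distances are visible only through the comparison of two conditional sums, so terms and arrays
-- hold natural numbers alone and no field element is kept from one command to the next.
data Cond where
  leq  : ∀ {r} → Term r → Term r → Cond r
  sums : ∀ {r} → Cond (suc r) → Term (suc r) → Cond (suc r) → Term (suc r) → Cond r

infixr 5 _▷_

data Cmd : ℕ → Set where
  put  : ∀ {r} → Fin 5 → Term r → Term r → Cmd r
  _▷_  : ∀ {r} → Cmd r → Cmd r → Cmd r
  when : ∀ {r} → Cond r → Cmd r → Cmd r
  for  : ∀ {r} → Cmd (suc r) → Cmd r
  bind : ∀ {r} → Term r → Cmd (suc r) → Cmd r

-- Natural memory: cells 0 and 1 are left alone, and the rest is interleaved into
-- the registers (stripe 0) and the five arrays (stripes 1 to 5).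

cell : Fin 6 → ℕ → ℕ
cell c i = 2 + (i * 6 + toℕ c)

cellₑ : Fin 6 → NatExp → NatExp
cellₑ c e = lit 2 ⊕ (e ⊗ lit 6 ⊕ lit (toℕ c))

reg : ℕ → NatExp
reg t = lit (cell zero t)

-- Field registers sit behind the distance matrix; matrix indices are clamped so
-- that lookups never see them.

regᵣ : ℕ → NatExp
regᵣ t = ! lit 0 ⊗ ! lit 0 ⊕ lit t

clampₑ : NatExp → NatExp
clampₑ e = e ⊖ (e ⊖ (! lit 0 ⊗ ! lit 0 ⊖ lit 1))

weighₑ : Bool → FieldExp → FieldExp
weighₑ false q = q
weighₑ true  q = q ⊠ q

loopₙ : NatExp → Program → Program
loopₙ i p = i ≔ lit 0 ⨾ while lit 1 ⊕ ! i ≤ₙ ! lit 0 loop (p ⨾ i ≔ lit 1 ⊕ ! i)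

testOf : ∀ {r} → Cond r → ℕ → Test
testOf (leq _ _)      t = ! reg t ≤ₙ ! reg (suc t)
testOf (sums _ _ _ _) t = ‼ regᵣ t ≤ᵣ ‼ regᵣ (suc t)

module Compile (sq : Bool) where

  -- Code at height t leaves its result in register t and may use all registers from t on; `σ` lists
  -- the registers of the variables, which lie below t. Weakening thus needs no code.
  comp    : ∀ {r} → Term r → Vec ℕ r → ℕ → Program
  prelude : ∀ {r} → Cond r → Vec ℕ r → ℕ → Program
  summing : ∀ {r} → Cond (suc r) → Term (suc r) → Vec ℕ r → ℕ → Program

  comp top         (x ∷ σ) t = reg t ≔ ! reg x
  comp (wk e)      (x ∷ σ) t = comp e σ t
  comp (con v)     σ t = reg t ≔ lit v
  comp #n          σ t = reg t ≔ ! lit 0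
  comp #k          σ t = reg t ≔ ! lit 1
  comp (get a e)   σ t = comp e σ t ⨾ reg t ≔ ! cellₑ (suc a) (! reg t)
  comp (add e e′)  σ t = comp e σ t ⨾ comp e′ σ (suc t) ⨾ reg t ≔ ! reg t ⊕ ! reg (suc t)
  comp (sub e e′)  σ t = comp e σ t ⨾ comp e′ σ (suc t) ⨾ reg t ≔ ! reg t ⊖ ! reg (suc t)
  comp (halve e)   σ t = comp e σ t ⨾ reg t ≔ half (! reg t)
  comp (row e)     σ t = comp e σ t ⨾ reg t ≔ ! reg t ⊗ ! lit 0
  comp (times v e) σ t = comp e σ t ⨾ reg t ≔ lit v ⊗ ! reg t
  comp (ite c e e′) σ t = prelude c σ t ⨾ ifᵗ testOf c t then comp e σ t else comp e′ σ t
  comp (fold e b)  σ t = comp e σ t ⨾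
    loopₙ (reg (suc t)) (comp b (suc t ∷ t ∷ σ) (2 + t) ⨾ reg t ≔ ! reg (2 + t))

  prelude (leq e e′)      σ t = comp e σ t ⨾ comp e′ σ (suc t)
  prelude (sums c e c′ e′) σ t = summing c e σ t ⨾ summing c′ e′ σ (suc t)

  summing c e σ t = regᵣ t ≔ᵣ zeroᵣ ⨾
    loopₙ (reg t) (prelude c (t ∷ σ) (suc t) ⨾
      ifᵗ testOf c (suc t)
      then (comp e (t ∷ σ) (suc t) ⨾
            regᵣ t ≔ᵣ ‼ regᵣ t ⊞ weighₑ sq (‼ clampₑ (! reg (suc t))))
      else skip)

  compile : ∀ {r} → Cmd r → Vec ℕ r → ℕ → Program
  compile (put a e e′) σ t =
    comp e σ t ⨾ comp e′ σ (suc t) ⨾ cellₑ (suc a) (! reg t) ≔ ! reg (suc t)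
  compile (c ▷ c′)     σ t = compile c σ t ⨾ compile c′ σ t
  compile (when b c)   σ t = prelude b σ t ⨾ ifᵗ testOf b t then compile c σ t else skip
  compile (for c)      σ t = loopₙ (reg t) (compile c (t ∷ σ) (suc t))
  compile (bind e c)   σ t = comp e σ t ⨾ compile c (t ∷ σ) (suc t)

-- Denotational semantics of the loop language

Heap : Set
Heap = Fin 5 → ℕ → ℕ

store : Heap → Fin 5 → ℕ → ℕ → Heap
store H a i v b = if does (b Fin.≟ a) then update (H b) i v else H b

-- This is the minimum of i and `n * n ∸ 1`, written with truncated subtraction because the machine
-- has that instruction.
clamp : ℕ → ℕ → ℕ
clamp n i = i ∸ (i ∸ (n * n ∸ 1))

module Semantics (F : OrderedField 0ℓ 0ℓ 0ℓ) (sq : Bool) (n k : ℕ)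
                 (D : ℕ → OrderedField.Carrier F) where
  open OrderedField F using (Carrier; 0#) renaming (_+_ to _+ᶠ_; _*_ to _*ᶠ_; _≤?_ to _≤?ᶠ_)

  weigh : Carrier → Carrier
  weigh x = if sq then x *ᶠ x else x

  lookupᵈ : ℕ → Carrier
  lookupᵈ i = weigh (D (clamp n i))

  sumIf : (ℕ → Bool) → (ℕ → Carrier) → Carrier
  sumIf p f = foldn n 0# λ x acc → if p x then acc +ᶠ f x else acc

  infix 4 _≤ˢ_
  _≤ˢ_ : (ℕ → Bool) × (ℕ → Carrier) → (ℕ → Bool) × (ℕ → Carrier) → Bool
  (p , f) ≤ˢ (q , g) = ⌊ sumIf p f ≤?ᶠ sumIf q g ⌋

  ⟦_⟧  : ∀ {r} → Term r → Heap → Vec ℕ r → ℕ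
  ⟦_⟧ᵇ : ∀ {r} → Cond r → Heap → Vec ℕ r → Bool

  ⟦ top ⟧        H (x ∷ ρ) = x
  ⟦ wk e ⟧       H (x ∷ ρ) = ⟦ e ⟧ H ρ
  ⟦ con v ⟧      H ρ = v
  ⟦ #n ⟧         H ρ = n
  ⟦ #k ⟧         H ρ = k
  ⟦ get a e ⟧    H ρ = H a (⟦ e ⟧ H ρ)
  ⟦ add e e′ ⟧   H ρ = ⟦ e ⟧ H ρ + ⟦ e′ ⟧ H ρ
  ⟦ sub e e′ ⟧   H ρ = ⟦ e ⟧ H ρ ∸ ⟦ e′ ⟧ H ρ
  ⟦ halve e ⟧    H ρ = ⌊ ⟦ e ⟧ H ρ /2⌋
  ⟦ row e ⟧      H ρ = ⟦ e ⟧ H ρ * n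
  ⟦ times v e ⟧  H ρ = v * ⟦ e ⟧ H ρ
  ⟦ ite c e e′ ⟧ H ρ = if ⟦ c ⟧ᵇ H ρ then ⟦ e ⟧ H ρ else ⟦ e′ ⟧ H ρ
  ⟦ fold e b ⟧   H ρ = foldn n (⟦ e ⟧ H ρ) λ i acc → ⟦ b ⟧ H (i ∷ acc ∷ ρ)

  ⟦ leq e e′ ⟧ᵇ       H ρ = ⟦ e ⟧ H ρ ≤ᵇ ⟦ e′ ⟧ H ρ
  ⟦ sums c e c′ e′ ⟧ᵇ H ρ =
    ((λ x → ⟦ c ⟧ᵇ H (x ∷ ρ)) , λ x → lookupᵈ (⟦ e ⟧ H (x ∷ ρ))) ≤ˢ
    ((λ x → ⟦ c′ ⟧ᵇ H (x ∷ ρ)) , λ x → lookupᵈ (⟦ e′ ⟧ H (x ∷ ρ)))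

  exec : ∀ {r} → Cmd r → Heap → Vec ℕ r → Heap
  exec (put a e e′) H ρ = store H a (⟦ e ⟧ H ρ) (⟦ e′ ⟧ H ρ)
  exec (c ▷ c′)     H ρ = exec c′ (exec c H ρ) ρ
  exec (when b c)   H ρ = if ⟦ b ⟧ᵇ H ρ then exec c H ρ else H
  exec (for c)      H ρ = foldn n H λ i H′ → exec c H′ (i ∷ ρ)
  exec (bind e c)   H ρ = exec c H (⟦ e ⟧ H ρ ∷ ρ)

-- Memory cells and bit lengths

update-≡ : ∀ {a} {A : Set a} (f : ℕ → A) x v → update f x v x ≡ v
update-≡ f x v with x ≡ᵇ x in eq
... | true  = refl
... | false = ⊥-elim (subst T eq (≡⇒≡ᵇ x x refl))

update-≢ : ∀ {a} {A : Set a} (f : ℕ → A) {x y} v → y ≢ x → update f x v y ≡ f y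
update-≢ f {x} {y} v y≢x with y ≡ᵇ x in eq
... | true  = ⊥-elim (y≢x (≡ᵇ⇒≡ y x (subst T (sym eq) tt)))
... | false = refl

≤ᵇ-true : ∀ {a b} → a ≤ b → (a ≤ᵇ b) ≡ true
≤ᵇ-true {a} {b} a≤b with a ≤ᵇ b | ≤⇒≤ᵇ a≤b
... | true | _ = refl

≤ᵇ-false : ∀ {a b} → b < a → (a ≤ᵇ b) ≡ false
≤ᵇ-false {a} {b} b<a with a ≤ᵇ b in eq
... | false = refl
... | true  = ⊥-elim (<⇒≱ b<a (≤ᵇ⇒≤ a b (subst T (sym eq) tt)))

-- Uniqueness of quotient and remainder modulo 6, by induction on the quotients. It keeps the
-- registers and the five arrays apart.
cell-injective : ∀ {c c′} i j → cell c i ≡ cell c′ j → c ≡ c′ × i ≡ j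
cell-injective {c} {c′} i j eq = go i j (cong (_∸ 2) eq)
  where
  go : ∀ i j → i * 6 + toℕ c ≡ j * 6 + toℕ c′ → c ≡ c′ × i ≡ j
  go zero    zero    eq = Finₚ.toℕ-injective eq , refl
  go zero    (suc j) eq = ⊥-elim (<⇒≱ (Finₚ.toℕ<n c) (≤-trans (m≤m+n 6 _) (≤-reflexive (sym eq))))
  go (suc i) zero    eq = ⊥-elim (<⇒≱ (Finₚ.toℕ<n c′) (≤-trans (m≤m+n 6 _) (≤-reflexive eq)))
  go (suc i) (suc j) eq with go i j (cong (_∸ 6) eq)
  ... | c≡c′ , i≡j = c≡c′ , cong suc i≡j

bits≤ : ∀ {v} m → v ≤ 2 ^ m → bits v ≤ suc m
bits≤ m v≤ = s≤s (≤-trans (⌊log₂⌋-mono-≤ v≤) (≤-reflexive (⌊log₂[2^n]⌋≡n m)))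

+-^ : ∀ {x y} a b → x ≤ 2 ^ a → y ≤ 2 ^ b → x + y ≤ 2 ^ (1 + (a + b))
+-^ {x} {y} a b x≤ y≤ = begin
  x + y                       ≤⟨ +-mono-≤ x≤ y≤ ⟩
  2 ^ a + 2 ^ b               ≤⟨ +-mono-≤ (^-monoʳ-≤ 2 (m≤m+n a b)) (^-monoʳ-≤ 2 (m≤n+m b a)) ⟩
  2 ^ (a + b) + 2 ^ (a + b)   ≡⟨ cong (2 ^ (a + b) +_) (+-identityʳ _) ⟨
  2 ^ (1 + (a + b))           ∎
  where open ≤-Reasoning

*-^ : ∀ {x y} a b → x ≤ 2 ^ a → y ≤ 2 ^ b → x * y ≤ 2 ^ (a + b)
*-^ a b x≤ y≤ = ≤-trans (*-mono-≤ x≤ y≤) (≤-reflexive (sym (^-distribˡ-+-* 2 a b)))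

v≤2^v : ∀ v → v ≤ 2 ^ v
v≤2^v v = <⇒≤ (n<2^n v)

^-mono : ∀ {a b x} → x ≤ 2 ^ a → a ≤ b → x ≤ 2 ^ b
^-mono x≤ a≤b = ≤-trans x≤ (^-monoʳ-≤ 2 a≤b)

-- Polynomial time bounds read off the source

valP timeP : NatExp → Poly
valP (lit v)  = :c v
valP (! e)    = :X
valP (e ⊕ e′) = :c 1 :+ (valP e :+ valP e′)
valP (e ⊖ e′) = valP e
valP (e ⊗ e′) = valP e :+ valP e′
valP (half e) = valP e
timeP (lit v)  = :c (suc v)
timeP (! e)    = (:c 1 :+ :X) :+ timeP e
timeP (e ⊕ e′) = (:c 1 :+ valP (e ⊕ e′)) :+ (timeP e :+ timeP e′)
timeP (e ⊖ e′) = (:c 1 :+ valP e) :+ (timeP e :+ timeP e′)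
timeP (e ⊗ e′) = (:c 1 :+ valP (e ⊗ e′)) :+ (timeP e :+ timeP e′)
timeP (half e) = (:c 1 :+ valP e) :+ timeP e

timeᵣP : FieldExp → Poly
timeᵣP zeroᵣ    = :c 1
timeᵣP oneᵣ     = :c 1
timeᵣP (‼ e)    = :c 1 :+ timeP e
timeᵣP (q ⊞ q′) = :c 1 :+ (timeᵣP q :+ timeᵣP q′)
timeᵣP (q ⊟ q′) = :c 1 :+ (timeᵣP q :+ timeᵣP q′)
timeᵣP (q ⊠ q′) = :c 1 :+ (timeᵣP q :+ timeᵣP q′)

timeᵗP : Test → Poly
timeᵗP (e ≤ₙ e′) = :c 1 :+ (timeP e :+ timeP e′)
timeᵗP (q ≤ᵣ q′) = :c 1 :+ (timeᵣP q :+ timeᵣP q′)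

asgP : NatExp → NatExp → Poly
asgP a e = :c 1 :+ (timeP a :+ timeP e)

asgᵣP : NatExp → FieldExp → Poly
asgᵣP a q = :c 1 :+ (timeP a :+ timeᵣP q)

loopP : NatExp → Poly → Poly
loopP i p = asgP i (lit 0) :+ (test :+ :X :* (test :+ (p :+ asgP i (lit 1 ⊕ ! i))))
  where
  test : Poly
  test = timeᵗP (lit 1 ⊕ ! i ≤ₙ ! lit 0)

-- A value of growth g is at most 2 ^ (μ + g n) when all inputs are at most 2 ^ μ.
-- That the growth is additive in the exponent keeps iterated folds polynomial.

growth : ∀ {r} → Term r → Poly
growth top          = :c 0
growth (wk e)       = growth e
growth (con v)      = :c v
growth #n           = :c 0
growth #k           = :c 0
growth (get a e)    = :c 0
growth (add e e′)   = :c 1 :+ (growth e :+ growth e′)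
growth (sub e e′)   = growth e
growth (halve e)    = growth e
growth (row e)      = growth e :+ :X
growth (times v e)  = :c v :+ growth e
growth (ite c e e′) = growth e :+ growth e′
growth (fold e b)   = growth e :+ :X :* growth b

growthᶜ : ∀ {r} → Cmd r → Poly
growthᶜ (put a e e′) = growth e′
growthᶜ (c ▷ c′)     = growthᶜ c :+ growthᶜ c′
growthᶜ (when b c)   = growthᶜ c
growthᶜ (for c)      = :X :* growthᶜ c
growthᶜ (bind e c)   = growth e :+ growthᶜ c

val : ∀ {r} → Term r → Poly
val e = :X :+ growth e

foldVal : ∀ {r} → Term r → Term (2 + r) → Poly
foldVal e b = :X :+ (growth e :+ :X :* growth b)

costTest : ∀ {r} → Cond r → ℕ → Poly
costTest c@(leq e e′) t = timeᵗP (testOf c t) :∘ (val e :+ growth e′)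
costTest c@(sums _ _ _ _) t = timeᵗP (testOf c t)

module Cost (sq : Bool) where

  cost    : ∀ {r} → Term r → Vec ℕ r → ℕ → Poly
  costᵇ   : ∀ {r} → Cond r → Vec ℕ r → ℕ → Poly
  costSum : ∀ {r} → Cond (suc r) → Term (suc r) → Vec ℕ r → ℕ → Poly

  cost top         (x ∷ σ) t = asgP (reg t) (! reg x)
  cost (wk e)      (x ∷ σ) t = cost e σ t
  cost (con v)     σ t = asgP (reg t) (lit v)
  cost #n          σ t = asgP (reg t) (! lit 0)
  cost #k          σ t = asgP (reg t) (! lit 1)
  cost (get a e)   σ t = cost e σ t :+ asgP (reg t) (! cellₑ (suc a) (! reg t)) :∘ val e
  cost (add e e′)  σ t = cost e σ t :+ (cost e′ σ (suc t) :+
    asgP (reg t) (! reg t ⊕ ! reg (suc t)) :∘ (val e :+ growth e′))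
  cost (sub e e′)  σ t = cost e σ t :+ (cost e′ σ (suc t) :+
    asgP (reg t) (! reg t ⊖ ! reg (suc t)) :∘ (val e :+ growth e′))
  cost (halve e)   σ t = cost e σ t :+ asgP (reg t) (half (! reg t)) :∘ val e
  cost (row e)     σ t = cost e σ t :+ asgP (reg t) (! reg t ⊗ ! lit 0) :∘ val e
  cost (times v e) σ t = cost e σ t :+ asgP (reg t) (lit v ⊗ ! reg t) :∘ val e
  cost (ite c e e′) σ t = costᵇ c σ t :+ (costTest c t :+ (cost e σ t :+ cost e′ σ t))
  cost (fold e b)  σ t = cost e σ t :+ loopP (reg (suc t))
    (cost b (suc t ∷ t ∷ σ) (2 + t) :∘ foldVal e b :+ asgP (reg t) (! reg (2 + t)) :∘ foldVal e b)

  costᵇ (leq e e′)       σ t = cost e σ t :+ cost e′ σ (suc t)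
  costᵇ (sums c e c′ e′) σ t = costSum c e σ t :+ costSum c′ e′ σ (suc t)

  costSum c e σ t = asgᵣP (regᵣ t) zeroᵣ :+ loopP (reg t)
    (costᵇ c (t ∷ σ) (suc t) :+ (costTest c (suc t) :+ ((cost e (t ∷ σ) (suc t) :+
      asgᵣP (regᵣ t) (‼ regᵣ t ⊞ weighₑ sq (‼ clampₑ (! reg (suc t)))) :∘ val e) :+ :c 1)))

  costᶜ : ∀ {r} → Cmd r → Vec ℕ r → ℕ → Poly
  costᶜ (put a e e′) σ t = cost e σ t :+ (cost e′ σ (suc t) :+
    asgP (cellₑ (suc a) (! reg t)) (! reg (suc t)) :∘ (val e :+ growth e′))
  costᶜ (c ▷ c′)     σ t = costᶜ c σ t :+ costᶜ c′ σ t :∘ (:X :+ growthᶜ c)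
  costᶜ (when b c)   σ t = costᵇ b σ t :+ (costTest b t :+ (costᶜ c σ t :+ :c 1))
  costᶜ (for c)      σ t = loopP (reg t) (costᶜ c (t ∷ σ) (suc t) :∘ (:X :+ :X :* growthᶜ c))
  costᶜ (bind e c)   σ t = cost e σ t :+ costᶜ c (t ∷ σ) (suc t) :∘ val e

-- Hoare triples with time bounds

module Hoare (F : OrderedField 0ℓ 0ℓ 0ℓ) where
  open OrderedField F using (Carrier)
  open Machine F

  Outcome : Program → State → (State → Set) → ℕ → Set
  Outcome p s Q b = Σ[ s′ ∈ State ] Σ[ τ ∈ ℕ ] ([ p , s ]⇓[ s′ , τ ] × Q s′ × τ ≤ b)

  relax : ∀ {p s b b′} {Q Q′ : State → Set} →
    (∀ s′ → Q s′ → Q′ s′) → b ≤ b′ → Outcome p s Q b → Outcome p s Q′ b′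
  relax Q⇒Q′ b≤b′ (s′ , τ , run , q , τ≤b) = s′ , τ , run , Q⇒Q′ s′ q , ≤-trans τ≤b b≤b′

  infixr 4 _>>_
  _>>_ : ∀ {p p′ s b b′} {Q Q′ : State → Set} →
    Outcome p s Q b → (∀ s′ → Q s′ → Outcome p′ s′ Q′ b′) → Outcome (p ⨾ p′) s Q′ (b + b′)
  (s′ , τ , run , q , τ≤b) >> next with next s′ q
  ... | s″ , τ′ , run′ , q′ , τ′≤b′ = s″ , τ + τ′ , ⇓-⨾ run run′ , q′ , +-mono-≤ τ≤b τ′≤b′

  skipping : ∀ {s} {Q : State → Set} → Q s → Outcome skip s Q 1
  skipping q = _ , 1 , ⇓-skip , q , ≤-refl

  branch : ∀ {c p p′ s β b T} {Q : State → Set} → evalᵗ c s ≡ β → timeᵗ c s ≤ T →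
    (β ≡ true → Outcome p s Q b) → (β ≡ false → Outcome p′ s Q b) →
    Outcome (ifᵗ c then p else p′) s Q (T + b)
  branch {β = true} test T≥ yes′ no′ with yes′ refl
  ... | s′ , τ , run , q , τ≤b = s′ , _ , ⇓-then test run , q , +-mono-≤ T≥ τ≤b
  branch {β = false} test T≥ yes′ no′ with no′ refl
  ... | s′ , τ , run , q , τ≤b = s′ , _ , ⇓-else test run , q , +-mono-≤ T≥ τ≤b

  iterating : ∀ {c p T B} (N : ℕ) (I : ℕ → State → Set) →
    (∀ i s → i < N → I i s → evalᵗ c s ≡ true × timeᵗ c s ≤ T × Outcome p s (I (suc i)) B) →
    (∀ s → I N s → evalᵗ c s ≡ false × timeᵗ c s ≤ T) →
    ∀ {s} → I 0 s → Outcome (while c loop p) s (I N) (T + N * (T + B))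
  iterating {c} {p} {T} {B} N I step stop = go N 0 refl
    where
    go : ∀ m i → i + m ≡ N → ∀ {s} → I i s → Outcome (while c loop p) s (I N) (T + m * (T + B))
    go zero i eq {s} inv with refl ← trans (sym (+-identityʳ i)) eq with stop s inv
    ... | test , T≥ = s , _ , ⇓-stop test , inv , ≤-trans T≥ (m≤m+n T _)
    go (suc m) i eq {s} inv
      with step i s (≤-trans (≤-trans (m≤m+n (suc i) m) (≤-reflexive (sym (+-suc i m)))) (≤-reflexive eq)) inv
    ... | test , T≥ , s′ , τ , run , inv′ , τ≤B
      with go m (suc i) (trans (sym (+-suc i m)) eq) inv′
    ... | s″ , τ′ , run′ , inv″ , τ′≤ = s″ , _ , ⇓-loop test run run′ , inv″ , (begin
      timeᵗ c s + (τ + τ′)                  ≤⟨ +-mono-≤ T≥ (+-mono-≤ τ≤B τ′≤) ⟩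
      T + (B + (T + m * (T + B)))           ≡⟨ cong (T +_) (+-assoc B T _) ⟨
      T + (B + T + m * (T + B))             ≡⟨ cong (λ z → T + (z + m * (T + B))) (+-comm B T) ⟩
      T + (T + B + m * (T + B))             ∎)
      where open ≤-Reasoning

  -- All cells that the evaluation looks up hold at most 2 ^ M. Evaluated at M, `valP` then bounds
  -- the exponent of the value and `timeP` the time.
  Reads : ℕ → NatExp → State → Set
  Reads M (lit v)  s = ⊤
  Reads M (! e)    s = Reads M e s × nat s (evalₙ e s) ≤ 2 ^ M
  Reads M (e ⊕ e′) s = Reads M e s × Reads M e′ s
  Reads M (e ⊖ e′) s = Reads M e s × Reads M e′ s
  Reads M (e ⊗ e′) s = Reads M e s × Reads M e′ s
  Reads M (half e) s = Reads M e s

  val≤ : ∀ {M s} e → Reads M e s → evalₙ e s ≤ 2 ^ ⟪ valP e ⟫ M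
  val≤ (lit v)  r        = v≤2^v v
  val≤ (! e)    (_ , v≤) = v≤
  val≤ (e ⊕ e′) (r , r′) = +-^ (⟪ valP e ⟫ _) (⟪ valP e′ ⟫ _) (val≤ e r) (val≤ e′ r′)
  val≤ {s = s} (e ⊖ e′) (r , r′) = ≤-trans (m∸n≤m _ (evalₙ e′ s)) (val≤ e r)
  val≤ (e ⊗ e′) (r , r′) = *-^ (⟪ valP e ⟫ _) (⟪ valP e′ ⟫ _) (val≤ e r) (val≤ e′ r′)
  val≤ (half e) r        = ≤-trans (⌊n/2⌋≤n _) (val≤ e r)

  time≤ : ∀ {M s} e → Reads M e s → timeₙ e s ≤ ⟪ timeP e ⟫ M
  time≤ (lit v)         _        = bits≤ v (v≤2^v v)
  time≤ (! e)           (r , v≤) = +-mono-≤ (bits≤ _ v≤) (time≤ e r)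
  time≤ {M} o@(e ⊕ e′)  (r , r′) =
    +-mono-≤ (bits≤ (⟪ valP o ⟫ M) (val≤ o (r , r′))) (+-mono-≤ (time≤ e r) (time≤ e′ r′))
  time≤ {M} o@(e ⊖ e′)  (r , r′) =
    +-mono-≤ (bits≤ (⟪ valP o ⟫ M) (val≤ o (r , r′))) (+-mono-≤ (time≤ e r) (time≤ e′ r′))
  time≤ {M} o@(e ⊗ e′)  (r , r′) =
    +-mono-≤ (bits≤ (⟪ valP o ⟫ M) (val≤ o (r , r′))) (+-mono-≤ (time≤ e r) (time≤ e′ r′))
  time≤ {M} o@(half e)  r        =
    +-mono-≤ (bits≤ (⟪ valP o ⟫ M) (val≤ o r)) (time≤ e r)

  Readsᵣ : ℕ → FieldExp → State → Set
  Readsᵣ M zeroᵣ    s = ⊤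
  Readsᵣ M oneᵣ     s = ⊤
  Readsᵣ M (‼ e)    s = Reads M e s
  Readsᵣ M (q ⊞ q′) s = Readsᵣ M q s × Readsᵣ M q′ s
  Readsᵣ M (q ⊟ q′) s = Readsᵣ M q s × Readsᵣ M q′ s
  Readsᵣ M (q ⊠ q′) s = Readsᵣ M q s × Readsᵣ M q′ s

  timeᵣ≤ : ∀ {M s} q → Readsᵣ M q s → timeᵣ q s ≤ ⟪ timeᵣP q ⟫ M
  timeᵣ≤ zeroᵣ    _        = ≤-refl
  timeᵣ≤ oneᵣ     _        = ≤-refl
  timeᵣ≤ (‼ e)    r        = s≤s (time≤ e r)
  timeᵣ≤ (q ⊞ q′) (r , r′) = s≤s (+-mono-≤ (timeᵣ≤ q r) (timeᵣ≤ q′ r′))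
  timeᵣ≤ (q ⊟ q′) (r , r′) = s≤s (+-mono-≤ (timeᵣ≤ q r) (timeᵣ≤ q′ r′))
  timeᵣ≤ (q ⊠ q′) (r , r′) = s≤s (+-mono-≤ (timeᵣ≤ q r) (timeᵣ≤ q′ r′))

  _[_≔ⁿ_] : State → ℕ → ℕ → State
  s [ a ≔ⁿ v ] = ⟨ update (nat s) a v , real s ⟩

  _[_≔ʳ_] : State → ℕ → Carrier → State
  s [ a ≔ʳ x ] = ⟨ nat s , update (real s) a x ⟩

  assign : ∀ {M s} a e → Reads M a s → Reads M e s →
    Outcome (a ≔ e) s (_≡ s [ evalₙ a s ≔ⁿ evalₙ e s ]) (⟪ asgP a e ⟫ M)
  assign a e r r′ = _ , _ , ⇓-≔ , refl , s≤s (+-mono-≤ (time≤ a r) (time≤ e r′))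

  assignᵣ : ∀ {M s} a q → Reads M a s → Readsᵣ M q s →
    Outcome (a ≔ᵣ q) s (_≡ s [ evalₙ a s ≔ʳ evalᵣ q s ]) (⟪ asgᵣP a q ⟫ M)
  assignᵣ a q r r′ = _ , _ , ⇓-≔ᵣ , refl , s≤s (+-mono-≤ (time≤ a r) (timeᵣ≤ q r′))

-- The machine simulates the loop language

module Simulation (F : OrderedField 0ℓ 0ℓ 0ℓ) (sq : Bool) (n k : ℕ) (1≤n : 1 ≤ n)
                  (D : ℕ → OrderedField.Carrier F) where
  open OrderedField F using (Carrier; 0#) renaming (_+_ to _+ᶠ_; _*_ to _*ᶠ_; _≤?_ to _≤?ᶠ_)
  open Machine F
  open Hoare F
  open Semantics F sq n k D
  open Compile sq
  open Cost sq

  -- Bit lengths and not values are measured by μ: heap cells and variables lie below 2 ^ μ, whereas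
  -- n and k lie below μ itself, so that numbers of rounds can be absorbed by polynomials in μ.
  record Ctx {r} (μ : ℕ) (H : Heap) (ρ : Vec ℕ r) : Set where
    constructor ctx
    field
      n≤μ   : n ≤ μ
      k≤μ   : k ≤ μ
      heap≤ : ∀ a i → H a i ≤ 2 ^ μ
      env≤  : All (_≤ 2 ^ μ) ρ
  open Ctx

  extend : ∀ {r μ μ′ H v} {ρ : Vec ℕ r} → Ctx μ H ρ → v ≤ 2 ^ μ′ → μ ≤ μ′ → Ctx μ′ H (v ∷ ρ)
  extend {μ′ = μ′} C v≤ μ≤ = ctx (≤-trans (n≤μ C) μ≤) (≤-trans (k≤μ C) μ≤)
    (λ a i → ^-mono (heap≤ C a i) μ≤) (v≤ ∷ All.map (λ x≤ → ^-mono x≤ μ≤) (env≤ C))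

  index≤ : ∀ {r μ H i} {ρ : Vec ℕ r} → Ctx μ H ρ → i ≤ n → i ≤ 2 ^ μ
  index≤ C i≤n = ≤-trans i≤n (≤-trans (n≤μ C) (v≤2^v _))

  bounded : ∀ {r} (e : Term r) {μ H ρ} → Ctx μ H ρ → ⟦ e ⟧ H ρ ≤ 2 ^ (μ + ⟪ growth e ⟫ n)

  fold-bounded : ∀ {r} (e : Term r) (b : Term (2 + r)) {μ H ρ} → Ctx μ H ρ → ∀ i → i ≤ n →
    foldn i (⟦ e ⟧ H ρ) (λ j acc → ⟦ b ⟧ H (j ∷ acc ∷ ρ)) ≤ 2 ^ (μ + (⟪ growth e ⟫ n + i * ⟪ growth b ⟫ n))

  bounded top {μ} {ρ = x ∷ ρ} C = ^-mono {μ} (All.head (env≤ C)) (m≤m+n μ 0)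
  bounded (wk e) {ρ = x ∷ ρ} (ctx n≤ k≤ h≤ (_ ∷ e≤)) = bounded e (ctx n≤ k≤ h≤ e≤)
  bounded (con v) {μ} C = ^-mono (v≤2^v v) (m≤n+m v μ)
  bounded #n {μ} C = ^-mono {μ} (index≤ C ≤-refl) (m≤m+n μ 0)
  bounded #k {μ} C = ^-mono {k} (v≤2^v k) (≤-trans (k≤μ C) (m≤m+n μ 0))
  bounded (get a e) {μ} C = ^-mono {μ} (heap≤ C a _) (m≤m+n μ 0)
  bounded (add e e′) {μ} {H} {ρ} C = let x = ⟪ growth e ⟫ n ; y = ⟪ growth e′ ⟫ n in begin
    ⟦ e ⟧ H ρ + ⟦ e′ ⟧ H ρ                   ≤⟨ +-mono-≤ (^-mono (bounded e C) (+-monoʳ-≤ μ (m≤m+n x y)))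
                                                         (^-mono (bounded e′ C) (+-monoʳ-≤ μ (m≤n+m y x))) ⟩
    2 ^ (μ + (x + y)) + 2 ^ (μ + (x + y))    ≡⟨ cong (2 ^ (μ + (x + y)) +_) (+-identityʳ _) ⟨
    2 ^ (1 + (μ + (x + y)))                  ≡⟨ cong (2 ^_) (+-suc μ (x + y)) ⟨
    2 ^ (μ + (1 + (x + y)))                  ∎
    where open ≤-Reasoning
  bounded (sub e e′) {H = H} {ρ} C = ≤-trans (m∸n≤m _ (⟦ e′ ⟧ H ρ)) (bounded e C)
  bounded (halve e) C = ≤-trans (⌊n/2⌋≤n _) (bounded e C)
  bounded (row e) {μ} C = ≤-trans (*-^ (μ + ⟪ growth e ⟫ n) n (bounded e C) (v≤2^v n))
    (≤-reflexive (cong (2 ^_) (+-assoc μ _ n)))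
  bounded (times v e) {μ} C = ≤-trans (*-^ v (μ + ⟪ growth e ⟫ n) (v≤2^v v) (bounded e C))
    (≤-reflexive (cong (2 ^_) (trans (sym (+-assoc v μ _)) (trans (cong (_+ ⟪ growth e ⟫ n) (+-comm v μ)) (+-assoc μ v _)))))
  bounded (ite c e e′) {μ} {H} {ρ} C with ⟦ c ⟧ᵇ H ρ
  ... | true  = ^-mono (bounded e C) (+-monoʳ-≤ μ (m≤m+n _ _))
  ... | false = ^-mono (bounded e′ C) (+-monoʳ-≤ μ (m≤n+m _ _))
  bounded (fold e b) C = fold-bounded e b C n ≤-refl

  fold-bounded e b {μ} C zero i≤n = ^-mono (bounded e C) (+-monoʳ-≤ μ (m≤m+n _ 0))
  fold-bounded e b {μ} C (suc i) i<n =
    -- The body is bounded in the context enlarged by what the accumulator has reached after i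
    -- rounds, so that this round adds `growth b` to the exponent.
    ^-mono (bounded b (extend (extend C (fold-bounded e b C i (<⇒≤ i<n)) (m≤m+n μ _))
                              (^-mono (index≤ C (<⇒≤ i<n)) (m≤m+n μ _)) ≤-refl))
      (≤-reflexive (let x = ⟪ growth e ⟫ n ; y = ⟪ growth b ⟫ n in begin
        μ + (x + i * y) + y     ≡⟨ +-assoc μ _ y ⟩
        μ + (x + i * y + y)     ≡⟨ cong (μ +_) (+-assoc x (i * y) y) ⟩
        μ + (x + (i * y + y))   ≡⟨ cong (λ z → μ + (x + z)) (+-comm (i * y) y) ⟩
        μ + (x + suc i * y)     ∎))
    where open ≡-Reasoning

  reg-val : ℕ → State → ℕ
  reg-val t s = nat s (cell zero t)

  Env : ∀ {r} → State → Vec ℕ r → Vec ℕ r → Set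
  Env s []      []      = ⊤
  Env s (x ∷ σ) (v ∷ ρ) = reg-val x s ≡ v × Env s σ ρ

  record Sim (s : State) (H : Heap) : Set where
    constructor sim
    field
      size≡  : nat s 0 ≡ n
      k≡     : nat s 1 ≡ k
      heap≡  : ∀ a i → nat s (cell (suc a) i) ≡ H a i
      dist≡  : ∀ i → i < n * n → real s i ≡ D i
  open Sim

  -- The frame condition of code at height t: values parked in registers below t survive the
  -- evaluation of further subterms.
  record Kept (t : ℕ) (s s′ : State) : Set where
    constructor kept
    field
      regs  : ∀ i → i < t → reg-val i s′ ≡ reg-val i s
      regsʳ : ∀ i → i < t → real s′ (n * n + i) ≡ real s (n * n + i)
  open Kept

  kept-refl : ∀ {t s} → Kept t s s
  kept-refl = kept (λ _ _ → refl) (λ _ _ → refl)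

  kept-trans : ∀ {t t′ s s′ s″} → t ≤ t′ → Kept t s s′ → Kept t′ s′ s″ → Kept t s s″
  kept-trans t≤t′ K K′ = kept
    (λ i i<t → trans (regs K′ i (≤-trans i<t t≤t′)) (regs K i i<t))
    (λ i i<t → trans (regsʳ K′ i (≤-trans i<t t≤t′)) (regsʳ K i i<t))

  env-kept : ∀ {r t s s′} {σ ρ : Vec ℕ r} → All (_< t) σ → Kept t s s′ → Env s σ ρ → Env s′ σ ρ
  env-kept {σ = []}    {[]}    []          K E       = tt
  env-kept {σ = x ∷ σ} {v ∷ ρ} (x<t ∷ σ<t) K (e , E) = trans (regs K x x<t) e , env-kept σ<t K E

  below-suc : ∀ {r t} {σ : Vec ℕ r} → All (_< t) σ → All (_< suc t) σ
  below-suc = All.map m<n⇒m<1+n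

  set : State → ℕ → ℕ → State
  set s t v = s [ cell zero t ≔ⁿ v ]

  set-≡ : ∀ s t v → reg-val t (set s t v) ≡ v
  set-≡ s t v = update-≡ (nat s) (cell zero t) v

  set-≢ : ∀ s {t i} v → i ≢ t → reg-val i (set s t v) ≡ reg-val i s
  set-≢ s {t} {i} v i≢t = update-≢ (nat s) v λ eq → i≢t (proj₂ (cell-injective {zero} {zero} i t eq))

  set-sim : ∀ {s H} t v → Sim s H → Sim (set s t v) H
  set-sim {s} t v S = sim (size≡ S) (k≡ S)
    (λ a i → trans (update-≢ (nat s) v λ eq → case proj₁ (cell-injective {suc a} {zero} i t eq) of λ ()) (heap≡ S a i))
    (dist≡ S)

  set-kept : ∀ s t v → Kept t s (set s t v)
  set-kept s t v = kept (λ i i<t → set-≢ s v (<⇒≢ i<t)) (λ _ _ → refl)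

  setʳ : State → ℕ → Carrier → State
  setʳ s t x = s [ n * n + t ≔ʳ x ]

  setʳ-sim : ∀ {s H} t x → Sim s H → Sim (setʳ s t x) H
  setʳ-sim {s} t x S = sim (size≡ S) (k≡ S) (heap≡ S)
    (λ i i< → trans (update-≢ (real s) x (<⇒≢ (≤-trans i< (m≤m+n (n * n) t)))) (dist≡ S i i<))

  setʳ-kept : ∀ s t x → Kept t s (setʳ s t x)
  setʳ-kept s t x = kept (λ _ _ → refl)
    (λ i i<t → update-≢ (real s) x (<⇒≢ (+-monoʳ-< (n * n) i<t)))

  -- The counter is register t. The invariant has to survive writes to it (`stable`) and the body
  -- has to hand it back unchanged; `n ≤ μ` replaces the number of rounds by μ in the bound.
  loops : ∀ t p {s B μ} (J : ℕ → State → Set) → n ≤ μ →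
    (∀ i s → J i s → nat s 0 ≡ n) →
    (∀ i s v → J i s → J i (set s t v)) →
    (∀ i s → i < n → J i s → reg-val t s ≡ i → Outcome p s (λ s′ → J (suc i) s′ × reg-val t s′ ≡ i) (⟪ B ⟫ μ)) →
    J 0 s → Outcome (loopₙ (reg t) p) s (J n) (⟪ loopP (reg t) B ⟫ μ)
  loops t p {s} {B} {μ} J n≤μ size stable body J₀ =
    assign {μ} (reg t) (lit 0) _ _ >> λ { s′ refl →
    relax (λ _ → proj₁) (+-monoʳ-≤ (⟪ timeᵗP (lit 1 ⊕ ! reg t ≤ₙ ! lit 0) ⟫ μ) (*-monoˡ-≤ _ n≤μ))
      (iterating n (λ i s → J i s × reg-val t s ≡ i) step stop (stable 0 s 0 J₀ , set-≡ s t 0)) }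
    where
    time : ∀ {i} s → i ≤ n → J i s → reg-val t s ≡ i →
      timeᵗ (lit 1 ⊕ ! reg t ≤ₙ ! lit 0) s ≤ ⟪ timeᵗP (lit 1 ⊕ ! reg t ≤ₙ ! lit 0) ⟫ μ
    time {i} s i≤n j c = s≤s (+-mono-≤
      (time≤ {μ} {s} (lit 1 ⊕ ! reg t) (tt , tt , ≤-trans (≤-reflexive c) (≤-trans (≤-trans i≤n n≤μ) (v≤2^v μ))))
      (time≤ {μ} {s} (! lit 0) (tt , ≤-trans (≤-reflexive (size i s j)) (≤-trans n≤μ (v≤2^v μ)))))
    step : ∀ i s → i < n → J i s × reg-val t s ≡ i → _ × _ × _
    step i s i<n (j , c) = trans (cong₂ (λ x y → suc x ≤ᵇ y) c (size i s j)) (≤ᵇ-true i<n)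
      , time s (<⇒≤ i<n) j c
      , (body i s i<n j c >> λ s′ (j′ , c′) →
         relax (λ { _ refl → stable (suc i) s′ _ j′ , trans (set-≡ s′ t _) (cong suc c′) }) ≤-refl
           (assign (reg t) (lit 1 ⊕ ! reg t) _
             (tt , tt , ≤-trans (≤-reflexive c′) (≤-trans (≤-trans (<⇒≤ i<n) n≤μ) (v≤2^v μ)))))
    stop : ∀ s → J n s × reg-val t s ≡ n → _ × _
    stop s (j , c) = trans (cong₂ (λ x y → suc x ≤ᵇ y) c (size n s j)) (≤ᵇ-false (n<1+n n))
      , time s ≤-refl j c

  clamp-below : ∀ i → clamp n i < n * n
  clamp-below i with n * n | *-mono-≤ 1≤n 1≤n
  ... | suc m | _ with ≤-total i m
  ...   | inj₁ i≤m = s≤s (≤-trans (m∸n≤m i (i ∸ m)) i≤m)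
  ...   | inj₂ m≤i = s≤s (≤-reflexive (m∸[m∸n]≡n m≤i))

  Yields : ∀ {r} → ℕ → State → Heap → Term r → Vec ℕ r → State → Set
  Yields t s H e ρ s′ = Sim s′ H × Kept t s s′ × reg-val t s′ ≡ ⟦ e ⟧ H ρ

  Decides : ∀ {r} → ℕ → ℕ → State → Heap → Cond r → Vec ℕ r → State → Set
  Decides t μ s H c ρ s′ = Sim s′ H × Kept t s s′ × evalᵗ (testOf c t) s′ ≡ ⟦ c ⟧ᵇ H ρ ×
    timeᵗ (testOf c t) s′ ≤ ⟪ costTest c t ⟫ μ

  val-bound : ∀ {r} (e : Term r) {μ H ρ} → Ctx μ H ρ → ⟦ e ⟧ H ρ ≤ 2 ^ ⟪ val e ⟫ μ
  val-bound e {μ} C = ^-mono (bounded e C) (+-monoʳ-≤ μ (⟪⟫-mono (growth e) (n≤μ C)))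

  val₁-bound : ∀ {r} (e e′ : Term r) {μ H ρ} → Ctx μ H ρ → ⟦ e ⟧ H ρ ≤ 2 ^ ⟪ val e :+ growth e′ ⟫ μ
  val₁-bound e e′ {μ} C = ^-mono (val-bound e C) (m≤m+n (⟪ val e ⟫ μ) _)

  val₂-bound : ∀ {r} (e e′ : Term r) {μ H ρ} → Ctx μ H ρ → ⟦ e′ ⟧ H ρ ≤ 2 ^ ⟪ val e :+ growth e′ ⟫ μ
  val₂-bound e e′ {μ} C = ^-mono (val-bound e′ C) (+-monoˡ-≤ _ (m≤m+n μ _))

  foldVal-bound : ∀ {r} (e : Term r) b {μ H ρ} → Ctx μ H ρ → ∀ i → i ≤ n →
    foldn i (⟦ e ⟧ H ρ) (λ j acc → ⟦ b ⟧ H (j ∷ acc ∷ ρ)) ≤ 2 ^ ⟪ foldVal e b ⟫ μ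
  foldVal-bound e b {μ} C i i≤n = ^-mono (fold-bounded e b C i i≤n) (+-monoʳ-≤ μ
    (+-mono-≤ (⟪⟫-mono (growth e) (n≤μ C)) (*-mono-≤ (≤-trans i≤n (n≤μ C)) (⟪⟫-mono (growth b) (n≤μ C)))))

  as-≤ : ∀ {x y b} → x ≡ y → y ≤ b → x ≤ b
  as-≤ refl y≤b = y≤b

  setting : ∀ {M s s₀ H v} t e → Sim s H → Kept t s₀ s → Reads M e s → evalₙ e s ≡ v →
    Outcome (reg t ≔ e) s (λ s′ → Sim s′ H × Kept t s₀ s′ × reg-val t s′ ≡ v) (⟪ asgP (reg t) e ⟫ M)
  setting {s = s} t e S K r eq =
    relax (λ { _ refl → set-sim t _ S , kept-trans ≤-refl K (set-kept s t _) , trans (set-≡ s t _) eq })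
      ≤-refl (assign (reg t) e _ r)

  run-term : ∀ {r} (e : Term r) {σ t s H μ ρ} → All (_< t) σ → Env s σ ρ → Ctx μ H ρ → Sim s H →
    Outcome (comp e σ t) s (Yields t s H e ρ) (⟪ cost e σ t ⟫ μ)
  run-cond : ∀ {r} (c : Cond r) {σ t s H μ ρ} → All (_< t) σ → Env s σ ρ → Ctx μ H ρ → Sim s H →
    Outcome (prelude c σ t) s (Decides t μ s H c ρ) (⟪ costᵇ c σ t ⟫ μ)
  run-sum : ∀ {r} (c : Cond (suc r)) (e : Term (suc r)) {σ t s H μ ρ} →
    All (_< t) σ → Env s σ ρ → Ctx μ H ρ → Sim s H →
    Outcome (summing c e σ t) s
      (λ s′ → Sim s′ H × Kept t s s′ × real s′ (n * n + t) ≡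
        sumIf (λ x → ⟦ c ⟧ᵇ H (x ∷ ρ)) (λ x → lookupᵈ (⟦ e ⟧ H (x ∷ ρ))))
      (⟪ costSum c e σ t ⟫ μ)

  run-two : ∀ {r} (e e′ : Term r) {σ t s H μ ρ} → All (_< t) σ → Env s σ ρ → Ctx μ H ρ → Sim s H →
    ∀ {p b} {Q : State → Set} →
    (∀ s′ → Sim s′ H → Kept t s s′ → reg-val t s′ ≡ ⟦ e ⟧ H ρ → reg-val (suc t) s′ ≡ ⟦ e′ ⟧ H ρ →
      Outcome p s′ Q b) →
    Outcome (comp e σ t ⨾ comp e′ σ (suc t) ⨾ p) s Q (⟪ cost e σ t ⟫ μ + (⟪ cost e′ σ (suc t) ⟫ μ + b))
  run-two e e′ {t = t} σ<t E C S next =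
    run-term e σ<t E C S >> λ s₁ (S₁ , K₁ , v₁) →
    run-term e′ (below-suc σ<t) (env-kept σ<t K₁ E) C S₁ >> λ s₂ (S₂ , K₂ , v₂) →
    next s₂ S₂ (kept-trans (n≤1+n t) K₁ K₂) (trans (regs K₂ t (n<1+n t)) v₁) v₂

  run-term top {x ∷ σ} {ρ = v ∷ ρ} (x<t ∷ σ<t) (e , E) C S =
    setting _ (! reg x) S kept-refl (tt , as-≤ e (All.head (env≤ C))) e
  run-term (wk e) {x ∷ σ} {ρ = v ∷ ρ} (_ ∷ σ<t) (_ , E) (ctx n≤ k≤ h≤ (_ ∷ e≤)) S =
    run-term e σ<t E (ctx n≤ k≤ h≤ e≤) S
  run-term (con v) {μ = μ} σ<t E C S = setting {μ} _ (lit v) S kept-refl _ refl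
  run-term #n σ<t E C S = setting _ (! lit 0) S kept-refl (tt , as-≤ (size≡ S) (index≤ C ≤-refl)) (size≡ S)
  run-term #k σ<t E C S =
    setting _ (! lit 1) S kept-refl (tt , as-≤ (k≡ S) (≤-trans (k≤μ C) (v≤2^v _))) (k≡ S)
  run-term (get a e) {t = t} {H = H} {μ} {ρ} σ<t E C S =
    run-term e σ<t E C S >> λ s₁ (S₁ , K₁ , v₁) →
    let look = trans (cong (λ i → nat s₁ (cell (suc a) i)) v₁) (heap≡ S₁ a (⟦ e ⟧ H ρ)) in
    setting t (! cellₑ (suc a) (! reg t)) S₁ K₁
      ((tt , ((tt , as-≤ v₁ (val-bound e C)) , tt) , tt) ,
       as-≤ look (^-mono (heap≤ C a _) (m≤m+n μ _))) look
  run-term (add e e′) {t = t} σ<t E C S = run-two e e′ σ<t E C S λ s₂ S₂ K₂ v w →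
    setting t (! reg t ⊕ ! reg (suc t)) S₂ K₂
      ((tt , as-≤ v (val₁-bound e e′ C)) , tt , as-≤ w (val₂-bound e e′ C)) (cong₂ _+_ v w)
  run-term (sub e e′) {t = t} σ<t E C S = run-two e e′ σ<t E C S λ s₂ S₂ K₂ v w →
    setting t (! reg t ⊖ ! reg (suc t)) S₂ K₂
      ((tt , as-≤ v (val₁-bound e e′ C)) , tt , as-≤ w (val₂-bound e e′ C)) (cong₂ _∸_ v w)
  run-term (halve e) {t = t} σ<t E C S =
    run-term e σ<t E C S >> λ s₁ (S₁ , K₁ , v₁) →
    setting t (half (! reg t)) S₁ K₁ (tt , as-≤ v₁ (val-bound e C)) (cong ⌊_/2⌋ v₁)
  run-term (row e) {t = t} {μ = μ} σ<t E C S =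
    run-term e σ<t E C S >> λ s₁ (S₁ , K₁ , v₁) →
    setting t (! reg t ⊗ ! lit 0) S₁ K₁
      ((tt , as-≤ v₁ (val-bound e C)) , tt , as-≤ (size≡ S₁) (^-mono (index≤ C ≤-refl) (m≤m+n μ _)))
      (cong₂ _*_ v₁ (size≡ S₁))
  run-term (times v e) {t = t} σ<t E C S =
    run-term e σ<t E C S >> λ s₁ (S₁ , K₁ , v₁) →
    setting t (lit v ⊗ ! reg t) S₁ K₁ (tt , tt , as-≤ v₁ (val-bound e C)) (cong (v *_) v₁)
  run-term (ite c e e′) {σ} {t} {s} {H} {μ} {ρ} σ<t E C S =
    run-cond c σ<t E C S >> λ s₁ (S₁ , K₁ , v₁ , τ₁) → branch v₁ τ₁
      (λ eq → relax (λ { _ (S₂ , K₂ , v₂) → S₂ , kept-trans ≤-refl K₁ K₂ ,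
          trans v₂ (cong (λ β → if β then ⟦ e ⟧ H ρ else ⟦ e′ ⟧ H ρ) (sym eq)) }) (m≤m+n _ _)
        (run-term e σ<t (env-kept σ<t K₁ E) C S₁))
      (λ eq → relax (λ { _ (S₂ , K₂ , v₂) → S₂ , kept-trans ≤-refl K₁ K₂ ,
          trans v₂ (cong (λ β → if β then ⟦ e ⟧ H ρ else ⟦ e′ ⟧ H ρ) (sym eq)) }) (m≤n+m _ (⟪ cost e σ t ⟫ μ))
        (run-term e′ σ<t (env-kept σ<t K₁ E) C S₁))
  run-term (fold e b) {σ} {t} {s} {H} {μ} {ρ} σ<t E C S =
    run-term e σ<t E C S >> λ s₁ (S₁ , K₁ , v₁) →
    relax (λ { _ (S₂ , K₂ , v₂) → S₂ , K₂ , v₂ }) ≤-refl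
      (loops (suc t) _
        {B = cost b (suc t ∷ t ∷ σ) (2 + t) :∘ foldVal e b :+ asgP (reg t) (! reg (2 + t)) :∘ foldVal e b}
        J (n≤μ C) (λ _ _ (S , _) → size≡ S) stable body (S₁ , K₁ , v₁))
    where
    acc : ℕ → ℕ
    acc i = foldn i (⟦ e ⟧ H ρ) λ j a → ⟦ b ⟧ H (j ∷ a ∷ ρ)
    J : ℕ → State → Set
    J i s′ = Sim s′ H × Kept t s s′ × reg-val t s′ ≡ acc i
    stable : ∀ i s′ v → J i s′ → J i (set s′ (suc t) v)
    stable i s′ v (S′ , K′ , v′) = set-sim (suc t) v S′ ,
      kept-trans (n≤1+n t) K′ (set-kept s′ (suc t) v) , trans (set-≢ s′ v (<⇒≢ (n<1+n t))) v′
    body : ∀ i s′ → i < n → J i s′ → reg-val (suc t) s′ ≡ i → Outcome _ s′ _ _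
    body i s′ i<n (S′ , K′ , v′) c′ =
      run-term b {suc t ∷ t ∷ σ} (n<1+n (suc t) ∷ m<n⇒m<1+n (n<1+n t) ∷ below-suc (below-suc σ<t))
        (c′ , v′ , env-kept σ<t K′ E)
        (extend (extend C (foldVal-bound e b C i (<⇒≤ i<n)) (m≤m+n μ _))
                (^-mono (index≤ C (<⇒≤ i<n)) (m≤m+n μ _)) ≤-refl) S′ >> λ s₂ (S₂ , K₂ , v₂) →
      relax (λ { _ refl → (set-sim t _ S₂
               , kept-trans ≤-refl K′
                   (kept-trans ≤-refl (kept-trans (m≤n+m t 2) kept-refl K₂) (set-kept s₂ t _))
               , trans (set-≡ s₂ t _) v₂)
               , trans (set-≢ s₂ _ (λ eq → <⇒≢ (n<1+n t) (sym eq))) (trans (regs K₂ (suc t) (n<1+n (suc t))) c′) })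
        ≤-refl
        (assign (reg t) (! reg (2 + t)) _ (tt , as-≤ v₂ (foldVal-bound e b C (suc i) i<n)))

  run-cond (leq e e′) {t = t} {μ = μ} σ<t E C S =
    run-term e σ<t E C S >> λ s₁ (S₁ , K₁ , v₁) →
    relax (λ { s₂ (S₂ , K₂ , v₂) →
        let v = trans (regs K₂ t (n<1+n t)) v₁ in
        S₂ , kept-trans (n≤1+n t) K₁ K₂ , cong₂ _≤ᵇ_ v v₂ ,
        s≤s (+-mono-≤ (time≤ {⟪ val e :+ growth e′ ⟫ μ} {s₂} (! reg t) (tt , as-≤ v (val₁-bound e e′ C)))
                      (time≤ {⟪ val e :+ growth e′ ⟫ μ} {s₂} (! reg (suc t)) (tt , as-≤ v₂ (val₂-bound e e′ C)))) }) ≤-refl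
      (run-term e′ (below-suc σ<t) (env-kept σ<t K₁ E) C S₁)
  run-cond c₀@(sums c e c′ e′) {t = t} {μ = μ} σ<t E C S =
    run-sum c e σ<t E C S >> λ s₁ (S₁ , K₁ , v₁) →
    relax (λ { s₂ (S₂ , K₂ , v₂) →
        let size : nat s₂ 0 ≤ 2 ^ μ
            size = as-≤ (size≡ S₂) (index≤ C ≤-refl)
            addr : ∀ i → real s₂ (nat s₂ 0 * nat s₂ 0 + i) ≡ real s₂ (n * n + i)
            addr i = cong (λ z → real s₂ (z * z + i)) (size≡ S₂)
        in S₂ , kept-trans (n≤1+n t) K₁ K₂ ,
           cong₂ (λ x y → ⌊ x ≤?ᶠ y ⌋)
             (trans (addr t) (trans (regsʳ K₂ t (n<1+n t)) v₁)) (trans (addr (suc t)) v₂) ,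
           s≤s (+-mono-≤ (timeᵣ≤ {μ} {s₂} (‼ regᵣ t) (((tt , size) , tt , size) , tt))
                         (timeᵣ≤ {μ} {s₂} (‼ regᵣ (suc t)) (((tt , size) , tt , size) , tt))) }) ≤-refl
      (run-sum c′ e′ (below-suc σ<t) (env-kept σ<t K₁ E) C S₁)

  run-sum c e {σ} {t} {s} {H} {μ} {ρ} σ<t E C S =
    assignᵣ (regᵣ t) zeroᵣ (((tt , sz S) , tt , sz S) , tt) _ >> λ { s₁ refl →
    relax (λ { _ (S₂ , K₂ , v₂) → S₂ , K₂ , v₂ }) ≤-refl
      (loops t _ {B = costᵇ c (t ∷ σ) (suc t) :+ (costTest c (suc t) :+ ((cost e (t ∷ σ) (suc t) :+
          asgᵣP (regᵣ t) (‼ regᵣ t ⊞ weighₑ sq (‼ clampₑ (! reg (suc t)))) :∘ val e) :+ :c 1))}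
        J (n≤μ C) (λ _ _ (S , _) → size≡ S)
        (λ i s′ v (S′ , K′ , v′) → set-sim t v S′ , kept-trans ≤-refl K′ (set-kept s′ t v) , v′)
        body (init (size≡ S))) }
    where
    sz : ∀ {s} → Sim s H → nat s 0 ≤ 2 ^ μ
    sz S = as-≤ (size≡ S) (index≤ C ≤-refl)
    cond : ℕ → Bool
    cond x = ⟦ c ⟧ᵇ H (x ∷ ρ)
    weight : ℕ → Carrier
    weight x = lookupᵈ (⟦ e ⟧ H (x ∷ ρ))
    total : ℕ → Carrier
    total i = foldn i 0# λ x acc → if cond x then acc +ᶠ weight x else acc
    J : ℕ → State → Set
    J i s′ = Sim s′ H × Kept t s s′ × real s′ (n * n + t) ≡ total i
    -- The machine computes the address from cell 0. Abstracting its content to z allows matching on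
    -- the equation with n.
    init : ∀ {z} → z ≡ n → J 0 (s [ z * z + t ≔ʳ 0# ])
    init refl = setʳ-sim t 0# S , setʳ-kept s t 0# , update-≡ (real s) (n * n + t) 0#
    weighₑ-reads : ∀ {M s} b q → Readsᵣ M q s → Readsᵣ M (weighₑ b q) s
    weighₑ-reads true  q r = r , r
    weighₑ-reads false q r = r
    weighₑ-eval : ∀ b q s → evalᵣ (weighₑ b q) s ≡ (if b then evalᵣ q s *ᶠ evalᵣ q s else evalᵣ q s)
    weighₑ-eval true  q s = refl
    weighₑ-eval false q s = refl
    body : ∀ i s′ → i < n → J i s′ → reg-val t s′ ≡ i → Outcome _ s′ _ _
    body i s′ i<n (S′ , K′ , v′) c′ =
      run-cond c {t ∷ σ} (n<1+n t ∷ below-suc σ<t) E′ C′ S′ >> λ s₁ (S₁ , K₁ , v₁ , τ₁) →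
      branch v₁ τ₁
        (λ eq → relax (λ _ q → q) (m≤m+n _ 1)
          (run-term e {t ∷ σ} (n<1+n t ∷ below-suc σ<t)
             (env-kept (n<1+n t ∷ below-suc σ<t) K₁ E′) C′ S₁ >> λ s₂ (S₂ , K₂ , v₂) →
           relax (λ { _ refl → finish s₂ S₂ (kept-trans (n≤1+n t) K′ (kept-trans ≤-refl K₁ K₂))
                         (trans (regs K₂ t (n<1+n t)) (trans (regs K₁ t (n<1+n t)) c′))
                         (trans (trans (regsʳ K₂ t (n<1+n t)) (regsʳ K₁ t (n<1+n t))) v′) v₂ eq })
             ≤-refl
             (let z : nat s₂ 0 ≤ 2 ^ ⟪ val e ⟫ μ
                  z = ^-mono (sz S₂) (m≤m+n μ _)
                  x : reg-val (suc t) s₂ ≤ 2 ^ ⟪ val e ⟫ μ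
                  x = as-≤ v₂ (val-bound e C′)
              in assignᵣ (regᵣ t) (‼ regᵣ t ⊞ weighₑ sq (‼ clampₑ (! reg (suc t))))
                (((tt , z) , tt , z) , tt)
                ((((tt , z) , tt , z) , tt) ,
                 weighₑ-reads sq (‼ clampₑ (! reg (suc t))) ((tt , x) , (tt , x) , ((tt , z) , tt , z) , tt)))))
        (λ eq → relax (λ { _ refl → (S₁ , kept-trans (n≤1+n t) K′ K₁ ,
              trans (regsʳ K₁ t (n<1+n t)) (trans v′ (cong (λ β → if β then total i +ᶠ weight i else total i) (sym eq))))
              , trans (regs K₁ t (n<1+n t)) c′ }) (m≤n+m 1 _)
          (skipping {Q = _≡ s₁} refl))
      where
      E′ : Env s′ (t ∷ σ) (i ∷ ρ)
      E′ = c′ , env-kept σ<t K′ E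
      C′ : Ctx μ H (i ∷ ρ)
      C′ = extend C (index≤ C (<⇒≤ i<n)) ≤-refl
      finish : ∀ s₂ → Sim s₂ H → Kept t s s₂ → reg-val t s₂ ≡ i → real s₂ (n * n + t) ≡ total i →
        reg-val (suc t) s₂ ≡ ⟦ e ⟧ H (i ∷ ρ) → cond i ≡ true →
        (λ s″ → J (suc i) s″ × reg-val t s″ ≡ i)
          (s₂ [ evalₙ (regᵣ t) s₂ ≔ʳ evalᵣ (‼ regᵣ t ⊞ weighₑ sq (‼ clampₑ (! reg (suc t)))) s₂ ])
      finish s₂ S₂ K₂ c₂ a₂ v₂ eq = go (size≡ S₂)
        where
        item : evalᵣ (weighₑ sq (‼ clampₑ (! reg (suc t)))) s₂ ≡ weight i
        item = trans (weighₑ-eval sq (‼ clampₑ (! reg (suc t))) s₂) (cong weigh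
          (trans (cong₂ (λ z x → real s₂ (x ∸ (x ∸ (z * z ∸ 1)))) (size≡ S₂) v₂)
                 (dist≡ S₂ _ (clamp-below (⟦ e ⟧ H (i ∷ ρ))))))
        go : ∀ {z} → z ≡ n → (λ s″ → J (suc i) s″ × reg-val t s″ ≡ i)
          (s₂ [ z * z + t ≔ʳ real s₂ (z * z + t) +ᶠ evalᵣ (weighₑ sq (‼ clampₑ (! reg (suc t)))) s₂ ])
        go refl = (setʳ-sim t _ S₂ , kept-trans ≤-refl K₂ (setʳ-kept s₂ t _) ,
          trans (update-≡ (real s₂) (n * n + t) _) (trans (cong₂ _+ᶠ_ a₂ item)
            (cong (λ β → if β then total i +ᶠ weight i else total i) (sym eq)))) , c₂

-- The driver loop and the output

queue seen table glob out : Fin 5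
queue = zero
seen  = suc zero
table = suc (suc zero)
glob  = suc (suc (suc zero))
out   = suc (suc (suc (suc zero)))

headₑ tailₑ : NatExp
headₑ = ! lit (cell (suc glob) 0)
tailₑ = ! lit (cell (suc glob) 1)

outₑ : NatExp → NatExp
outₑ e = ! cellₑ (suc out) (! lit 0 ⊕ ! lit 0 ⊕ e)

-- The output overwrites all memory below k + n, in particular n and k.  It is
-- therefore written downwards from a buffer located by the value of n, cell 1
-- serving as the counter; cells 1 and 0 themselves come last.

copyOut : Program
copyOut = lit 1 ≔ ! lit 1 ⊕ ! lit 0 ⨾
  while lit 3 ≤ₙ ! lit 1 loop (lit 1 ≔ ! lit 1 ⊖ lit 1 ⨾ ! lit 1 ≔ outₑ (! lit 1)) ⨾
  lit 1 ≔ outₑ (lit 1) ⨾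
  lit 0 ≔ outₑ (lit 0)

pending : Test
pending = lit 1 ⊕ headₑ ≤ₙ tailₑ

-- The search loop is the only place where exponential time can arise: the three commands it is
-- built from run for polynomial time in the bit lengths, and it stops when the head of the queue
-- meets the tail.
driver : Bool → Cmd 0 → Cmd 0 → Cmd 0 → Program
driver sq start body finish = compile start [] 0 ⨾
  while pending loop compile body [] 0 ⨾ compile finish [] 0 ⨾ copyOut
  where open Compile sq

copyP : Poly
copyP = asgP (lit 1) (! lit 1 ⊕ ! lit 0) :∘ X₂ :+ ((test :+ X₂ :* (test :+
    (asgP (lit 1) (! lit 1 ⊖ lit 1) :∘ X₂ :+ asgP (! lit 1) (outₑ (! lit 1)) :∘ X₂))) :+
    (asgP (lit 1) (outₑ (lit 1)) :∘ X₂ :+ asgP (lit 0) (outₑ (lit 0)) :∘ X₂))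
  where
  X₂ test : Poly
  X₂ = :X :+ :X
  test = timeᵗP (lit 3 ≤ₙ ! lit 1) :∘ X₂

store-hit : ∀ H a i v → store H a i v a i ≡ v
store-hit H a i v with a Fin.≟ a
... | yes _  = update-≡ (H a) i v
... | no a≢a = ⊥-elim (a≢a refl)

store-miss : ∀ H a i v {j} → j ≢ i → store H a i v a j ≡ H a j
store-miss H a i v j≢i with a Fin.≟ a
... | yes _  = update-≢ (H a) v j≢i
... | no a≢a = refl

store-≤ : ∀ H a i v {B} → (∀ b j → H b j ≤ B) → v ≤ B → ∀ b j → store H a i v b j ≤ B
store-≤ H a i v H≤ v≤ b j with b Fin.≟ a
... | no _ = H≤ b j
... | yes _ with j ≡ᵇ i
...   | true  = v≤
...   | false = H≤ b j

module Running (F : OrderedField 0ℓ 0ℓ 0ℓ) (sq : Bool) (n k : ℕ) (1≤n : 1 ≤ n)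
               (D : ℕ → OrderedField.Carrier F) where
  open OrderedField F using (Carrier; 0#)
  open Machine F
  open Hoare F
  open Semantics F sq n k D
  open Compile sq
  open Cost sq
  open Simulation F sq n k 1≤n D
  open Ctx
  open Sim
  open Kept

  exec-bounded : ∀ {r} (c : Cmd r) {μ H ρ} → Ctx μ H ρ → ∀ a i → exec c H ρ a i ≤ 2 ^ (μ + ⟪ growthᶜ c ⟫ n)
  for-bounded : ∀ {r} (c : Cmd (suc r)) {μ H ρ} → Ctx μ H ρ → ∀ m → m ≤ n → ∀ a i →
    foldn m H (λ j H′ → exec c H′ (j ∷ ρ)) a i ≤ 2 ^ (μ + m * ⟪ growthᶜ c ⟫ n)

  reheap : ∀ {r μ μ′ H H′} {ρ : Vec ℕ r} → Ctx μ H ρ → μ ≤ μ′ → (∀ a i → H′ a i ≤ 2 ^ μ′) → Ctx μ′ H′ ρ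
  reheap C μ≤ H′≤ = ctx (≤-trans (n≤μ C) μ≤) (≤-trans (k≤μ C) μ≤) H′≤
    (All.map (λ x≤ → ^-mono x≤ μ≤) (env≤ C))

  exec-bounded (put b e e′) {μ} C = store-≤ _ b _ _
    (λ b j → ^-mono (heap≤ C b j) (m≤m+n μ _)) (bounded e′ C)
  exec-bounded (c ▷ c′) {μ} C a i =
    ^-mono (exec-bounded c′ (reheap C (m≤m+n μ _) (exec-bounded c C)) a i) (≤-reflexive (+-assoc μ _ _))
  exec-bounded (when b c) {μ} {H} {ρ} C a i with ⟦ b ⟧ᵇ H ρ
  ... | true  = exec-bounded c C a i
  ... | false = ^-mono (heap≤ C a i) (m≤m+n μ _)
  exec-bounded (for c) C = for-bounded c C n ≤-refl
  exec-bounded (bind e c) {μ} C a i =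
    ^-mono (exec-bounded c (extend C (bounded e C) (m≤m+n μ _)) a i) (≤-reflexive (+-assoc μ _ _))

  for-bounded c {μ} C zero _ a i = ^-mono {μ} (heap≤ C a i) (m≤m+n μ 0)
  for-bounded c {μ} C (suc m) m<n a i =
    ^-mono (exec-bounded c (extend (reheap C (m≤m+n μ _) (for-bounded c C m (<⇒≤ m<n)))
                                   (^-mono (index≤ C (<⇒≤ m<n)) (m≤m+n μ _)) ≤-refl) a i)
      (≤-reflexive (trans (+-assoc μ _ _) (cong (μ +_) (+-comm (m * ⟪ growthᶜ c ⟫ n) _))))

  run-cmd : ∀ {r} (c : Cmd r) {σ t s H μ ρ} → All (_< t) σ → Env s σ ρ → Ctx μ H ρ → Sim s H →
    Outcome (compile c σ t) s (λ s′ → Sim s′ (exec c H ρ) × Kept t s s′) (⟪ costᶜ c σ t ⟫ μ)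
  run-cmd (put b e e′) {σ} {t} {s} {H} {μ} {ρ} σ<t E C S = run-two e e′ σ<t E C S λ s₂ S₂ K₂ v w →
    let x = reg-val t s₂ ; y = reg-val (suc t) s₂ in
    relax (λ { s′ refl → sim (size≡ S₂) (k≡ S₂) (λ a i → trans (heap {nat s₂} (heap≡ S₂) b x y a i)
               (cong₂ (λ p q → store H b p q a i) v w)) (dist≡ S₂)
             , kept-trans ≤-refl K₂ (kept (λ i i<t → update-≢ (nat s₂) y
                 λ eq → case proj₁ (cell-injective {zero} {suc b} i x eq) of λ ()) λ _ _ → refl) }) ≤-refl
      (assign (cellₑ (suc b) (! reg t)) (! reg (suc t))
        (tt , ((tt , as-≤ v (val₁-bound e e′ C)) , tt) , tt) (tt , as-≤ w (val₂-bound e e′ C)))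
    where
    heap : ∀ {f} → (∀ a i → f (cell (suc a) i) ≡ H a i) → ∀ b x y a i →
      update f (cell (suc b) x) y (cell (suc a) i) ≡ store H b x y a i
    heap {f} f≡ b x y a i with a Fin.≟ b
    ... | no a≢b = trans (update-≢ f y λ eq → a≢b (Finₚ.suc-injective (proj₁ (cell-injective i x eq)))) (f≡ a i)
    ... | yes refl with i ≟ x
    ...   | yes refl = trans (update-≡ f (cell (suc a) i) y) (sym (update-≡ (H a) i y))
    ...   | no i≢x = trans (update-≢ f y λ eq → i≢x (proj₂ (cell-injective {suc a} {suc a} i x eq)))
              (trans (f≡ a i) (sym (update-≢ (H a) y i≢x)))
  run-cmd (c ▷ c′) {μ = μ} σ<t E C S =
    run-cmd c σ<t E C S >> λ s₁ (S₁ , K₁) →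
    relax (λ _ (S₂ , K₂) → S₂ , kept-trans ≤-refl K₁ K₂) ≤-refl
      (run-cmd c′ σ<t (env-kept σ<t K₁ E) (reheap C (m≤m+n μ _) λ a i →
        ^-mono (exec-bounded c C a i) (+-monoʳ-≤ μ (⟪⟫-mono (growthᶜ c) (n≤μ C)))) S₁)
  run-cmd (when b c) {σ} {t} {s} {H} {μ} {ρ} σ<t E C S =
    run-cond b σ<t E C S >> λ s₁ (S₁ , K₁ , v₁ , τ₁) → branch v₁ τ₁
      (λ eq → relax (λ _ (S₂ , K₂) → subst (λ β → Sim _ (if β then exec c H ρ else H)) (sym eq) S₂
                    , kept-trans ≤-refl K₁ K₂) (m≤m+n _ 1)
        (run-cmd c σ<t (env-kept σ<t K₁ E) C S₁))
      (λ eq → relax (λ { _ refl → subst (λ β → Sim _ (if β then exec c H ρ else H)) (sym eq) S₁ , K₁ })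
        (m≤n+m 1 _) (skipping {Q = _≡ s₁} refl))
  run-cmd (for c) {σ} {t} {s} {H} {μ} {ρ} σ<t E C S =
    loops t _ {B = costᶜ c (t ∷ σ) (suc t) :∘ (:X :+ :X :* growthᶜ c)} Inv (n≤μ C)
      (λ _ _ (S , _) → size≡ S)
      (λ i s′ v (S′ , K′) → set-sim t v S′ , kept-trans ≤-refl K′ (set-kept s′ t v))
      (λ i s′ i<n (S′ , K′) c′ →
        relax (λ _ (S₂ , K₂) → (S₂ , kept-trans (n≤1+n t) K′ K₂) ,
                 trans (regs K₂ t (n<1+n t)) c′) ≤-refl
          (run-cmd c {t ∷ σ} (n<1+n t ∷ below-suc σ<t) (c′ , env-kept σ<t K′ E)
            (extend (reheap C (m≤m+n μ _) λ a j → ^-mono (for-bounded c C i (<⇒≤ i<n) a j)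
                       (+-monoʳ-≤ μ (*-mono-≤ (≤-trans (<⇒≤ i<n) (n≤μ C)) (⟪⟫-mono (growthᶜ c) (n≤μ C)))))
                    (^-mono (index≤ C (<⇒≤ i<n)) (m≤m+n μ _)) ≤-refl) S′))
      (S , kept-refl)
    where
    Inv : ℕ → State → Set
    Inv i s′ = Sim s′ (foldn i H λ j H′ → exec c H′ (j ∷ ρ)) × Kept t s s′
  run-cmd (bind e c) {t = t} {μ = μ} σ<t E C S =
    run-term e σ<t E C S >> λ s₁ (S₁ , K₁ , v₁) →
    relax (λ _ (S₂ , K₂) → S₂ , kept-trans (n≤1+n t) K₁ K₂) ≤-refl
      (run-cmd c (n<1+n t ∷ below-suc σ<t) (v₁ , env-kept σ<t K₁ E)
        (extend C (val-bound e C) (m≤m+n μ _)) S₁)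

  module _ (1≤k : 1 ≤ k) (k≤n : k ≤ n) where

    run-copy : ∀ {s H μ} → Sim s H → Ctx μ H [] →
      Outcome copyOut s (λ s′ → ∀ a → a < k + n → nat s′ a ≡ H out (n + n + a)) (⟪ copyP ⟫ μ)
    run-copy {s} {H} {μ} S C =
      assign {M} {s} (lit 1) (! lit 1 ⊕ ! lit 0) _
        ((tt , as-≤ (k≡ S) (small (m≤m+n k n))) , tt , as-≤ (size≡ S) (small (m≤n+m n k))) >> λ { s₁ refl →
      (relax {b′ = ⟪ timeᵗP (lit 3 ≤ₙ ! lit 1) ⟫ M + M * _} (λ _ q → q)
          (+-monoʳ-≤ (⟪ timeᵗP (lit 3 ≤ₙ ! lit 1) ⟫ M)
            (*-monoˡ-≤ _ (≤-trans (m∸n≤m (k + n) 2) k+n≤M)))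
        (iterating (k + n ∸ 2) Inv step stop
          (size≡ S , cong₂ _+_ (k≡ S) (size≡ S) , (λ a ge lt → ⊥-elim (<⇒≱ lt ge)) ,
           λ j ge → heap≡ S out j))) >> λ { s₂ (z , c , w , b) →
      assign {M} {s₂} (lit 1) (outₑ (lit 1)) _ (outReads s₂ z 1 (lit 1) tt refl b) >> λ { s₃ refl →
      relax (λ { s′ refl a a< → final s₂ z c w b a a< }) ≤-refl
        (assign {M} (lit 0) (outₑ (lit 0)) _ (outReads s₃ z 0 (lit 0) tt refl
          λ j ge → b j ge)) } } }
      where
      -- The counter starts at k + n, which need not be below μ.
      M : ℕ
      M = μ + μ
      k+n≤M : k + n ≤ M
      k+n≤M = +-mono-≤ (k≤μ C) (n≤μ C)
      small : ∀ {x} → x ≤ k + n → x ≤ 2 ^ M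
      small x≤ = ≤-trans (≤-trans x≤ k+n≤M) (v≤2^v M)
      2≤k+n : 2 ≤ k + n
      2≤k+n = +-mono-≤ 1≤k 1≤n
      source : ℕ → ℕ
      source a = H out (n + n + a)
      Buffer : State → Set
      Buffer s′ = ∀ j → n + n ≤ j → nat s′ (cell (suc out) j) ≡ H out j
      Inv : ℕ → State → Set
      Inv i s′ = nat s′ 0 ≡ n × nat s′ 1 ≡ k + n ∸ i ×
        (∀ a → k + n ∸ i ≤ a → a < k + n → nat s′ a ≡ source a) × Buffer s′
      outReads : ∀ s′ → nat s′ 0 ≡ n → ∀ a e → Reads M e s′ → evalₙ e s′ ≡ a → Buffer s′ →
        Reads M (outₑ e) s′
      outReads s′ z a e r eq b =
        (tt , ((((tt , as-≤ z (small (m≤n+m n k))) , tt , as-≤ z (small (m≤n+m n k))) , r) , tt) , tt) ,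
        as-≤ (trans (cong₂ (λ x y → nat s′ (cell (suc out) (x + x + y))) z eq) (b (n + n + a) (m≤m+n (n + n) a)))
             (^-mono (heap≤ C out _) (m≤m+n μ μ))
      outVal : ∀ s′ → nat s′ 0 ≡ n → Buffer s′ → ∀ e a → evalₙ e s′ ≡ a → evalₙ (outₑ e) s′ ≡ source a
      outVal s′ z b e a eq =
        trans (cong₂ (λ x y → nat s′ (cell (suc out) (x + x + y))) z eq) (b (n + n + a) (m≤m+n (n + n) a))
      k+n≤2n : k + n ≤ n + n
      k+n≤2n = +-monoˡ-≤ n k≤n
      -- Buffer entry j lies at an address above j, and j ≥ n + n ≥ k + n is beyond all output
      -- cells, so nothing is overwritten before it is read.
      far : ∀ j {a} → n + n ≤ j → a < k + n → cell (suc out) j ≢ a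
      far j {a} ge a< eq = <⇒≱ a< (≤-trans k+n≤2n (≤-trans ge (≤-trans (≤-trans (m≤m*n j 6) (m≤m+n (j * 6) 5))
        (≤-trans (m≤n+m _ 2) (≤-reflexive eq)))))
      step : ∀ i s′ → i < k + n ∸ 2 → Inv i s′ →
        evalᵗ (lit 3 ≤ₙ ! lit 1) s′ ≡ true × timeᵗ (lit 3 ≤ₙ ! lit 1) s′ ≤ ⟪ timeᵗP (lit 3 ≤ₙ ! lit 1) ⟫ M ×
        Outcome (lit 1 ≔ ! lit 1 ⊖ lit 1 ⨾ ! lit 1 ≔ outₑ (! lit 1)) s′ (Inv (suc i))
          (⟪ asgP (lit 1) (! lit 1 ⊖ lit 1) ⟫ M + ⟪ asgP (! lit 1) (outₑ (! lit 1)) ⟫ M)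
      step i s′ i< (z , c , w , b) =
        trans (cong (3 ≤ᵇ_) c) (≤ᵇ-true {3} (m+n≤o⇒m≤o∸n 3 (≤-trans (s≤s (s≤s i<)) (≤-reflexive (m+[n∸m]≡n 2≤k+n))))) ,
        s≤s (+-mono-≤ (time≤ {M} {s′} (lit 3) tt) (time≤ {M} {s′} (! lit 1) (tt , c≤))) ,
        (assign {M} (lit 1) (! lit 1 ⊖ lit 1) _ ((tt , c≤) , tt) >> λ { s₁ refl →
         relax (λ { _ refl → moved }) ≤-refl
           (assign {M} {s₁} (! lit 1) (outₑ (! lit 1)) (tt , small (as-≤ c₁ (m∸n≤m _ (suc i))))
             (outReads s₁ z (k + n ∸ suc i) (! lit 1) (tt , small (as-≤ c₁ (m∸n≤m _ (suc i)))) c₁ b₁)) })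
        where
        c≤ : nat s′ 1 ≤ 2 ^ M
        c≤ = as-≤ c (small (m∸n≤m _ i))
        s₁ : State
        s₁ = s′ [ 1 ≔ⁿ nat s′ 1 ∸ 1 ]
        c₁ : nat s′ 1 ∸ 1 ≡ k + n ∸ suc i
        c₁ = trans (cong (_∸ 1) c) (trans (∸-+-assoc (k + n) i 1) (cong (k + n ∸_) (+-comm i 1)))
        suc-i≤ : suc (suc (suc i)) ≤ k + n
        suc-i≤ = ≤-trans (s≤s (s≤s i<)) (≤-reflexive (m+[n∸m]≡n 2≤k+n))
        b₁ : Buffer s₁
        b₁ j ge = b j ge
        target : ℕ
        target = nat s′ 1 ∸ 1
        target≥2 : 2 ≤ target
        target≥2 = ≤-trans (m+n≤o⇒m≤o∸n 2 suc-i≤) (≤-reflexive (sym c₁))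
        target< : target < k + n
        target< = ≤-trans (s≤s (≤-reflexive c₁)) (≤-trans (≤-reflexive (sym (+-∸-assoc 1 {k + n} {suc i} (≤-trans (m≤n+m _ 2) suc-i≤)))) (m∸n≤m (k + n) i))
        v : ℕ
        v = evalₙ (outₑ (! lit 1)) s₁
        moved : Inv (suc i) (s₁ [ target ≔ⁿ v ])
        moved = trans (update-≢ (nat s₁) v (λ eq → <⇒≱ target≥2 (≤-trans (≤-reflexive (sym eq)) z≤n))) z
          , trans (update-≢ (nat s₁) v (λ eq → <⇒≱ target≥2 (≤-reflexive (sym eq)))) c₁
          , written
          , λ j ge → trans (update-≢ (nat s₁) v (far j ge target<)) (b₁ j ge)
          where
          written : ∀ a → k + n ∸ suc i ≤ a → a < k + n → update (nat s₁) target v a ≡ source a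
          written a ge lt with a ≟ target
          ... | yes refl = trans (update-≡ (nat s₁) target v) (trans (outVal s₁ z b₁ (! lit 1) target refl) refl)
          ... | no a≢t = trans (update-≢ (nat s₁) v a≢t)
                  (trans (update-≢ (nat s′) _ λ { refl → <⇒≱ target≥2 (≤-trans (≤-reflexive c₁) ge) })
                    (w a (≤-trans (≤-reflexive (+-∸-assoc 1 {k + n} {suc i} (≤-trans (m≤n+m _ 2) suc-i≤)))
                      (≤∧≢⇒< ge λ eq → a≢t (trans (sym eq) (sym c₁)))) lt))
      stop : ∀ s′ → Inv (k + n ∸ 2) s′ → evalᵗ (lit 3 ≤ₙ ! lit 1) s′ ≡ false ×
        timeᵗ (lit 3 ≤ₙ ! lit 1) s′ ≤ ⟪ timeᵗP (lit 3 ≤ₙ ! lit 1) ⟫ M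
      stop s′ (z , c , _) =
        trans (cong (3 ≤ᵇ_) (trans c (m∸[m∸n]≡n 2≤k+n))) refl ,
        s≤s (+-mono-≤ (time≤ {M} {s′} (lit 3) tt) (time≤ {M} {s′} (! lit 1) (tt , as-≤ c (small (m∸n≤m _ (k + n ∸ 2))))))
      final : ∀ s₂ → nat s₂ 0 ≡ n → nat s₂ 1 ≡ k + n ∸ (k + n ∸ 2) →
        (∀ a → k + n ∸ (k + n ∸ 2) ≤ a → a < k + n → nat s₂ a ≡ source a) → Buffer s₂ →
        let s₃ = s₂ [ 1 ≔ⁿ evalₙ (outₑ (lit 1)) s₂ ] in
        ∀ a → a < k + n → update (nat s₃) 0 (evalₙ (outₑ (lit 0)) s₃) a ≡ source a
      final s₂ z c w b 0 a< =
        outVal (s₂ [ 1 ≔ⁿ evalₙ (outₑ (lit 1)) s₂ ]) z (λ j ge → b j ge) (lit 0) 0 refl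
      final s₂ z c w b 1 a< = outVal s₂ z b (lit 1) 1 refl
      final s₂ z c w b (suc (suc a)) a< = w _ (≤-trans (≤-reflexive (m∸[m∸n]≡n 2≤k+n)) (s≤s (s≤s z≤n))) a<

    -- All rounds share one context μ, supplied by `CH`. The growth bound for commands alone would
    -- let the numbers lengthen in each of the exponentially many rounds.
    run-driver : ∀ start body finish {s H μ} (Hs : ℕ → Heap) (N : ℕ) →
      Sim s H → Ctx μ H [] →
      Hs 0 ≡ exec start H [] → (∀ i → Hs (suc i) ≡ exec body (Hs i) []) →
      (∀ i → i ≤ N → Ctx μ (Hs i) []) →
      (∀ i → i < N → Hs i glob 0 < Hs i glob 1) → Hs N glob 1 ≤ Hs N glob 0 →
      Outcome (driver sq start body finish) s
        (λ s′ → ∀ a → a < k + n → nat s′ a ≡ exec finish (Hs N) [] out (n + n + a))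
        (⟪ costᶜ start [] 0 ⟫ μ + ((⟪ timeᵗP pending ⟫ μ + N * (⟪ timeᵗP pending ⟫ μ + ⟪ costᶜ body [] 0 ⟫ μ)) +
          (⟪ costᶜ finish [] 0 ⟫ μ + ⟪ copyP :∘ (:X :+ growthᶜ finish) ⟫ μ)))
    run-driver start body finish {μ = μ} Hs N S C zero≡ suc≡ CH go-on halt =
      run-cmd start [] tt C S >> λ s₁ (S₁ , _) →
      iterating N (λ i s → Sim s (Hs i))
        (λ i s i<N S → trans (test s (Hs i) S) (≤ᵇ-true (go-on i i<N)) , time s (Hs i) (CH i (<⇒≤ i<N)) S ,
           relax (λ _ (S′ , _) → subst (Sim _) (sym (suc≡ i)) S′) ≤-refl
             (run-cmd body [] tt (CH i (<⇒≤ i<N)) S))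
        (λ s S → trans (test s (Hs N) S) (≤ᵇ-false (s≤s halt)) , time s (Hs N) (CH N ≤-refl) S)
        (subst (Sim s₁) (sym zero≡) S₁) >> λ s₂ S₂ →
      run-cmd finish [] tt (CH N ≤-refl) S₂ >> λ s₃ (S₃ , _) →
      run-copy S₃ (reheap (CH N ≤-refl) (m≤m+n μ _) λ a i →
        ^-mono (exec-bounded finish (CH N ≤-refl) a i) (+-monoʳ-≤ μ (⟪⟫-mono (growthᶜ finish) (n≤μ (CH N ≤-refl)))))
      where
      test : ∀ s H → Sim s H → evalᵗ pending s ≡ (suc (H glob 0) ≤ᵇ H glob 1)
      test s H S = cong₂ (λ x y → suc x ≤ᵇ y) (heap≡ S glob 0) (heap≡ S glob 1)
      time : ∀ s H → Ctx μ H [] → Sim s H → timeᵗ pending s ≤ ⟪ timeᵗP pending ⟫ μ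
      time s H C S = s≤s (+-mono-≤
        (time≤ {μ} {s} (lit 1 ⊕ headₑ) (tt , tt , as-≤ (heap≡ S glob 0) (heap≤ C glob 0)))
        (time≤ {μ} {s} tailₑ (tt , as-≤ (heap≡ S glob 1) (heap≤ C glob 1))))

-- Sums, counting and bit masks

≡ᵇ-refl : ∀ x → (x ≡ᵇ x) ≡ true
≡ᵇ-refl zero    = refl
≡ᵇ-refl (suc x) = ≡ᵇ-refl x

≢⇒≡ᵇ : ∀ {x y} → x ≢ y → (x ≡ᵇ y) ≡ false
≢⇒≡ᵇ {x} {y} x≢y with x ≡ᵇ y in eq
... | true  = ⊥-elim (x≢y (≡ᵇ⇒≡ x y (subst T (sym eq) tt)))
... | false = refl

module BigOp {c ℓ} (M : CommutativeMonoid c ℓ) where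
  open CommutativeMonoid M renaming (refl to ≈-refl; sym to ≈-sym; trans to ≈-trans)
  open import Relation.Binary.Reasoning.Setoid setoid

  big : ℕ → (ℕ → Carrier) → Carrier
  big n f = foldn n ε λ i acc → acc ∙ f i

  big-cong : ∀ n {f g : ℕ → Carrier} → (∀ i → i < n → f i ≈ g i) → big n f ≈ big n g
  big-cong zero    f≈g = ≈-refl
  big-cong (suc n) f≈g = ∙-cong (big-cong n λ i i<n → f≈g i (m<n⇒m<1+n i<n)) (f≈g n (n<1+n n))

  big-ε : ∀ n {f : ℕ → Carrier} → (∀ i → i < n → f i ≈ ε) → big n f ≈ ε
  big-ε zero    f≈ε = ≈-refl
  big-ε (suc n) f≈ε = ≈-trans
    (∙-cong (big-ε n λ i i<n → f≈ε i (m<n⇒m<1+n i<n)) (f≈ε n (n<1+n n))) (identityˡ ε)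

  interchange : ∀ a b c d → (a ∙ b) ∙ (c ∙ d) ≈ (a ∙ c) ∙ (b ∙ d)
  interchange a b c d = begin
    (a ∙ b) ∙ (c ∙ d)   ≈⟨ assoc a b (c ∙ d) ⟩
    a ∙ (b ∙ (c ∙ d))   ≈⟨ ∙-congˡ (assoc b c d) ⟨
    a ∙ ((b ∙ c) ∙ d)   ≈⟨ ∙-congˡ (∙-congʳ (comm b c)) ⟩
    a ∙ ((c ∙ b) ∙ d)   ≈⟨ ∙-congˡ (assoc c b d) ⟩
    a ∙ (c ∙ (b ∙ d))   ≈⟨ assoc a c (b ∙ d) ⟨
    (a ∙ c) ∙ (b ∙ d)   ∎

  big-∙ : ∀ n (f g : ℕ → Carrier) → big n (λ i → f i ∙ g i) ≈ big n f ∙ big n g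
  big-∙ zero    f g = ≈-sym (identityˡ ε)
  big-∙ (suc n) f g = ≈-trans (∙-congʳ (big-∙ n f g)) (interchange _ _ _ _)

  big-swap : ∀ m n (f : ℕ → ℕ → Carrier) →
    big m (λ i → big n (f i)) ≈ big n (λ j → big m λ i → f i j)
  big-swap zero    n f = ≈-sym (big-ε n λ _ _ → ≈-refl)
  big-swap (suc m) n f = ≈-trans (∙-congʳ (big-swap m n f)) (≈-sym (big-∙ n _ (f m)))

  big-head : ∀ n (f : ℕ → Carrier) → big (suc n) f ≈ f 0 ∙ big n (f ∘ suc)
  big-head zero    f = comm ε (f 0)
  big-head (suc n) f = ≈-trans (∙-congʳ (big-head n f)) (assoc (f 0) _ _)

  big-single : ∀ n {f : ℕ → Carrier} a → a < n → (∀ i → i < n → i ≢ a → f i ≈ ε) → big n f ≈ f a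
  big-single (suc n) {f} a a<sn rest with a ≟ n
  ... | yes refl = ≈-trans (∙-congʳ (big-ε n λ i i<n → rest i (m<n⇒m<1+n i<n) (<⇒≢ i<n))) (identityˡ (f a))
  ... | no a≢n = ≈-trans (∙-cong
      (big-single n a (≤∧≢⇒< (≤-pred a<sn) a≢n) λ i i<n → rest i (m<n⇒m<1+n i<n))
      (rest n (n<1+n n) (a≢n ∘ sym))) (identityʳ (f a))

  pick : ℕ → ℕ → Carrier → Carrier
  pick a c x = if a ≡ᵇ c then x else ε

  pick-≡ : ∀ a x → pick a a x ≈ x
  pick-≡ a x with a ≡ᵇ a | ≡⇒≡ᵇ a a refl
  ... | true | _ = ≈-refl

  pick-≢ : ∀ {a c} x → a ≢ c → pick a c x ≈ ε
  pick-≢ {a} {c} x a≢c with a ≡ᵇ c in eq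
  ... | true  = ⊥-elim (a≢c (≡ᵇ⇒≡ a c (subst T (sym eq) tt)))
  ... | false = ≈-refl

  -- Double counting: x occurs in exactly one fiber, that of `a x`. With `a` sending points to
  -- centers, sums over points become sums over clusters.
  big-fibers : ∀ n (a : ℕ → ℕ) → (∀ x → x < n → a x < n) → ∀ f →
    big n f ≈ big n (λ c → big n λ x → pick (a x) c (f x))
  big-fibers n a a<n f = begin
    big n f                                        ≈⟨ big-cong n (λ x x<n → ≈-sym (≈-trans
                                                        (big-single n (a x) (a<n x x<n)
                                                          (λ c _ c≢ax → pick-≢ (f x) (c≢ax ∘ sym)))
                                                        (pick-≡ (a x) (f x)))) ⟩
    big n (λ x → big n λ c → pick (a x) c (f x))   ≈⟨ big-swap n n (λ x c → pick (a x) c (f x)) ⟩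
    big n (λ c → big n λ x → pick (a x) c (f x))   ∎

  big-pair : ∀ n {f : ℕ → Carrier} a b → a < n → b < n → a ≢ b →
    (∀ i → i < n → i ≢ a → i ≢ b → f i ≈ ε) → big n f ≈ f a ∙ f b
  big-pair n {f} a b a<n b<n a≢b rest = ≈-trans (big-cong n split) (≈-trans (big-∙ n _ _)
    (∙-cong (≈-trans (big-single n a a<n λ i _ i≢a → pick-≢ {i} {a} (f i) i≢a) (pick-≡ a (f a)))
      (≈-trans (big-single n b b<n off) (≈-reflexive (cong (λ β → if β then ε else f b) (≢⇒≡ᵇ (a≢b ∘ sym)))))))
    where
    ≈-reflexive : ∀ {x y : Carrier} → x ≡ y → x ≈ y
    ≈-reflexive refl = ≈-refl
    split : ∀ i → i < n → f i ≈ pick i a (f i) ∙ (if i ≡ᵇ a then ε else f i)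
    split i i<n with i ≡ᵇ a
    ... | true  = ≈-sym (identityʳ (f i))
    ... | false = ≈-sym (identityˡ (f i))
    off : ∀ i → i < n → i ≢ b → (if i ≡ᵇ a then ε else f i) ≈ ε
    off i i<n i≢b with i ≟ a
    ... | yes refl = ≈-reflexive (cong (λ β → if β then ε else f i) (≡ᵇ-refl i))
    ... | no i≢a = ≈-trans (≈-reflexive (cong (λ β → if β then ε else f i) (≢⇒≡ᵇ i≢a))) (rest i i<n i≢a i≢b)

  module Monotone {ℓ′} (_⊑_ : Carrier → Carrier → Set ℓ′) (ε⊑ε : ε ⊑ ε)
                  (mono : ∀ {a b c d} → a ⊑ b → c ⊑ d → (a ∙ c) ⊑ (b ∙ d)) where
    big-mono : ∀ n {f g : ℕ → Carrier} → (∀ i → i < n → f i ⊑ g i) → big n f ⊑ big n g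
    big-mono zero    f⊑g = ε⊑ε
    big-mono (suc n) f⊑g = mono (big-mono n λ i i<n → f⊑g i (m<n⇒m<1+n i<n)) (f⊑g n (n<1+n n))

module Sumℕ = BigOp +-0-commutativeMonoid
module Prodℕ = BigOp *-1-commutativeMonoid
module Sum≤ = Sumℕ.Monotone _≤_ z≤n +-mono-≤
module Prod≤ = Prodℕ.Monotone _≤_ ≤-refl *-mono-≤

∑ ∏ : ℕ → (ℕ → ℕ) → ℕ
∑ = Sumℕ.big
∏ = Prodℕ.big

𝟙 : Bool → ℕ
𝟙 b = if b then 1 else 0

count : ℕ → (ℕ → Bool) → ℕ
count n p = foldn n 0 λ i acc → if p i then suc acc else acc

count-∑ : ∀ n p → count n p ≡ ∑ n (𝟙 ∘ p)
count-∑ zero    p = refl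
count-∑ (suc n) p with p n
... | true  = trans (cong suc (count-∑ n p)) (+-comm 1 _)
... | false = trans (count-∑ n p) (sym (+-identityʳ _))

count-cong : ∀ n {p q : ℕ → Bool} → (∀ i → i < n → p i ≡ q i) → count n p ≡ count n q
count-cong n p≡q = foldn-cong n refl λ i x i<n → cong (λ b → if b then suc x else x) (p≡q i i<n)

count-none : ∀ n → count n (λ _ → false) ≡ 0
count-none zero    = refl
count-none (suc n) = count-none n

count≤n : ∀ n p → count n p ≤ n
count≤n zero    p = z≤n
count≤n (suc n) p with p n
... | true  = s≤s (count≤n n p)
... | false = m≤n⇒m≤1+n (count≤n n p)

count-mono : ∀ n {p q : ℕ → Bool} → (∀ i → i < n → p i ≡ true → q i ≡ true) → count n p ≤ count n q
count-mono zero    p⇒q = z≤n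
count-mono (suc n) {p} {q} p⇒q with p n | q n | p⇒q n (n<1+n n) | count-mono n {p} {q} (λ i i<n → p⇒q i (m<n⇒m<1+n i<n))
... | true  | true  | _ | ih = s≤s ih
... | true  | false | h | ih = case h refl of λ ()
... | false | true  | _ | ih = m≤n⇒m≤1+n ih
... | false | false | _ | ih = ih

count-all : ∀ n {p : ℕ → Bool} → (∀ i → i < n → p i ≡ true) → count n p ≡ n
count-all zero    all = refl
count-all (suc n) all rewrite all n (n<1+n n) = cong suc (count-all n λ i i<n → all i (m<n⇒m<1+n i<n))

count-full : ∀ n {p : ℕ → Bool} → count n p ≡ n → ∀ i → i < n → p i ≡ true
count-full (suc n) {p} full i i<sn with p n in eq
... | false = ⊥-elim (<⇒≱ (≤-reflexive (sym full)) (count≤n n p))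
... | true with i ≟ n
...   | yes refl = eq
...   | no i≢n = count-full n (suc-injective full) i (≤∧≢⇒< (≤-pred i<sn) i≢n)

insert : ℕ → (ℕ → Bool) → ℕ → Bool
insert y p x = (x ≡ᵇ y) ∨ p x

count-insert : ∀ n {p} y → y < n → p y ≡ false → count n (insert y p) ≡ suc (count n p)
count-insert (suc n) {p} y y<sn py with y ≟ n
... | yes refl rewrite ≡ᵇ-refl y | py =
  cong suc (count-cong y λ i i<n → cong (_∨ p i) (≢⇒≡ᵇ (<⇒≢ i<n)))
... | no y≢n rewrite ≢⇒≡ᵇ {n} {y} (y≢n ∘ sym) with p n | count-insert n {p} y (≤∧≢⇒< (≤-pred y<sn) y≢n) py
...   | true  | ih = cong suc ih
...   | false | ih = ih

shift : ℕ → ℕ → ℕ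
shift zero    S = S
shift (suc x) S = ⌊ shift x S /2⌋

odd : ℕ → Bool
odd v = 1 ≤ᵇ v ∸ (⌊ v /2⌋ + ⌊ v /2⌋)

bit : ℕ → ℕ → Bool
bit x S = odd (shift x S)

shift-half : ∀ x S → shift (suc x) S ≡ shift x ⌊ S /2⌋
shift-half zero    S = refl
shift-half (suc x) S = cong ⌊_/2⌋ (shift-half x S)

half-2* : ∀ b v → ⌊ 𝟙 b + (v + v) /2⌋ ≡ v
half-2* false v = sym (n≡⌊n+n/2⌋ v)
half-2* true  zero = refl
half-2* true  (suc v) = cong suc (trans (cong ⌊_/2⌋ (+-suc v v)) (half-2* true v))

odd-2* : ∀ b v → odd (𝟙 b + (v + v)) ≡ b
odd-2* b v rewrite half-2* b v | m+n∸n≡m (𝟙 b) (v + v) with b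
... | true  = refl
... | false = refl

mask : ℕ → (ℕ → Bool) → ℕ
mask zero    p = 0
mask (suc n) p = 𝟙 (p 0) + (mask n (p ∘ suc) + mask n (p ∘ suc))

double-half : ∀ S → 𝟙 (odd S) + (⌊ S /2⌋ + ⌊ S /2⌋) ≡ S
double-half zero          = refl
double-half (suc zero)    = refl
double-half (suc (suc S)) = begin
  𝟙 (odd (2 + S)) + (suc h + suc h)   ≡⟨ cong (λ b → 𝟙 b + (suc h + suc h)) odd-2+ ⟩
  𝟙 (odd S) + (suc h + suc h)         ≡⟨ cong (λ z → 𝟙 (odd S) + suc z) (+-suc h h) ⟩
  𝟙 (odd S) + suc (suc (h + h))       ≡⟨ trans (+-suc (𝟙 (odd S)) (suc (h + h))) (cong suc (+-suc (𝟙 (odd S)) (h + h))) ⟩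
  suc (suc (𝟙 (odd S) + (h + h)))     ≡⟨ cong (2 +_) (double-half S) ⟩
  2 + S                               ∎
  where
  open ≡-Reasoning
  h : ℕ
  h = ⌊ S /2⌋
  odd-2+ : odd (2 + S) ≡ odd S
  odd-2+ = cong (λ z → 1 ≤ᵇ 1 + S ∸ z) (+-suc h h)

mask-none : ∀ n → mask n (λ _ → false) ≡ 0
mask-none zero    = refl
mask-none (suc n) = cong (λ m → m + m) (mask-none n)

mask-cong : ∀ n {p q : ℕ → Bool} → (∀ x → x < n → p x ≡ q x) → mask n p ≡ mask n q
mask-cong zero    p≡q = refl
mask-cong (suc n) p≡q = cong₂ (λ b m → 𝟙 b + (m + m)) (p≡q 0 (s≤s z≤n)) (mask-cong n λ x x<n → p≡q (suc x) (s≤s x<n))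

bit-mask : ∀ n p x → x < n → bit x (mask n p) ≡ p x
bit-mask (suc n) p zero    _ = odd-2* (p 0) (mask n (p ∘ suc))
bit-mask (suc n) p (suc x) (s≤s x<n) = trans
  (cong odd (trans (shift-half x _) (cong (shift x) (half-2* (p 0) (mask n (p ∘ suc))))))
  (bit-mask n (p ∘ suc) x x<n)

mask<2^n : ∀ n p → mask n p < 2 ^ n
mask<2^n zero    p = s≤s z≤n
mask<2^n (suc n) p = begin
  suc (𝟙 (p 0) + (m + m))     ≤⟨ s≤s (+-monoˡ-≤ (m + m) (𝟙≤1 (p 0))) ⟩
  suc (suc (m + m))           ≡⟨ cong suc (+-suc m m) ⟨
  suc m + suc m               ≤⟨ +-mono-≤ (mask<2^n n (p ∘ suc)) (mask<2^n n (p ∘ suc)) ⟩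
  2 ^ n + 2 ^ n               ≡⟨ cong (2 ^ n +_) (+-identityʳ (2 ^ n)) ⟨
  2 ^ suc n                   ∎
  where
  open ≤-Reasoning
  m : ℕ
  m = mask n (p ∘ suc)
  𝟙≤1 : ∀ b → 𝟙 b ≤ 1
  𝟙≤1 true  = ≤-refl
  𝟙≤1 false = z≤n

half-< : ∀ n {S} → S < 2 ^ suc n → ⌊ S /2⌋ < 2 ^ n
half-< n {S} S< = ≰⇒> λ le → <⇒≱ S< (begin
  2 ^ n + (2 ^ n + 0)            ≡⟨ cong (2 ^ n +_) (+-identityʳ (2 ^ n)) ⟩
  2 ^ n + 2 ^ n                  ≤⟨ +-mono-≤ le le ⟩
  ⌊ S /2⌋ + ⌊ S /2⌋              ≤⟨ m≤n+m _ (𝟙 (odd S)) ⟩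
  𝟙 (odd S) + (⌊ S /2⌋ + ⌊ S /2⌋) ≡⟨ double-half S ⟩
  S                              ∎)
  where open ≤-Reasoning

mask-bit : ∀ n {S} → S < 2 ^ n → mask n (λ x → bit x S) ≡ S
mask-bit zero    (s≤s z≤n) = refl
mask-bit (suc n) {S} S< = trans
  (cong (λ m → 𝟙 (odd S) + (m + m)) (trans (mask-cong n λ x _ → cong odd (shift-half x S))
    (mask-bit n (half-< n S<))))
  (double-half S)

mask-insert : ∀ n p y → y < n → p y ≡ false → mask n (insert y p) ≡ mask n p + 2 ^ y
mask-insert (suc n) p zero _ p0 rewrite p0 = +-comm 1 _
mask-insert (suc n) p (suc y) (s≤s y<n) py = begin
  𝟙 (p 0) + (mask n (insert y (p ∘ suc)) + mask n (insert y (p ∘ suc)))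
    ≡⟨ cong (λ z → 𝟙 (p 0) + (z + z)) (mask-insert n (p ∘ suc) y y<n py) ⟩
  𝟙 (p 0) + ((m + 2 ^ y) + (m + 2 ^ y))
    ≡⟨ rearrange (𝟙 (p 0)) m (2 ^ y) ⟩
  𝟙 (p 0) + (m + m) + 2 ^ suc y
    ∎
  where
  open ≡-Reasoning
  m : ℕ
  m = mask n (p ∘ suc)
  rearrange : ∀ b m q → b + ((m + q) + (m + q)) ≡ b + (m + m) + (q + (q + 0))
  rearrange = solve-∀

module Masks (n : ℕ) where

  -- Adding 2 ^ y to a mask without y produces no carry, so inserting a point is a single addition.
  add-mask : ∀ {S y} → S < 2 ^ n → y < n → bit y S ≡ false →
    S + 2 ^ y ≡ mask n (insert y λ x → bit x S)
  add-mask {S} {y} S< y<n by = sym (trans (mask-insert n _ y y<n by) (cong (_+ 2 ^ y) (mask-bit n S<)))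

  add-< : ∀ {S y} → S < 2 ^ n → y < n → bit y S ≡ false → S + 2 ^ y < 2 ^ n
  add-< S< y<n by = subst (_< 2 ^ n) (sym (add-mask S< y<n by)) (mask<2^n n _)

  bit-add : ∀ {S y x} → S < 2 ^ n → y < n → bit y S ≡ false → x < n →
    bit x (S + 2 ^ y) ≡ (x ≡ᵇ y) ∨ bit x S
  bit-add {x = x} S< y<n by x<n = trans (cong (bit x) (add-mask S< y<n by)) (bit-mask n _ x x<n)

  size : ℕ → ℕ
  size S = count n λ x → bit x S

  size-add : ∀ {S y} → S < 2 ^ n → y < n → bit y S ≡ false → size (S + 2 ^ y) ≡ suc (size S)
  size-add {y = y} S< y<n by = trans (count-cong n λ x x<n → bit-add S< y<n by x<n) (count-insert n y y<n by)

  bit-0 : ∀ x → bit x 0 ≡ false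
  bit-0 x = cong odd (shift-0 x)
    where
    shift-0 : ∀ x → shift x 0 ≡ 0
    shift-0 zero    = refl
    shift-0 (suc x) = cong ⌊_/2⌋ (shift-0 x)

  size-0 : size 0 ≡ 0
  size-0 = trans (count-cong n λ x _ → bit-0 x) (count-none n)

∑-double : ∀ N g → ∑ (N + N) g ≡ ∑ N (λ S → g (S + S) + g (1 + (S + S)))
∑-double zero    g = refl
∑-double (suc N) g = trans (cong (λ z → ∑ (suc z) g) (+-suc N N))
  (trans (+-assoc (∑ (N + N) g) _ _) (cong (_+ (g (N + N) + g (1 + (N + N)))) (∑-double N g)))

∑-*ˡ : ∀ n c f → ∑ n (λ i → c * f i) ≡ c * ∑ n f
∑-*ˡ zero    c f = sym (*-zeroʳ c)
∑-*ˡ (suc n) c f = trans (cong (_+ c * f n) (∑-*ˡ n c f)) (sym (*-distribˡ-+ c _ (f n)))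

-- Expanding the product on the right: to choose a summand from each factor is to choose a set. The
-- induction splits off the lowest bit of S.
∑-masks : ∀ n (a b : ℕ → ℕ) → ∑ (2 ^ n) (λ S → ∏ n λ x → if bit x S then a x else b x) ≡ ∏ n (λ x → a x + b x)
∑-masks zero    a b = refl
∑-masks (suc n) a b = begin
  ∑ (2 ^ suc n) w                                          ≡⟨ cong (λ z → ∑ (2 ^ n + z) w) (+-identityʳ (2 ^ n)) ⟩
  ∑ (2 ^ n + 2 ^ n) w                                      ≡⟨ ∑-double (2 ^ n) w ⟩
  ∑ (2 ^ n) (λ S → w (S + S) + w (1 + (S + S)))            ≡⟨ Sumℕ.big-cong (2 ^ n) (λ S _ → cong₂ _+_ (split false S) (split true S)) ⟩
  ∑ (2 ^ n) (λ S → b 0 * w′ S + a 0 * w′ S)                ≡⟨ Sumℕ.big-cong (2 ^ n) (λ S _ → trans (+-comm (b 0 * w′ S) _) (sym (*-distribʳ-+ (w′ S) (a 0) (b 0)))) ⟩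
  ∑ (2 ^ n) (λ S → (a 0 + b 0) * w′ S)                     ≡⟨ ∑-*ˡ (2 ^ n) (a 0 + b 0) w′ ⟩
  (a 0 + b 0) * ∑ (2 ^ n) w′                               ≡⟨ cong ((a 0 + b 0) *_) (∑-masks n (a ∘ suc) (b ∘ suc)) ⟩
  (a 0 + b 0) * ∏ n (λ x → a (suc x) + b (suc x))          ≡⟨ Prodℕ.big-head n (λ x → a x + b x) ⟨
  ∏ (suc n) (λ x → a x + b x)                              ∎
  where
  open ≡-Reasoning
  w w′ : ℕ → ℕ
  w  S = ∏ (suc n) λ x → if bit x S then a x else b x
  w′ S = ∏ n λ x → if bit x S then a (suc x) else b (suc x)
  split : ∀ c S → w (𝟙 c + (S + S)) ≡ (if c then a 0 else b 0) * w′ S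
  split c S = trans (Prodℕ.big-head n _) (cong₂ _*_
    (cong (λ z → if z then a 0 else b 0) (odd-2* c S))
    (Prodℕ.big-cong n λ x _ → cong (λ z → if z then a (suc x) else b (suc x))
      (cong odd (trans (shift-half x _) (cong (shift x) (half-2* c S))))))

-- The algorithm

v₀ : ∀ {r} → Term (suc r)
v₀ = top

v₁ : ∀ {r} → Term (2 + r)
v₁ = wk top

wk² : ∀ {r} → Term r → Term (2 + r)
wk² e = wk (wk e)

-- Loops always make n rounds, so x-fold repetition is a loop that idles from round x on. It is
-- exact for x ≤ n.
powₜ pointsₜ parityₜ : ∀ {r} → Term r → Term r
shiftₜ hasₜ : ∀ {r} → Term r → Term r → Term r
hasᶜ : ∀ {r} → Term r → Term r → Cond r

shiftₜ x S = fold S (ite (leq (add (con 1) v₀) (wk² x)) (halve v₁) v₁)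

powₜ x = fold (con 1) (ite (leq (add (con 1) v₀) (wk² x)) (add v₁ v₁) v₁)

parityₜ v = sub v (add (halve v) (halve v))

hasₜ x S = parityₜ (shiftₜ x S)

hasᶜ x S = leq (con 1) (hasₜ x S)

pointsₜ S = fold (con 0) (ite (hasᶜ v₀ (wk² S)) (add (con 1) v₁) v₁)

-- Two single distances are compared as sums whose condition admits only index 0.
nearᶜ : ∀ {r} → Term r → Term r → Term r → Term r → Cond r
nearᶜ c x c′ x′ = sums (leq v₀ (con 0)) (wk (add (row c) x)) (leq v₀ (con 0)) (wk (add (row c′) x′))

-- A center is assigned to itself whatever the ties, so that no output cluster is empty. The initial
-- 0 of the scan is a placeholder until a center is met.
nearestₜ : ∀ {r} → Term r → Term r → Term r
nearestₜ m x = ite (hasᶜ x m) x (fold (con 0) (ite (hasᶜ v₀ (wk² m))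
  (ite (hasᶜ v₁ (wk² m)) (ite (nearᶜ v₀ (wk² x) v₁ (wk² x)) v₀ v₁) v₀) v₁))

costᶜᵒ : ∀ {r} → Term r → Term r → Term r → Cond r
costᶜᵒ S m m′ = sums (hasᶜ v₀ (wk S)) (add (row (nearestₜ (wk m) v₀)) v₀)
                     (hasᶜ v₀ (wk S)) (add (row (nearestₜ (wk m′) v₀)) v₀)

totalᶜ : ∀ {r} → Term r → Term r → Cond r
totalᶜ m m′ = sums (leq (con 0) (con 0)) (add (row (nearestₜ (wk m) v₀)) v₀)
                   (leq (con 0) (con 0)) (add (row (nearestₜ (wk m′) v₀)) v₀)

-- `greedyₜ` measures distances to the set `m′` and not to the growing set: an added center is meant
-- to serve only itself, and then the saving is exactly its distance to the given centers.
farₜ greedyₜ : ∀ {r} → Term r → Term r → Term r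
farₜ m C = fold (con 0) (ite (hasᶜ v₀ (wk² C)) v₁ (ite (hasᶜ v₁ (wk² C)) v₀
  (ite (nearᶜ (nearestₜ (wk² m) v₁) v₁ (nearestₜ (wk² m) v₀) v₀) v₀ v₁)))

greedyₜ m m′ = fold m (ite (leq (add (con 1) (pointsₜ v₁)) #k) (add v₁ (powₜ (farₜ (wk² m′) v₁))) v₁)

opaque
  -- Sets with more than k points are refused, so the best set so far can always be completed to
  -- exactly k centers.
  betterₜ : ∀ {r} → Term r → Term r → Term r
  betterₜ a b = ite (leq (pointsₜ b) #k) (ite (totalᶜ (greedyₜ b b) (greedyₜ a a)) b a) a

-- Every profile assigns to each point x a factor a(x) for membership and
-- 756 − a(x) for non-membership; since 756 / 400 = 1.89, at most 1.89ⁿ sets have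
-- a product of factors ≥ 400ⁿ.  The odds 252 : 504 favor sets of n / 3 points,
-- 378 : 378 treats all sets alike once a prefix is fixed (756 : 0), and
-- 324 : 432 and 189 : 567 favor, among the sets of n / 3 points, those that
-- contain more points of one color than of the other.

thresholdₜ : ∀ {r} → Term r
thresholdₜ = fold (con 1) (times 400 v₁)

weightₜ : ∀ {r} → Cond (2 + r) → ℕ → ℕ → Term r → Term r
weightₜ c a b S = fold (con 1) (ite c
  (ite (hasᶜ v₀ (wk² S)) (times a v₁) (times (756 ∸ a) v₁))
  (ite (hasᶜ v₀ (wk² S)) (times b v₁) (times (756 ∸ b) v₁)))

-- A Hadamard code: M indexes the coloring of the points x.

dotᶜ : ∀ {r} → Term r → Term r → Cond r
dotᶜ M x = leq (con 1) (parityₜ (fold (con 0)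
  (ite (hasᶜ v₀ (wk² M)) (ite (hasᶜ v₀ (wk² x)) (add (con 1) v₁) v₁) v₁)))

opaque
  -- The loops supply q, r < n. The first profile fixes q points, possibly none; the second fixes q
  -- + 1, possibly all. In the third, q * n + r numbers a code word, and x is encoded as 2 x + 1 so
  -- that the lowest bit of the word can exchange the two colors.
  heavyₜ : ∀ {r} → Term r → Term r
  heavyₜ S = fold (con 0) (fold v₁
    (ite (leq thresholdₜ (weightₜ (leq (add (con 1) v₀) (wk² q)) 756 252 (wk² (wk² S)))) (con 1)
    (ite (leq thresholdₜ (weightₜ (leq v₀ (wk² q)) 756 378 (wk² (wk² S)))) (con 1)
    (ite (leq thresholdₜ (weightₜ (dotᶜ (wk² (add (row q) v₀)) (add (con 1) (add v₀ v₀))) 324 189 (wk² (wk² S)))) (con 1)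
     v₁))))
    where
    q : ∀ {r} → Term (4 + r)
    q = wk² v₀

indexₜ : ∀ {r} → Term r → Term r → Term r → Term r
indexₜ S j c = add (row (add (row S) j)) c

-- A table entry for c is a set of centers and is valid only if it contains c, so the initial 0
-- means that nothing has been found. Costs are recomputed from the set at each comparison.
improveₜ : ∀ {r} → Term r → Term r → Term r → Term r → Term r
improveₜ u c acc m =
  ite (hasᶜ c m) (ite (hasᶜ c acc) (ite (costᶜᵒ u m acc) m acc) m) acc

opaque
  -- The recurrence is over the last point of u: either it joined the cluster of c, or it opened
  -- that cluster after one with some center c′.
  entryₜ : ∀ {r} → Term r → Term r → Term r → Term r
  entryₜ {r} u j c = fold (ite (leq u (con 0)) (ite (leq j (con 0)) (powₜ c) (con 0)) (con 0))
    (ite (hasᶜ v₀ (wk² u))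
      (fold (improveₜ (wk² u) (wk² c) v₁ (get table (indexₜ (sub (wk² u) (powₜ v₀)) (wk² j) (wk² c))))
        (ite (leq (con 1) (wk² (wk² j)))
          (ite (hasᶜ v₀ m) (improveₜ (wk² (wk² u)) (wk² (wk² c)) v₁
              (ite (hasᶜ (wk² (wk² c)) m) m (add m (powₜ (wk² (wk² c)))))) v₁)
          v₁))
      v₁)
    where
    m : Term (4 + r)
    m = get table (indexₜ (sub (wk² (wk² u)) (powₜ (wk² v₀))) (sub (wk² (wk² j)) (con 1)) v₀)

-- Inverse bijections between C and the numbers below its size. Ranks increase strictly on C, so for
-- such i the last point of rank at most i has rank i.
rankₜ nthₜ : ∀ {r} → Term r → Term r → Term r
rankₜ y C = fold (con 0) (ite (leq (add (con 1) v₀) (wk² y)) (ite (hasᶜ v₀ (wk² C)) (add (con 1) v₁) v₁) v₁)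
nthₜ i C = fold (con 0) (ite (hasᶜ v₀ (wk² C)) (ite (leq (rankₜ v₀ (wk² C)) (wk² i)) v₀ v₁) v₁)

headₜ tailₜ bestₜ : ∀ {r} → Term r
headₜ = get glob (con 0)
tailₜ = get glob (con 1)
bestₜ = get glob (con 2)

opaque
  starting : Cmd zero
  starting = put glob (con 1) (con 1) ▷ put seen (con 0) (con 1)

opaque
  -- `candidates` consults the entries of every u, whether or not u contains all points: any set of
  -- at most k centers is an admissible candidate.
  visit rows candidates expand : Cmd (suc zero)

  visit = put glob (con 2) (betterₜ bestₜ v₀)

  rows = for (for (put table (indexₜ (wk² v₀) v₁ v₀) (entryₜ (wk² v₀) v₁ v₀)))

  candidates = put glob (con 2) (fold bestₜ (betterₜ v₁ (get table (indexₜ (wk² v₀) (sub #k (con 1)) v₀))))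

  expand = for
    (when (leq (hasₜ v₀ v₁) (con 0))
      (when (leq (con 1) (heavyₜ S′))
        (when (leq (get seen S′) (con 0))
          (put seen S′ (con 1) ▷ put queue tailₜ S′ ▷ put glob (con 1) (add (con 1) tailₜ)))))
    where
    S′ : Term (suc (suc zero))
    S′ = add v₁ (powₜ v₀)

opaque
  process : Cmd (suc zero)
  process = visit ▷ rows ▷ candidates ▷ expand ▷ put glob (con 0) (add (con 1) headₜ)

  searching finishing : Cmd zero

  searching = bind (get queue headₜ) process

  finishing = bind (greedyₜ bestₜ bestₜ)
    (for (when (leq (add (con 1) v₀) #k) (put out (add (add #n #n) v₀) (nthₜ v₀ v₁))) ▷
     for (put out (add (add #n #n) (add #k v₀)) (rankₜ (nearestₜ v₁ v₀) v₁)))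

-- The algorithm as functions on numbers and heaps

module Spec (F : OrderedField 0ℓ 0ℓ 0ℓ) (n k : ℕ) (V : ℕ → ℕ → OrderedField.Carrier F) where
  open OrderedField F using (Carrier; 0#) renaming (_+_ to _+ᶠ_; _≤?_ to _≤?ᶠ_)

  sumIf : (ℕ → Bool) → (ℕ → Carrier) → Carrier
  sumIf p f = foldn n 0# λ x acc → if p x then acc +ᶠ f x else acc

  has : ℕ → ℕ → Bool
  has x S = odd (foldn n S λ i acc → if suc i ≤ᵇ x then ⌊ acc /2⌋ else acc)

  pow : ℕ → ℕ
  pow x = foldn n 1 λ i acc → if suc i ≤ᵇ x then acc + acc else acc

  points : ℕ → ℕ
  points S = count n λ x → has x S

  near≤ : ℕ → ℕ → ℕ → ℕ → Bool
  near≤ c x c′ x′ = ⌊ sumIf (_≤ᵇ 0) (λ _ → V c x) ≤?ᶠ sumIf (_≤ᵇ 0) (λ _ → V c′ x′) ⌋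

  nearest : ℕ → ℕ → ℕ
  nearest m x = if has x m then x else foldn n 0 λ i acc →
    if has i m then (if has acc m then (if near≤ i x acc x then i else acc) else i) else acc

  opaque
    cost : ℕ → ℕ → Carrier
    cost S m = sumIf (λ x → has x S) λ x → V (nearest m x) x

    total : ℕ → Carrier
    total m = sumIf (λ _ → true) λ x → V (nearest m x) x

  far : ℕ → ℕ → ℕ
  far m C = foldn n 0 λ y z → if has y C then z else
    (if has z C then y else (if near≤ (nearest m z) z (nearest m y) y then y else z))

  opaque
    greedy : ℕ → ℕ
    greedy m = foldn n m λ _ C → if suc (points C) ≤ᵇ k then C + pow (far m C) else C

  opaque
    better : ℕ → ℕ → ℕ
    better a b = if points b ≤ᵇ k
      then (if ⌊ total (greedy b) ≤?ᶠ total (greedy a) ⌋ then b else a) else a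

  weight : (ℕ → Bool) → ℕ → ℕ → ℕ → ℕ
  weight p a b S = foldn n 1 λ x acc → if p x
    then (if has x S then a * acc else (756 ∸ a) * acc)
    else (if has x S then b * acc else (756 ∸ b) * acc)

  dot : ℕ → ℕ → Bool
  dot M x = odd (foldn n 0 λ b acc → if has b M then (if has b x then suc acc else acc) else acc)

  profile₁ profile₂ profile₃ : ℕ → ℕ → ℕ → ℕ
  profile₁ q r S = weight (λ x → suc x ≤ᵇ q) 756 252 S
  profile₂ q r S = weight (λ x → x ≤ᵇ q) 756 378 S
  profile₃ q r S = weight (λ x → dot (q * n + r) (suc (x + x))) 324 189 S

  threshold : ℕ
  threshold = foldn n 1 λ _ acc → 400 * acc

  opaque
    heavy : ℕ → ℕ
    heavy S = foldn n 0 λ q acc → foldn n acc λ r acc →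
      if threshold ≤ᵇ profile₁ q r S then 1 else
      (if threshold ≤ᵇ profile₂ q r S then 1 else
      (if threshold ≤ᵇ profile₃ q r S then 1 else acc))

  index : ℕ → ℕ → ℕ → ℕ
  index S j c = (S * n + j) * n + c

  improve : ℕ → ℕ → ℕ → ℕ → ℕ
  improve u c acc m =
    if has c m then (if has c acc then (if ⌊ cost u m ≤?ᶠ cost u acc ⌋ then m else acc) else m) else acc

  join : ℕ → ℕ → ℕ
  join c m = if has c m then m else m + pow c

  seed : ℕ → ℕ → ℕ → ℕ
  seed u j c = if u ≤ᵇ 0 then (if j ≤ᵇ 0 then pow c else 0) else 0

  opaque
    entry : (ℕ → ℕ) → ℕ → ℕ → ℕ → ℕ
    entry t u j c = foldn n (seed u j c) λ x acc →
      if has x u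
      then foldn n (improve u c acc (t (index (u ∸ pow x) j c))) (λ c′ acc →
        if 1 ≤ᵇ j
        then (if has c′ (t (index (u ∸ pow x) (j ∸ 1) c′))
              then improve u c acc (join c (t (index (u ∸ pow x) (j ∸ 1) c′))) else acc)
        else acc)
      else acc

  rank nth : ℕ → ℕ → ℕ
  rank y C = foldn n 0 λ z acc → if suc z ≤ᵇ y then (if has z C then suc acc else acc) else acc
  nth i C = foldn n 0 λ y acc → if has y C then (if rank y C ≤ᵇ i then y else acc) else acc

  lacks : ℕ → ℕ → Bool
  lacks x S = (v ∸ (⌊ v /2⌋ + ⌊ v /2⌋)) ≤ᵇ 0
    where
    v : ℕ
    v = foldn n S λ i acc → if suc i ≤ᵇ x then ⌊ acc /2⌋ else acc

  visitedH : Heap → ℕ → Heap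
  visitedH H u = store H glob 2 (better (H glob 2) u)

  rowsH : Heap → ℕ → Heap
  rowsH H u = foldn n H λ j H → foldn n H λ c H → store H table (index u j c) (entry (H table) u j c)

  candidatesH : Heap → ℕ → Heap
  candidatesH H u = store H glob 2
    (foldn n (H glob 2) λ c best → better best (H table (index u (k ∸ 1) c)))

  pushH : Heap → ℕ → Heap
  pushH H S = let H₁ = store H seen S 1 ; H₂ = store H₁ queue (H₁ glob 1) S in
    store H₂ glob 1 (suc (H₂ glob 1))

  expandH : Heap → ℕ → Heap
  expandH H u = foldn n H λ x H →
    if lacks x u then
      (if 1 ≤ᵇ heavy (u + pow x) then
        (if H seen (u + pow x) ≤ᵇ 0 then pushH H (u + pow x) else H) else H) else H

  advanceH : Heap → Heap
  advanceH H = store H glob 0 (suc (H glob 0))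

  searchAt : Heap → ℕ → Heap
  searchAt H u = advanceH (expandH (candidatesH (rowsH (visitedH H u) u) u) u)

  searchH : Heap → Heap
  searchH H = searchAt H (H queue (H glob 0))

  startH : Heap
  startH = store (store (λ _ _ → 0) glob 1 1) seen 0 1

  finishH : Heap → Heap
  finishH H = let C = greedy (H glob 2)
                  H₁ = foldn n H λ i H → if suc i ≤ᵇ k then store H out (n + n + i) (nth i C) else H in
    foldn n H₁ λ x H → store H out (n + n + (k + x)) (rank (nearest C x) C)

-- Agreement of the source terms with these functions

module Meaning (F : OrderedField 0ℓ 0ℓ 0ℓ) (sq : Bool) (n k : ℕ) (D : ℕ → OrderedField.Carrier F) where
  open OrderedField F using (Carrier) renaming (_≤?_ to _≤?ᶠ_)
  open Semantics F sq n k D using (⟦_⟧; ⟦_⟧ᵇ; exec; lookupᵈ)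
  open Spec F n k (λ c x → lookupᵈ (c * n + x))

  nearest-spec : ∀ {r} (m x : Term r) {H ρ} → ⟦ nearestₜ m x ⟧ H ρ ≡ nearest (⟦ m ⟧ H ρ) (⟦ x ⟧ H ρ)
  nearest-spec m x = refl

  opaque
    unfolding total cost

    total-spec : ∀ {r} (m m′ : Term r) {H ρ} → ⟦ totalᶜ m m′ ⟧ᵇ H ρ ≡
      ⌊ total (⟦ m ⟧ H ρ) ≤?ᶠ total (⟦ m′ ⟧ H ρ) ⌋
    total-spec m m′ = refl

    cost-spec : ∀ {r} (S m m′ : Term r) {H ρ} → ⟦ costᶜᵒ S m m′ ⟧ᵇ H ρ ≡
      ⌊ cost (⟦ S ⟧ H ρ) (⟦ m ⟧ H ρ) ≤?ᶠ cost (⟦ S ⟧ H ρ) (⟦ m′ ⟧ H ρ) ⌋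
    cost-spec S m m′ = refl

  opaque
    unfolding greedy

    greedy-spec : ∀ {r} (m : Term r) {H ρ} → ⟦ greedyₜ m m ⟧ H ρ ≡ greedy (⟦ m ⟧ H ρ)
    greedy-spec m {H} {ρ} = refl

  opaque
    unfolding betterₜ better

    better-spec : ∀ {r} (a b : Term r) {H ρ} → ⟦ betterₜ a b ⟧ H ρ ≡ better (⟦ a ⟧ H ρ) (⟦ b ⟧ H ρ)
    better-spec a b {H} {ρ} = cong (λ β → if points (⟦ b ⟧ H ρ) ≤ᵇ k then (if β then ⟦ b ⟧ H ρ else ⟦ a ⟧ H ρ) else ⟦ a ⟧ H ρ)
      (trans (total-spec (greedyₜ b b) (greedyₜ a a))
        (cong₂ (λ x y → ⌊ total x ≤?ᶠ total y ⌋) (greedy-spec b) (greedy-spec a)))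

  weight-spec : ∀ {r} (c : Cond (2 + r)) (p : ℕ → Bool) a b (S : Term r) {H ρ} →
    (∀ x acc → ⟦ c ⟧ᵇ H (x ∷ acc ∷ ρ) ≡ p x) → ⟦ weightₜ c a b S ⟧ H ρ ≡ weight p a b (⟦ S ⟧ H ρ)
  weight-spec c p a b S {H} {ρ} c≡p = foldn-cong n refl λ x acc _ →
    cong (λ β → if β then (if has x (⟦ S ⟧ H ρ) then a * acc else (756 ∸ a) * acc)
                else (if has x (⟦ S ⟧ H ρ) then b * acc else (756 ∸ b) * acc)) (c≡p x acc)

  opaque
    unfolding heavyₜ heavy

    heavy-spec : ∀ {r} (S : Term r) {H ρ} → ⟦ heavyₜ S ⟧ H ρ ≡ heavy (⟦ S ⟧ H ρ)
    heavy-spec S {H} {ρ} = foldn-cong n refl λ q acc _ → foldn-cong n refl λ r acc′ _ →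
      let ρ′ = r ∷ acc′ ∷ q ∷ acc ∷ ρ in
      some
        (weight-spec (leq (add (con 1) v₀) (wk² (wk² v₀))) (λ x → suc x ≤ᵇ q) 756 252 (wk² (wk² S)) {H} {ρ′} λ _ _ → refl)
        (weight-spec (leq v₀ (wk² (wk² v₀))) (λ x → x ≤ᵇ q) 756 378 (wk² (wk² S)) {H} {ρ′} λ _ _ → refl)
        (weight-spec (dotᶜ (wk² (add (row (wk² v₀)) v₀)) (add (con 1) (add v₀ v₀)))
          (λ x → dot (q * n + r) (suc (x + x))) 324 189 (wk² (wk² S)) {H} {ρ′} λ _ _ → refl)
      where
      some : ∀ {a a′ b b′ c c′ acc} → a ≡ a′ → b ≡ b′ → c ≡ c′ →
        (if threshold ≤ᵇ a then 1 else (if threshold ≤ᵇ b then 1 else (if threshold ≤ᵇ c then 1 else acc))) ≡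
        (if threshold ≤ᵇ a′ then 1 else (if threshold ≤ᵇ b′ then 1 else (if threshold ≤ᵇ c′ then 1 else acc)))
      some refl refl refl = refl

  improve-spec : ∀ {r} (u c acc m : Term r) {H ρ} → ⟦ improveₜ u c acc m ⟧ H ρ ≡
    improve (⟦ u ⟧ H ρ) (⟦ c ⟧ H ρ) (⟦ acc ⟧ H ρ) (⟦ m ⟧ H ρ)
  improve-spec u c acc m {H} {ρ} = cong (λ β → if has (⟦ c ⟧ H ρ) (⟦ m ⟧ H ρ)
      then (if has (⟦ c ⟧ H ρ) (⟦ acc ⟧ H ρ) then (if β then ⟦ m ⟧ H ρ else ⟦ acc ⟧ H ρ) else ⟦ m ⟧ H ρ)
      else ⟦ acc ⟧ H ρ)
    (cost-spec u m acc)

  rank-spec : ∀ {r} (y C : Term r) {H ρ} → ⟦ rankₜ y C ⟧ H ρ ≡ rank (⟦ y ⟧ H ρ) (⟦ C ⟧ H ρ)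
  rank-spec y C = refl

  nth-spec : ∀ {r} (i C : Term r) {H ρ} → ⟦ nthₜ i C ⟧ H ρ ≡ nth (⟦ i ⟧ H ρ) (⟦ C ⟧ H ρ)
  nth-spec i C = refl

  opaque
    unfolding entryₜ entry

    entry-spec : ∀ {r} (u j c : Term r) {H ρ} → ⟦ entryₜ u j c ⟧ H ρ ≡
      entry (H table) (⟦ u ⟧ H ρ) (⟦ j ⟧ H ρ) (⟦ c ⟧ H ρ)
    entry-spec {r} u j c {H} {ρ} = foldn-cong n refl λ x acc _ →
      cong (λ z → if has x (⟦ u ⟧ H ρ) then z else acc)
        (foldn-cong n
          (improve-spec (wk² u) (wk² c) v₁ (get table (indexₜ (sub (wk² u) (powₜ v₀)) (wk² j) (wk² c))) {H} {x ∷ acc ∷ ρ})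
          λ c′ acc′ _ →
            let m = H table (index (⟦ u ⟧ H ρ ∸ pow x) (⟦ j ⟧ H ρ ∸ 1) c′) in
            cong (λ z → if 1 ≤ᵇ ⟦ j ⟧ H ρ then (if has c′ m then z else acc′) else acc′)
              (improve-spec (wk² (wk² u)) (wk² (wk² c)) v₁
                (ite (hasᶜ (wk² (wk² c)) mₜ) mₜ (add mₜ (powₜ (wk² (wk² c))))) {H} {c′ ∷ acc′ ∷ x ∷ acc ∷ ρ}))
      where
      mₜ : Term (4 + r)
      mₜ = get table (indexₜ (sub (wk² (wk² u)) (powₜ (wk² v₀))) (sub (wk² (wk² j)) (con 1)) v₀)


  opaque
    unfolding starting

    start-spec : exec starting (λ _ _ → 0) [] ≡ startH
    start-spec = refl

  better-at : ∀ {r} (a b : Term r) {H ρ} x y → ⟦ a ⟧ H ρ ≡ x → ⟦ b ⟧ H ρ ≡ y → ⟦ betterₜ a b ⟧ H ρ ≡ better x y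
  better-at a b _ _ refl refl = better-spec a b

  heavy-at : ∀ {r} (S : Term r) {H ρ} x → ⟦ S ⟧ H ρ ≡ x → ⟦ heavyₜ S ⟧ H ρ ≡ heavy x
  heavy-at S _ refl = heavy-spec S

  entry-at : ∀ {r} (u j c : Term r) {H ρ} x y z → ⟦ u ⟧ H ρ ≡ x → ⟦ j ⟧ H ρ ≡ y → ⟦ c ⟧ H ρ ≡ z →
    ⟦ entryₜ u j c ⟧ H ρ ≡ entry (H table) x y z
  entry-at u j c _ _ _ refl refl refl = entry-spec u j c

  opaque
    unfolding visit

    visit-spec : ∀ H u → exec visit H (u ∷ []) ≡ visitedH H u
    visit-spec H u = cong (store H glob 2) (better-at bestₜ v₀ {H} {u ∷ []} (H glob 2) u refl refl)

  opaque
    unfolding rows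

    rows-spec : ∀ H u → exec rows H (u ∷ []) ≡ rowsH H u
    rows-spec H u = foldn-cong n refl λ j H′ _ → foldn-cong n refl λ c H″ _ →
      cong (store H″ table (index u j c)) (entry-at (wk² v₀) v₁ v₀ {H″} {c ∷ j ∷ u ∷ []} u j c refl refl refl)

  opaque
    unfolding candidates

    candidates-spec : ∀ H u → exec candidates H (u ∷ []) ≡ candidatesH H u
    candidates-spec H u = cong (store H glob 2) (foldn-cong n refl λ c best _ →
      better-at v₁ (get table (indexₜ (wk² v₀) (sub #k (con 1)) v₀)) {H} {c ∷ best ∷ u ∷ []}
        best (H table (index u (k ∸ 1) c)) refl refl)

  opaque
    unfolding expand

    expand-spec : ∀ H u → exec expand H (u ∷ []) ≡ expandH H u
    expand-spec H u = foldn-cong n refl λ x H′ _ →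
      cong (λ z → if lacks x u then
          (if 1 ≤ᵇ z then (if H′ seen (u + pow x) ≤ᵇ 0 then pushH H′ (u + pow x) else H′) else H′) else H′)
        (heavy-at (add v₁ (powₜ v₀)) {H′} {x ∷ u ∷ []} (u + pow x) refl)

  opaque
    unfolding searching

    process-spec : ∀ H u → exec process H (u ∷ []) ≡ searchAt H u
    process-spec H u = chain (visit-spec H u) (rows-spec (visitedH H u) u)
      (candidates-spec (rowsH (visitedH H u) u) u) (expand-spec (candidatesH (rowsH (visitedH H u) u) u) u)
      where
      chain : ∀ {H₁ H₂ H₃ H₄ : Heap} → exec visit H (u ∷ []) ≡ H₁ → exec rows H₁ (u ∷ []) ≡ H₂ →
        exec candidates H₂ (u ∷ []) ≡ H₃ → exec expand H₃ (u ∷ []) ≡ H₄ →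
        exec process H (u ∷ []) ≡ advanceH H₄
      chain refl refl refl refl = refl

    search-spec : ∀ H → exec searching H [] ≡ searchH H
    search-spec H = process-spec H (H queue (H glob 0))

  opaque
    unfolding finishing

    finish-spec : ∀ H → exec finishing H [] ≡ finishH H
    finish-spec H = trans (cong (λ C → exec body H (C ∷ [])) (greedy-spec bestₜ {H} {[]}))
      (trans (cong (λ H′ → exec right H′ (C ∷ [])) (foldn-cong n refl λ i H′ _ →
          cong (λ z → if suc i ≤ᵇ k then store H′ out (n + n + i) z else H′) (nth-spec v₀ v₁ {H′} {i ∷ C ∷ []})))
        (foldn-cong n refl λ x H′ _ → cong (store H′ out (n + n + (k + x)))
          (trans (rank-spec (nearestₜ v₁ v₀) v₁ {H′} {x ∷ C ∷ []})
                 (cong (λ y → rank y C) (nearest-spec v₁ v₀ {H′} {x ∷ C ∷ []})))))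
      where
      C : ℕ
      C = greedy (H glob 2)
      left right body : Cmd 1
      left = for (when (leq (add (con 1) v₀) #k) (put out (add (add #n #n) v₀) (nthₜ v₀ v₁)))
      right = for (put out (add (add #n #n) (add #k v₀)) (rankₜ (nearestₜ v₁ v₀) v₁))
      body = left ▷ right

-- Correctness of the search

-- The existential counterpart of an invariant: round i establishes Q whatever came before, and the
-- later rounds keep it.
foldn-hit : ∀ {a q} {A : Set a} (Q : A → Set q) {n i a₀} {f : ℕ → A → A} → i < n →
  (∀ x → Q (f i x)) → (∀ j x → Q x → Q (f j x)) → Q (foldn n a₀ f)
foldn-hit Q {suc n} {i} i<sn hit keep with i ≟ n
... | yes refl = hit _
... | no i≢n = keep n _ (foldn-hit Q (≤∧≢⇒< (≤-pred i<sn) i≢n) hit keep)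

false≢true : false ≢ true
false≢true ()

true⇒≤ : ∀ {a b} → (a ≤ᵇ b) ≡ true → a ≤ b
true⇒≤ {a} {b} eq = ≤ᵇ⇒≤ a b (subst T (sym eq) tt)

false⇒> : ∀ {a b} → (a ≤ᵇ b) ≡ false → b < a
false⇒> eq = ≰⇒> λ a≤b → false≢true (trans (sym eq) (≤ᵇ-true a≤b))

-- Sums in an ordered field

module Ordered (F : OrderedField 0ℓ 0ℓ 0ℓ) where
  open OrderedField F public
    using (Carrier; 0#; _≈_; +-commutativeMonoid; *-nonNegative)
    renaming (_+_ to _+ᶠ_; _*_ to _*ᶠ_; _≤_ to _≤ᶠ_; _≤?_ to _≤?ᶠ_; -_ to -ᶠ_;
              refl to ≈-refl; sym to ≈-sym; trans to ≈-trans; reflexive to ≈-reflexive)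
  private module Fᵒ = OrderedField F
  open IsDecTotalOrder Fᵒ.isDecTotalOrder public
    using () renaming (refl to ≤ᶠ-refl; reflexive to ≤ᶠ-reflexive; trans to ≤ᶠ-trans; total to ≤ᶠ-total; antisym to ≤ᶠ-antisym)

  ≤ᶠ-respˡ : ∀ {a b c} → a ≈ b → b ≤ᶠ c → a ≤ᶠ c
  ≤ᶠ-respˡ a≈b b≤c = ≤ᶠ-trans (≤ᶠ-reflexive a≈b) b≤c

  ≤ᶠ-respʳ : ∀ {a b c} → a ≤ᶠ b → b ≈ c → a ≤ᶠ c
  ≤ᶠ-respʳ a≤b b≈c = ≤ᶠ-trans a≤b (≤ᶠ-reflexive b≈c)

  +ᶠ-mono : ∀ {a b c d} → a ≤ᶠ b → c ≤ᶠ d → (a +ᶠ c) ≤ᶠ (b +ᶠ d)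
  +ᶠ-mono {a} {b} {c} {d} a≤b c≤d = ≤ᶠ-trans (Fᵒ.+-monoʳ-≤ a c≤d)
    (≤ᶠ-respˡ (Fᵒ.+-comm a d) (≤ᶠ-respʳ (Fᵒ.+-monoʳ-≤ d a≤b) (Fᵒ.+-comm d b)))

  +ᶠ-cancelʳ : ∀ {a b} c → (a +ᶠ c) ≤ᶠ (b +ᶠ c) → a ≤ᶠ b
  +ᶠ-cancelʳ {a} {b} c le = ≤ᶠ-respˡ (≈-sym (undo a)) (≤ᶠ-respʳ (+ᶠ-mono le ≤ᶠ-refl) (undo b))
    where
    undo : ∀ x → ((x +ᶠ c) +ᶠ (-ᶠ c)) ≈ x
    undo x = ≈-trans (Fᵒ.+-assoc x c _) (≈-trans (Fᵒ.+-congˡ (Fᵒ.-‿inverseʳ c)) (Fᵒ.+-identityʳ x))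

  module Sumᶠ = BigOp +-commutativeMonoid
  module Sumᶠ≤ = Sumᶠ.Monotone _≤ᶠ_ ≤ᶠ-refl +ᶠ-mono

  ∑ᶠ : ℕ → (ℕ → Carrier) → Carrier
  ∑ᶠ = Sumᶠ.big

  [_]_ : Bool → Carrier → Carrier
  [ b ] x = if b then x else 0#

  []-nonneg : ∀ b {x} → 0# ≤ᶠ x → 0# ≤ᶠ ([ b ] x)
  []-nonneg true  0≤x = 0≤x
  []-nonneg false 0≤x = ≤ᶠ-refl

  []-≤ : ∀ b {x} → 0# ≤ᶠ x → ([ b ] x) ≤ᶠ x
  []-≤ true  0≤x = ≤ᶠ-refl
  []-≤ false 0≤x = 0≤x

  []-mono : ∀ b {x y} → x ≤ᶠ y → ([ b ] x) ≤ᶠ ([ b ] y)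
  []-mono true  x≤y = x≤y
  []-mono false x≤y = ≤ᶠ-refl

  ∑ᶠ-nonneg : ∀ n {f} → (∀ x → x < n → 0# ≤ᶠ f x) → 0# ≤ᶠ ∑ᶠ n f
  ∑ᶠ-nonneg n 0≤f = ≤ᶠ-respˡ (≈-sym (Sumᶠ.big-ε n λ _ _ → ≈-refl)) (Sumᶠ≤.big-mono n 0≤f)

  sumIf-∑ : ∀ n (p : ℕ → Bool) (f : ℕ → Carrier) →
    foldn n 0# (λ x acc → if p x then acc +ᶠ f x else acc) ≈ ∑ᶠ n (λ x → [ p x ] f x)
  sumIf-∑ zero    p f = ≈-refl
  sumIf-∑ (suc n) p f with p n
  ... | true  = Fᵒ.+-congʳ (sumIf-∑ n p f)
  ... | false = ≈-trans (sumIf-∑ n p f) (≈-sym (Fᵒ.+-identityʳ _))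

  _·_ : ℕ → Carrier → Carrier
  zero  · x = 0#
  suc m · x = (m · x) +ᶠ x

  ·-mono : ∀ {m m′} {x} → m ≤ m′ → 0# ≤ᶠ x → (m · x) ≤ᶠ (m′ · x)
  ·-mono {m′ = zero}  z≤n 0≤x = ≤ᶠ-refl
  ·-mono {m′ = suc m′} z≤n 0≤x = ≤ᶠ-respˡ (≈-sym (Fᵒ.+-identityˡ 0#)) (+ᶠ-mono (·-mono {0} {m′} z≤n 0≤x) 0≤x)
  ·-mono (s≤s m≤m′) 0≤x = +ᶠ-mono (·-mono m≤m′ 0≤x) ≤ᶠ-refl

  ∑ᶠ-const : ∀ n p x → ∑ᶠ n (λ i → [ p i ] x) ≈ (count n p · x)
  ∑ᶠ-const zero    p x = ≈-refl
  ∑ᶠ-const (suc n) p x with p n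
  ... | true  = Fᵒ.+-congʳ (∑ᶠ-const n p x)
  ... | false = ≈-trans (Fᵒ.+-identityʳ _) (∑ᶠ-const n p x)

  ≤?-true : ∀ {a b} → ⌊ a ≤?ᶠ b ⌋ ≡ true → a ≤ᶠ b
  ≤?-true {a} {b} eq with a ≤?ᶠ b
  ... | yes a≤b = a≤b
  ≤?-true () | no _

  ≤?-false : ∀ {a b} → ⌊ a ≤?ᶠ b ⌋ ≡ false → b ≤ᶠ a
  ≤?-false {a} {b} eq with a ≤?ᶠ b | ≤ᶠ-total a b
  ≤?-false () | yes _   | _
  ... | no a≰b | inj₁ a≤b = ⊥-elim (a≰b a≤b)
  ... | no a≰b | inj₂ b≤a = b≤a

-- V stands for the distance or for its square. The fields hold for both, so a single proof serves
-- k-median and k-means.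
record Instance (F : OrderedField 0ℓ 0ℓ 0ℓ) : Set where
  open OrderedField F using (Carrier; _≈_; 0#) renaming (_≤_ to _≤ᶠ_)
  field
    n k   : ℕ
    V     : ℕ → ℕ → Carrier
    1≤n   : 1 ≤ n
    1≤k   : 1 ≤ k
    k≤n   : k ≤ n
    V≥0   : ∀ c x → c < n → x < n → 0# ≤ᶠ V c x
    V≈0   : ∀ x → x < n → V x x ≈ 0#
    V-sym : ∀ c x → c < n → x < n → V c x ≈ V x c

-- Masks, nearest centers and farthest points

module Properties {F : OrderedField 0ℓ 0ℓ 0ℓ} (I : Instance F) where
  open Instance I
  open Ordered F
  open Spec F n k V public
  open Masks n public

  has-bit : ∀ {x} S → x ≤ n → has x S ≡ bit x S
  has-bit {x} S x≤n = cong odd (trans (capped n) (cong (λ y → shift y S) (m≤n⇒m⊓n≡m x≤n)))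
    where
    capped : ∀ m → foldn m S (λ i acc → if suc i ≤ᵇ x then ⌊ acc /2⌋ else acc) ≡ shift (x ⊓ m) S
    capped zero = cong (λ y → shift y S) (sym (⊓-zeroʳ x))
    capped (suc m) with suc m ≤ᵇ x in eq
    ... | true rewrite m≥n⇒m⊓n≡n (true⇒≤ {suc m} {x} eq) =
      cong ⌊_/2⌋ (trans (capped m) (cong (λ y → shift y S) (m≥n⇒m⊓n≡n (<⇒≤ (true⇒≤ {suc m} {x} eq)))))
    ... | false rewrite m≤n⇒m⊓n≡m (<⇒≤ (false⇒> {suc m} {x} eq)) =
      trans (capped m) (cong (λ y → shift y S) (m≤n⇒m⊓n≡m (≤-pred (false⇒> {suc m} {x} eq))))

  pow-2^ : ∀ {x} → x ≤ n → pow x ≡ 2 ^ x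
  pow-2^ {x} x≤n = trans (capped n) (cong (2 ^_) (m≤n⇒m⊓n≡m x≤n))
    where
    capped : ∀ m → foldn m 1 (λ i acc → if suc i ≤ᵇ x then acc + acc else acc) ≡ 2 ^ (x ⊓ m)
    capped zero = cong (2 ^_) (sym (⊓-zeroʳ x))
    capped (suc m) with suc m ≤ᵇ x in eq
    ... | true rewrite m≥n⇒m⊓n≡n (true⇒≤ {suc m} {x} eq) =
      trans (cong (λ z → z + z) (trans (capped m) (cong (2 ^_) (m≥n⇒m⊓n≡n (<⇒≤ (true⇒≤ {suc m} {x} eq))))))
            (cong (2 ^ m +_) (sym (+-identityʳ (2 ^ m))))
    ... | false rewrite m≤n⇒m⊓n≡m (<⇒≤ (false⇒> {suc m} {x} eq)) =
      trans (capped m) (cong (2 ^_) (m≤n⇒m⊓n≡m (≤-pred (false⇒> {suc m} {x} eq))))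

  points-size : ∀ S → points S ≡ size S
  points-size S = count-cong n λ x x<n → has-bit S (<⇒≤ x<n)

  lacks-bit : ∀ {x} S → x ≤ n → lacks x S ≡ not (bit x S)
  lacks-bit {x} S x≤n = trans (flip (v ∸ (⌊ v /2⌋ + ⌊ v /2⌋))) (cong not (has-bit S x≤n))
    where
    v : ℕ
    v = foldn n S λ i acc → if suc i ≤ᵇ x then ⌊ acc /2⌋ else acc
    flip : ∀ v → (v ≤ᵇ 0) ≡ not (1 ≤ᵇ v)
    flip zero    = refl
    flip (suc v) = refl

  _∈_ _∉_ : ℕ → ℕ → Set
  x ∈ S = bit x S ≡ true
  x ∉ S = bit x S ≡ false

  single : ∀ v → sumIf (_≤ᵇ 0) (λ _ → v) ≈ v
  single v = ≈-trans (sumIf-∑ n (_≤ᵇ 0) (λ _ → v)) (Sumᶠ.big-single n 0 1≤n λ { zero _ 0≢0 → ⊥-elim (0≢0 refl) ; (suc i) _ _ → ≈-refl })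

  near≤-true : ∀ c x c′ x′ → near≤ c x c′ x′ ≡ true → V c x ≤ᶠ V c′ x′
  near≤-true c x c′ x′ eq = ≤ᶠ-respˡ (≈-sym (single (V c x))) (≤ᶠ-respʳ (≤?-true eq) (single (V c′ x′)))

  near≤-false : ∀ c x c′ x′ → near≤ c x c′ x′ ≡ false → V c′ x′ ≤ᶠ V c x
  near≤-false c x c′ x′ eq = ≤ᶠ-respˡ (≈-sym (single (V c′ x′))) (≤ᶠ-respʳ (≤?-false eq) (single (V c x)))

  module Nearest (m : ℕ) {x} (x<n : x < n) where
    -- Beyond its range nothing is claimed about z until a center below i exists, as the scan starts
    -- from an arbitrary value.
    Best : ℕ → ℕ → Set
    Best i z = z < n × (∀ c → c < i → c ∈ m → z ∈ m × V z x ≤ᶠ V c x)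

    scan : Best n (foldn n 0 λ i acc →
      if has i m then (if has acc m then (if near≤ i x acc x then i else acc) else i) else acc)
    scan = foldn-ind Best n (1≤n , λ c ()) step
      where
      step : ∀ i z → i < n → Best i z →
        Best (suc i) (if has i m then (if has z m then (if near≤ i x z x then i else z) else i) else z)
      step i z i<n (z<n , best) rewrite has-bit m (<⇒≤ i<n) | has-bit m (<⇒≤ z<n) with bit i m in bi
      ... | false = z<n , λ c c≤i c∈m → best c (≤∧≢⇒< (≤-pred c≤i) λ { refl → false≢true (trans (sym bi) c∈m) }) c∈m
      ... | true with bit z m in bz
      ...   | false = i<n , λ c c≤i c∈m → case c ≟ i of λ where
                (yes refl) → bi , ≤ᶠ-refl
                (no c≢i)   → ⊥-elim (false≢true (proj₁ (best c (≤∧≢⇒< (≤-pred c≤i) c≢i) c∈m)))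
      ...   | true with near≤ i x z x in eq
      ...     | true = i<n , λ c c≤i c∈m → case c ≟ i of λ where
                (yes refl) → bi , ≤ᶠ-refl
                (no c≢i)   → bi , ≤ᶠ-trans (near≤-true i x z x eq) (proj₂ (best c (≤∧≢⇒< (≤-pred c≤i) c≢i) c∈m))
      ...     | false = z<n , λ c c≤i c∈m → case c ≟ i of λ where
                (yes refl) → bz , near≤-false i x z x eq
                (no c≢i)   → bz , proj₂ (best c (≤∧≢⇒< (≤-pred c≤i) c≢i) c∈m)

    nearest-< : nearest m x < n
    nearest-< with has x m
    ... | true  = x<n
    ... | false = proj₁ scan

    nearest-best : ∀ c → c < n → c ∈ m → nearest m x ∈ m × V (nearest m x) x ≤ᶠ V c x
    nearest-best c c<n c∈m with has x m in eq
    ... | true  = trans (sym (has-bit m (<⇒≤ x<n))) eq , ≤ᶠ-respˡ (V≈0 x x<n) (V≥0 c x c<n x<n)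
    ... | false = proj₂ scan c c<n c∈m

    nearest-self : x ∈ m → nearest m x ≡ x
    nearest-self x∈m rewrite has-bit m (<⇒≤ x<n) | x∈m = refl

  open Nearest using (nearest-<; nearest-best; nearest-self)

  dist : ℕ → ℕ → Carrier
  dist m x = V (nearest m x) x

  opaque
    unfolding total cost

    total-≡ : ∀ m → total m ≡ ∑ᶠ n (dist m)
    total-≡ m = refl

    cost-≡ : ∀ S m → cost S m ≡ sumIf (λ x → has x S) (dist m)
    cost-≡ S m = refl

  dist≥0 : ∀ m {x} → x < n → 0# ≤ᶠ dist m x
  dist≥0 m x<n = V≥0 _ _ (nearest-< m x<n) x<n

  dist-self : ∀ m {x} → x < n → x ∈ m → dist m x ≈ 0#
  dist-self m {x} x<n x∈m = ≈-trans (≈-reflexive (cong (λ c → V c x) (nearest-self m x<n x∈m))) (V≈0 x x<n)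

  dist≤ : ∀ m {x} → x < n → ∀ c → c < n → c ∈ m → dist m x ≤ᶠ V c x
  dist≤ m x<n c c<n c∈m = proj₂ (nearest-best m x<n c c<n c∈m)

  _⊆_ : ℕ → ℕ → Set
  m ⊆ m′ = ∀ x → x < n → x ∈ m → x ∈ m′

  -- The witness c excludes the empty set, whose `nearest` is a mere default.
  dist-⊆ : ∀ {m m′ x} → x < n → m ⊆ m′ → ∀ c → c < n → c ∈ m → dist m′ x ≤ᶠ dist m x
  dist-⊆ {m} {m′} {x} x<n m⊆m′ c c<n c∈m =
    dist≤ m′ x<n (nearest m x) (nearest-< m x<n)
      (m⊆m′ _ (nearest-< m x<n) (proj₁ (nearest-best m x<n c c<n c∈m)))

  module Farthest (m C : ℕ) where
    Best : ℕ → ℕ → Set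
    Best i z = z < n × (∀ y → y < i → y ∉ C → z ∉ C × dist m y ≤ᶠ dist m z)

    scan : Best n (far m C)
    scan = foldn-ind Best n (1≤n , λ y ()) step
      where
      step : ∀ i z → i < n → Best i z → Best (suc i) (if has i C then z else
        (if has z C then i else (if near≤ (nearest m z) z (nearest m i) i then i else z)))
      step i z i<n (z<n , best) rewrite has-bit C (<⇒≤ i<n) | has-bit C (<⇒≤ z<n) with bit i C in bi
      ... | true = z<n , λ y y≤i y∉C → best y (≤∧≢⇒< (≤-pred y≤i) λ { refl → false≢true (trans (sym y∉C) bi) }) y∉C
      ... | false with bit z C in bz
      ...   | true = i<n , λ y y≤i y∉C → case y ≟ i of λ where
                (yes refl) → bi , ≤ᶠ-refl
                (no y≢i)   → ⊥-elim (false≢true (sym (proj₁ (best y (≤∧≢⇒< (≤-pred y≤i) y≢i) y∉C))))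
      ...   | false with near≤ (nearest m z) z (nearest m i) i in eq
      ...     | true = i<n , λ y y≤i y∉C → case y ≟ i of λ where
                (yes refl) → bi , ≤ᶠ-refl
                (no y≢i)   → bi , ≤ᶠ-trans (proj₂ (best y (≤∧≢⇒< (≤-pred y≤i) y≢i) y∉C)) (near≤-true _ z _ i eq)
      ...     | false = z<n , λ y y≤i y∉C → case y ≟ i of λ where
                (yes refl) → bz , near≤-false _ z _ i eq
                (no y≢i)   → bz , proj₂ (best y (≤∧≢⇒< (≤-pred y≤i) y≢i) y∉C)

  missing : ∀ C → size C < n → ∃[ y ] (y < n × y ∉ C)
  missing C lt with anyUpTo? (λ y → bit y C Boolₚ.≟ false) n
  ... | yes found = found
  ... | no none = ⊥-elim (<⇒≢ lt (count-all n present))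
    where
    present : ∀ y → y < n → y ∈ C
    present y y<n with bit y C in eq
    ... | true  = refl
    ... | false = ⊥-elim (none (y , y<n , eq))

-- Greedy completion, candidates and table entries

module Choosing {F : OrderedField 0ℓ 0ℓ 0ℓ} (I : Instance F) where
  open Instance I
  open Ordered F
  open Properties I

  -- By `progress` a round adds a point unless k are present, so n rounds suffice as k ≤ n. `order`
  -- is what the exchange argument consumes.
  record Grown (m i C : ℕ) : Set where
    field
      small    : C < 2 ^ n
      size≤k   : size C ≤ k
      progress : size C ≡ k ⊎ i ≤ size C
      base     : m ⊆ C
      order    : ∀ y z → y < n → z < n → y ∈ C → y ∉ m → z ∉ C → dist m z ≤ᶠ dist m y

  insert-bit : ∀ {C y x} → C < 2 ^ n → y < n → y ∉ C → x < n → x ∈ (C + 2 ^ y) → x ≡ y ⊎ x ∈ C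
  insert-bit {C} {y} {x} C< y<n y∉C x<n x∈ with x ≟ y
  ... | yes x≡y = inj₁ x≡y
  ... | no x≢y = inj₂ (trans (cong (_∨ bit x C) (sym (≢⇒≡ᵇ x≢y))) (trans (sym (bit-add C< y<n y∉C x<n)) x∈))

  ⊆-add : ∀ {C y} → C < 2 ^ n → y < n → y ∉ C → C ⊆ (C + 2 ^ y)
  ⊆-add {C} {y} C< y<n y∉C x x<n x∈C = trans (bit-add C< y<n y∉C x<n) (trans (cong ((x ≡ᵇ y) ∨_) x∈C) (Boolₚ.∨-zeroʳ (x ≡ᵇ y)))

  ∈-add : ∀ {C y} → C < 2 ^ n → y < n → y ∉ C → y ∈ (C + 2 ^ y)
  ∈-add {C} {y} C< y<n y∉C = trans (bit-add C< y<n y∉C y<n) (cong (_∨ bit y C) (≡ᵇ-refl y))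

  ∉⇒ : ∀ {C D x} → x < n → C ⊆ D → x ∉ D → x ∉ C
  ∉⇒ {C} {D} {x} x<n C⊆D x∉D with bit x C in eq
  ... | false = refl
  ... | true  = ⊥-elim (false≢true (trans (sym x∉D) (C⊆D x x<n eq)))

  opaque
    unfolding greedy

    greedy-≡ : ∀ m → greedy m ≡ foldn n m λ _ C → if suc (points C) ≤ᵇ k then C + pow (far m C) else C
    greedy-≡ m = refl

  greedy-grown : ∀ {m} → m < 2 ^ n → size m ≤ k → Grown m n (greedy m)
  greedy-grown {m} m< m≤k = subst (Grown m n) (sym (greedy-≡ m)) (foldn-ind (Grown m) n
    (record { small = m< ; size≤k = m≤k ; progress = inj₂ z≤n ; base = λ _ _ x∈m → x∈m
            ; order = λ y z _ _ y∈m y∉m → ⊥-elim (false≢true (trans (sym y∉m) y∈m)) }) step)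
    where
    step : ∀ i C → i < n → Grown m i C →
      Grown m (suc i) (if suc (points C) ≤ᵇ k then C + pow (far m C) else C)
    step i C i<n G with suc (points C) ≤ᵇ k in eq
    ... | false = record { small = small ; size≤k = size≤k ; base = base ; order = order
                         ; progress = inj₁ (≤-antisym size≤k (≤-trans (≤-pred (false⇒> eq)) (≤-reflexive (points-size C)))) }
      where open Grown G
    ... | true with missing C (≤-trans (≤-reflexive (cong suc (sym (points-size C)))) (≤-trans (true⇒≤ eq) k≤n))
    ...   | y , y<n , y∉C = grown (Farthest.scan m C)
      where
      open Grown G
      f : ℕ
      f = far m C
      C<k : suc (size C) ≤ k
      C<k = ≤-trans (≤-reflexive (cong suc (sym (points-size C)))) (true⇒≤ eq)
      grown : Farthest.Best m C n f → Grown m (suc i) (C + pow f)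
      grown (f<n , best) rewrite pow-2^ (<⇒≤ f<n) =
        record
          { small = add-< small f<n f∉C
          ; size≤k = ≤-trans (≤-reflexive (size-add small f<n f∉C)) C<k
          ; progress = inj₂ (≤-trans (s≤s (case progress of λ where
              (inj₁ full) → ⊥-elim (<⇒≢ C<k full)
              (inj₂ i≤)   → i≤)) (≤-reflexive (sym (size-add small f<n f∉C))))
          ; base = λ x x<n x∈m → ⊆-add small f<n f∉C x x<n (base x x<n x∈m)
          ; order = λ u z u<n z<n u∈ u∉m z∉ → case insert-bit small f<n f∉C u<n u∈ of λ where
              (inj₁ refl) → proj₂ (best z z<n (∉⇒ z<n (⊆-add small f<n f∉C) z∉))
              (inj₂ u∈C)  → order u z u<n z<n u∈C u∉m (∉⇒ z<n (⊆-add small f<n f∉C) z∉) }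
        where
        f∉C : f ∉ C
        f∉C = proj₁ (best y y<n y∉C)

  module Greedy {m} (m< : m < 2 ^ n) (m≤k : size m ≤ k) where
    open Grown (greedy-grown m< m≤k) public

    G : ℕ
    G = greedy m

    size≡k : size G ≡ k
    size≡k = case progress of λ where
      (inj₁ full) → full
      (inj₂ n≤)   → ≤-antisym size≤k (≤-trans k≤n n≤)

    -- The cost when the points of E serve themselves and all others go to m. For E above a nonempty
    -- m it is an upper bound on the cost with centers E, and an exact one to compare the greedy
    -- choice by.
    outside : (ℕ → Bool) → Carrier
    outside E = ∑ᶠ n λ x → [ not (E x) ] dist m x

    in-G : ℕ → Bool
    in-G x = bit x G

    -- A threshold θ separates the distances of the points added from those of
    -- the points left over, which makes the comparison pointwise.
    by-threshold : ∀ θ → 0# ≤ᶠ θ → (∀ z → z < n → z ∉ G → dist m z ≤ᶠ θ) →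
      (∀ y → y < n → y ∈ G → y ∉ m → θ ≤ᶠ dist m y) →
      ∀ E → count n E ≤ k → (∀ x → x < n → x ∈ m → E x ≡ true) → outside in-G ≤ᶠ outside E
    by-threshold θ 0≤θ above below E E≤k m⊆E = +ᶠ-cancelʳ (∑ᶠ n λ x → [ E x ] θ) (≤ᶠ-trans
      (+ᶠ-mono ≤ᶠ-refl (≤ᶠ-respˡ (∑ᶠ-const n E θ) (≤ᶠ-respʳ (·-mono (≤-trans E≤k (≤-reflexive (sym size≡k))) 0≤θ)
        (≈-sym (∑ᶠ-const n in-G θ)))))
      (≤ᶠ-respˡ (≈-sym (Sumᶠ.big-∙ n _ _)) (≤ᶠ-respʳ (Sumᶠ≤.big-mono n pointwise) (Sumᶠ.big-∙ n _ _))))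
      where
      pointwise : ∀ x → x < n → (([ not (bit x G) ] dist m x) +ᶠ ([ bit x G ] θ)) ≤ᶠ
        (([ not (E x) ] dist m x) +ᶠ ([ E x ] θ))
      pointwise x x<n with bit x G in xG | E x in xE
      ... | true  | true  = ≤ᶠ-refl
      ... | false | false = ≤ᶠ-refl
      ... | false | true  = ≤ᶠ-respˡ (OrderedField.+-comm F _ _) (+ᶠ-mono ≤ᶠ-refl (above x x<n xG))
      ... | true  | false = ≤ᶠ-respʳ (+ᶠ-mono ≤ᶠ-refl (below x x<n xG x∉m)) (OrderedField.+-comm F _ _)
        where
        x∉m : x ∉ m
        x∉m with bit x m in xm
        ... | false = refl
        ... | true  = ⊥-elim (false≢true (trans (sym xE) (m⊆E x x<n xm)))

    -- If `G` contains all points, nothing remains to be paid. Otherwise the distance of a farthest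
    -- point left over separates the two sides.
    optimal : ∀ E → count n E ≤ k → (∀ x → x < n → x ∈ m → E x ≡ true) → outside in-G ≤ᶠ outside E
    optimal E E≤k m⊆E with size G <? n
    ... | no full = ≤ᶠ-respˡ (Sumᶠ.big-ε n λ x x<n → ≈-reflexive (cong (λ b → [ not b ] dist m x)
            (count-full n (≤-antisym (count≤n n _) (≮⇒≥ full)) x x<n)))
          (∑ᶠ-nonneg n λ x x<n → []-nonneg (not (E x)) (dist≥0 m x<n))
    ... | yes G<n with missing G G<n
    ...   | z₀ , z₀<n , z₀∉G with Farthest.scan m G
    ...     | f<n , best = by-threshold (dist m (far m G)) (dist≥0 m f<n)
              (λ z z<n z∉G → proj₂ (best z z<n z∉G))
              (λ y y<n y∈G y∉m → order y (far m G) y<n f<n y∈G y∉m (proj₁ (best z₀ z₀<n z₀∉G)))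
              E E≤k m⊆E

    -- For empty m the values of `dist m` mean nothing; this is harmless when every point becomes a
    -- center.
    total≤outside : k ≡ n ⊎ (∃[ c ] (c < n × c ∈ m)) → total G ≤ᶠ outside in-G
    total≤outside source = ≤ᶠ-respˡ (≈-reflexive (total-≡ G)) (Sumᶠ≤.big-mono n pointwise)
      where
      pointwise : ∀ x → x < n → dist G x ≤ᶠ ([ not (bit x G) ] dist m x)
      pointwise x x<n with bit x G in xG
      ... | true  = ≤ᶠ-reflexive (dist-self G x<n xG)
      ... | false = case source of λ where
        (inj₁ k≡n) → ⊥-elim (false≢true (trans (sym xG) (count-full n (trans size≡k k≡n) x x<n)))
        (inj₂ (c , c<n , c∈m)) → dist-⊆ x<n base c c<n c∈m

    greedy-optimal : k ≡ n ⊎ (∃[ c ] (c < n × c ∈ m)) →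
      ∀ E → count n E ≤ k → (∀ x → x < n → x ∈ m → E x ≡ true) → total G ≤ᶠ outside E
    greedy-optimal source E E≤k m⊆E = ≤ᶠ-trans (total≤outside source) (optimal E E≤k m⊆E)

    greedy-≤ : ∀ c → c < n → c ∈ m → total G ≤ᶠ total m
    greedy-≤ c c<n c∈m = subst₂ _≤ᶠ_ (sym (total-≡ G)) (sym (total-≡ m))
      (Sumᶠ≤.big-mono n λ x x<n → dist-⊆ x<n base c c<n c∈m)

  score : ℕ → Carrier
  score m = total (greedy m)

  Candidate : ℕ → Set
  Candidate m = m < 2 ^ n × size m ≤ k

  record Better (a b r : ℕ) : Set where
    field
      candidate : Candidate r
      ≤-left    : score r ≤ᶠ score a
      ≤-right   : size b ≤ k → score r ≤ᶠ score b

  opaque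
    unfolding better

    better-≡ : ∀ a b → better a b ≡ (if points b ≤ᵇ k
      then (if ⌊ total (greedy b) ≤?ᶠ total (greedy a) ⌋ then b else a) else a)
    better-≡ a b = refl

  better-works : ∀ {a b} → Candidate a → b < 2 ^ n → Better a b (better a b)
  better-works {a} {b} a-ok b< rewrite better-≡ a b with points b ≤ᵇ k in eq
  ... | false = record { candidate = a-ok ; ≤-left = ≤ᶠ-refl
                       ; ≤-right = λ b≤k → ⊥-elim (<⇒≱ (false⇒> eq) (≤-trans (≤-reflexive (points-size b)) b≤k)) }
  ... | true with ⌊ total (greedy b) ≤?ᶠ total (greedy a) ⌋ in le
  ...   | true  = record { candidate = b< , ≤-trans (≤-reflexive (sym (points-size b))) (true⇒≤ eq)
                         ; ≤-left = ≤?-true le ; ≤-right = λ _ → ≤ᶠ-refl }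
  ...   | false = record { candidate = a-ok ; ≤-left = ≤ᶠ-refl ; ≤-right = λ _ → ≤?-false le }

  module _ (u c : ℕ) (c<n : c < n) where

    AtMost : Carrier → ℕ → Set
    AtMost X m = c ∈ m × cost u m ≤ᶠ X

    improve-old : ∀ {X acc} m → AtMost X acc → AtMost X (improve u c acc m)
    improve-old {X} {acc} m (c∈acc , ≤X) rewrite has-bit m (<⇒≤ c<n) | has-bit acc (<⇒≤ c<n) | c∈acc with bit c m in cm
    ... | false = c∈acc , ≤X
    ... | true with ⌊ cost u m ≤?ᶠ cost u acc ⌋ in le
    ...   | true  = cm , ≤ᶠ-trans (≤?-true le) ≤X
    ...   | false = c∈acc , ≤X

    improve-new : ∀ {X m} acc → AtMost X m → AtMost X (improve u c acc m)
    improve-new {X} {m} acc (c∈m , ≤X) rewrite has-bit m (<⇒≤ c<n) | has-bit acc (<⇒≤ c<n) | c∈m with bit c acc in ca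
    ... | false = c∈m , ≤X
    ... | true with ⌊ cost u m ≤?ᶠ cost u acc ⌋ in le
    ...   | true  = c∈m , ≤X
    ...   | false = ca , ≤ᶠ-trans (≤?-false le) ≤X

    improve-keeps : (Q : ℕ → Set) → ∀ {acc m} → Q acc → Q m → Q (improve u c acc m)
    improve-keeps Q {acc} {m} qa qm with has c m
    ... | false = qa
    ... | true with has c acc
    ...   | false = qm
    ...   | true with ⌊ cost u m ≤?ᶠ cost u acc ⌋
    ...     | true  = qm
    ...     | false = qa

  join-< : ∀ {c m} → c < n → m < 2 ^ n → join c m < 2 ^ n
  join-< {c} {m} c<n m< with has c m in eq
  ... | true  = m<
  ... | false rewrite pow-2^ (<⇒≤ c<n) = add-< m< c<n (trans (sym (has-bit m (<⇒≤ c<n))) eq)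

  join-size : ∀ {c m} → c < n → m < 2 ^ n → size (join c m) ≤ suc (size m)
  join-size {c} {m} c<n m< with has c m in eq
  ... | true  = n≤1+n _
  ... | false rewrite pow-2^ (<⇒≤ c<n) =
    ≤-reflexive (size-add m< c<n (trans (sym (has-bit m (<⇒≤ c<n))) eq))

  join-∈ : ∀ {c m} → c < n → m < 2 ^ n → c ∈ join c m
  join-∈ {c} {m} c<n m< with has c m in eq
  ... | true  = trans (sym (has-bit m (<⇒≤ c<n))) eq
  ... | false rewrite pow-2^ (<⇒≤ c<n) = ∈-add m< c<n (trans (sym (has-bit m (<⇒≤ c<n))) eq)

  join-⊆ : ∀ {c m} → c < n → m < 2 ^ n → m ⊆ join c m
  join-⊆ {c} {m} c<n m< with has c m in eq
  ... | true  = λ _ _ x∈ → x∈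
  ... | false rewrite pow-2^ (<⇒≤ c<n) = ⊆-add m< c<n (trans (sym (has-bit m (<⇒≤ c<n))) eq)

  -- Only valid entries, those containing c, need the bound on the size; for j = k - 1 it makes them
  -- admissible candidates.
  Sound : (ℕ → ℕ) → Set
  Sound t = ∀ S j c → c < n → j < n → t (index S j c) < 2 ^ n × (c ∈ t (index S j c) → size (t (index S j c)) ≤ suc j)

  module Entry (t : ℕ → ℕ) (u j c : ℕ) (c<n : c < n) (j<n : j < n) where

    inner : ℕ → ℕ → ℕ → ℕ
    inner p c′ acc = if 1 ≤ᵇ j
      then (if has c′ (t (index (u ∸ p) (j ∸ 1) c′))
            then improve u c acc (join c (t (index (u ∸ p) (j ∸ 1) c′))) else acc)
      else acc

    outer : ℕ → ℕ → ℕ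
    outer x acc = if has x u
      then foldn n (improve u c acc (t (index (u ∸ pow x) j c))) (inner (pow x)) else acc

    inner-keeps : ∀ {X} p c′ acc → AtMost u c c<n X acc → AtMost u c c<n X (inner p c′ acc)
    inner-keeps p c′ acc q with 1 ≤ᵇ j
    ... | false = q
    ... | true with has c′ (t (index (u ∸ p) (j ∸ 1) c′))
    ...   | false = q
    ...   | true  = improve-old u c c<n _ q

    inner-fold : ∀ {X acc} p → AtMost u c c<n X acc → AtMost u c c<n X (foldn n acc (inner p))
    inner-fold {X} p q = foldn-ind (λ _ → AtMost u c c<n X) n q λ c′ acc _ → inner-keeps p c′ acc

    outer-keeps : ∀ {X} y acc → AtMost u c c<n X acc → AtMost u c c<n X (outer y acc)
    outer-keeps y acc q with has y u
    ... | false = q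
    ... | true  = inner-fold (pow y) (improve-old u c c<n _ q)

    opaque
      unfolding entry

      entry-≡ : entry t u j c ≡ foldn n (seed u j c) outer
      entry-≡ = refl

    extend-entry : ∀ x X → x < n → x ∈ u → AtMost u c c<n X (t (index (u ∸ 2 ^ x) j c)) →
      AtMost u c c<n X (entry t u j c)
    extend-entry x X x<n x∈u good = subst (AtMost u c c<n X) (sym entry-≡)
      (foldn-hit (AtMost u c c<n X) {f = outer} x<n hit outer-keeps)
      where
      hit : ∀ acc → AtMost u c c<n X (outer x acc)
      hit acc rewrite has-bit u (<⇒≤ x<n) | x∈u | pow-2^ (<⇒≤ x<n) =
        inner-fold (2 ^ x) (improve-new u c c<n acc good)

    open-entry : ∀ x c′ X → x < n → x ∈ u → c′ < n → 1 ≤ j → c′ ∈ t (index (u ∸ 2 ^ x) (j ∸ 1) c′) →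
      AtMost u c c<n X (join c (t (index (u ∸ 2 ^ x) (j ∸ 1) c′))) → AtMost u c c<n X (entry t u j c)
    open-entry x c′ X x<n x∈u c′<n 1≤j c′∈ good = subst (AtMost u c c<n X) (sym entry-≡)
      (foldn-hit (AtMost u c c<n X) {f = outer} x<n hit outer-keeps)
      where
      hit′ : ∀ acc → AtMost u c c<n X (inner (2 ^ x) c′ acc)
      hit′ acc rewrite ≤ᵇ-true 1≤j | has-bit (t (index (u ∸ 2 ^ x) (j ∸ 1) c′)) (<⇒≤ c′<n) | c′∈ =
        improve-new u c c<n acc good
      hit : ∀ acc → AtMost u c c<n X (outer x acc)
      hit acc rewrite has-bit u (<⇒≤ x<n) | x∈u | pow-2^ (<⇒≤ x<n) =
        foldn-hit (AtMost u c c<n X) {f = inner (2 ^ x)} c′<n hit′ (inner-keeps (2 ^ x))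

    entry-sound : Sound t → entry t u j c < 2 ^ n × (c ∈ entry t u j c → size (entry t u j c) ≤ suc j)
    entry-sound sound = subst R (sym entry-≡) (foldn-ind (λ _ → R) n seed-sound step)
      where
      R : ℕ → Set
      R m = m < 2 ^ n × (c ∈ m → size m ≤ suc j)
      empty : R 0
      empty = m^n>0 2 n , λ c∈0 → ⊥-elim (false≢true (trans (sym (bit-0 c)) c∈0))
      seed-sound : R (seed u j c)
      seed-sound with u ≤ᵇ 0
      ... | false = empty
      ... | true with j ≤ᵇ 0
      ...   | false = empty
      ...   | true rewrite pow-2^ (<⇒≤ c<n) = add-< (m^n>0 2 n) c<n (bit-0 c) ,
                λ _ → ≤-trans (≤-reflexive (trans (size-add (m^n>0 2 n) c<n (bit-0 c)) (cong suc size-0))) (s≤s z≤n)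
      joined : ∀ S c′ → c′ < n → 1 ≤ j → has c′ (t (index S (j ∸ 1) c′)) ≡ true → R (join c (t (index S (j ∸ 1) c′)))
      joined S c′ c′<n 1≤j eq =
        let m< , m≤ = sound S (j ∸ 1) c′ c′<n (≤-trans (s≤s (m∸n≤m j 1)) j<n) in
        join-< c<n m< , λ _ → ≤-trans (join-size c<n m<)
          (s≤s (≤-trans (m≤ (trans (sym (has-bit _ (<⇒≤ c′<n))) eq)) (≤-reflexive (m+[n∸m]≡n 1≤j))))
      step : ∀ x acc → x < n → R acc → R (outer x acc)
      step x acc x<n r with has x u
      ... | false = r
      ... | true = foldn-ind (λ _ → R) n (improve-keeps u c c<n R r (sound (u ∸ pow x) j c c<n j<n)) step′
        where
        step′ : ∀ c′ acc → c′ < n → R acc → R (inner (pow x) c′ acc)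
        step′ c′ acc c′<n r with 1 ≤ᵇ j in eq
        ... | false = r
        ... | true with has c′ (t (index (u ∸ pow x) (j ∸ 1) c′)) in eq′
        ...   | false = r
        ...   | true  = improve-keeps u c c<n R r (joined (u ∸ pow x) c′ c′<n (true⇒≤ eq) eq′)


∑-const : ∀ m c → ∑ m (λ _ → c) ≡ m * c
∑-const zero    c = refl
∑-const (suc m) c = trans (cong (_+ c) (∑-const m c)) (+-comm (m * c) c)

∏-const : ∀ m c → ∏ m (λ _ → c) ≡ c ^ m
∏-const zero    c = refl
∏-const (suc m) c = trans (cong (_* c) (∏-const m c)) (*-comm (c ^ m) c)

∑-swap-left : ∀ m N (f : ℕ → ℕ → ℕ) → ∑ N (λ S → ∑ m λ q → f q S) ≡ ∑ m (λ q → ∑ N (f q))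
∑-swap-left m N f = Sumℕ.big-swap N m (λ S q → f q S)

term≤∑ : ∀ n f i → i < n → f i ≤ ∑ n f
term≤∑ (suc n) f i i<sn with i ≟ n
... | yes refl = m≤n+m _ _
... | no i≢n = ≤-trans (term≤∑ n f i (≤∧≢⇒< (≤-pred i<sn) i≢n)) (m≤m+n _ _)

-- Counting heavy sets

module Heavy {F : OrderedField 0ℓ 0ℓ 0ℓ} (I : Instance F) where
  open Instance I
  open Properties I

  threshold-≡ : threshold ≡ 400 ^ n
  threshold-≡ = go n
    where
    go : ∀ m → foldn m 1 (λ _ acc → 400 * acc) ≡ 400 ^ m
    go zero    = refl
    go (suc m) = cong (400 *_) (go m)

  factor : (ℕ → Bool) → ℕ → ℕ → ℕ → ℕ → ℕ
  factor p a b S x = if bit x S then (if p x then a else b) else (if p x then 756 ∸ a else 756 ∸ b)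

  weight-∏ : ∀ p a b S → weight p a b S ≡ ∏ n (factor p a b S)
  weight-∏ p a b S = trans (foldn-cong n refl (λ x acc x<n → step x acc x<n)) (flip n)
    where
    step : ∀ x acc → x < n →
      (if p x then (if has x S then a * acc else (756 ∸ a) * acc)
              else (if has x S then b * acc else (756 ∸ b) * acc)) ≡ factor p a b S x * acc
    step x acc x<n rewrite has-bit S (<⇒≤ x<n) with p x | bit x S
    ... | true  | true  = refl
    ... | true  | false = refl
    ... | false | true  = refl
    ... | false | false = refl
    flip : ∀ m → foldn m 1 (λ x acc → factor p a b S x * acc) ≡ ∏ m (factor p a b S)
    flip zero    = refl
    flip (suc m) = trans (cong (factor p a b S m *_) (flip m)) (*-comm (factor p a b S m) _)

  -- Each factor of the product expanded by `∑-masks` is a + (756 - a) or b + (756 - b).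
  ∑-weight : ∀ p a b → a ≤ 756 → b ≤ 756 → ∑ (2 ^ n) (weight p a b) ≡ 756 ^ n
  ∑-weight p a b a≤ b≤ = begin
    ∑ (2 ^ n) (weight p a b)                     ≡⟨ Sumℕ.big-cong (2 ^ n) (λ S _ → weight-∏ p a b S) ⟩
    ∑ (2 ^ n) (λ S → ∏ n (factor p a b S))       ≡⟨ ∑-masks n (λ x → if p x then a else b) (λ x → if p x then 756 ∸ a else 756 ∸ b) ⟩
    ∏ n (λ x → (if p x then a else b) + (if p x then 756 ∸ a else 756 ∸ b)) ≡⟨ Prodℕ.big-cong n (λ x _ → whole (p x)) ⟩
    ∏ n (λ _ → 756)                              ≡⟨ ∏-const n 756 ⟩
    756 ^ n                                      ∎
    where
    open ≡-Reasoning
    whole : ∀ c → (if c then a else b) + (if c then 756 ∸ a else 756 ∸ b) ≡ 756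
    whole true  = m+[n∸m]≡n a≤
    whole false = m+[n∸m]≡n b≤

  Profile : ℕ → Set
  Profile S = Σ[ q ∈ ℕ ] Σ[ r ∈ ℕ ] (q < n × r < n ×
    (400 ^ n ≤ profile₁ q r S ⊎ 400 ^ n ≤ profile₂ q r S ⊎ 400 ^ n ≤ profile₃ q r S))

  choose : ℕ → ℕ → ℕ → ℕ → ℕ
  choose S q r acc = if threshold ≤ᵇ profile₁ q r S then 1 else
    (if threshold ≤ᵇ profile₂ q r S then 1 else
    (if threshold ≤ᵇ profile₃ q r S then 1 else acc))

  choose-keeps : ∀ S q r acc → 1 ≤ acc → 1 ≤ choose S q r acc
  choose-keeps S q r acc 1≤ with threshold ≤ᵇ profile₁ q r S | threshold ≤ᵇ profile₂ q r S | threshold ≤ᵇ profile₃ q r S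
  ... | true  | _     | _     = ≤-refl
  ... | false | true  | _     = ≤-refl
  ... | false | false | true  = ≤-refl
  ... | false | false | false = 1≤

  opaque
    unfolding heavy

    heavy-≡ : ∀ S → heavy S ≡ foldn n 0 λ q acc → foldn n acc (choose S q)
    heavy-≡ S = refl

  heavy-intro : ∀ {S} → Profile S → 1 ≤ heavy S
  heavy-intro {S} (q , r , q<n , r<n , p) = subst (1 ≤_) (sym (heavy-≡ S)) (foldn-hit (1 ≤_) {f = λ q acc → foldn n acc (choose S q)} q<n
    (λ acc → foldn-hit (1 ≤_) {f = choose S q} r<n (hit p) (choose-keeps S q))
    (λ q acc 1≤ → foldn-ind (λ _ → 1 ≤_) n 1≤ λ r acc _ → choose-keeps S q r acc))
    where
    hit : _ → ∀ acc → 1 ≤ choose S q r acc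
    hit (inj₁ ge) acc rewrite ≤ᵇ-true (≤-trans (≤-reflexive threshold-≡) ge) = ≤-refl
    hit (inj₂ (inj₁ ge)) acc with threshold ≤ᵇ profile₁ q r S
    ... | true = ≤-refl
    ... | false rewrite ≤ᵇ-true (≤-trans (≤-reflexive threshold-≡) ge) = ≤-refl
    hit (inj₂ (inj₂ ge)) acc with threshold ≤ᵇ profile₁ q r S | threshold ≤ᵇ profile₂ q r S
    ... | true  | _    = ≤-refl
    ... | false | true = ≤-refl
    ... | false | false rewrite ≤ᵇ-true (≤-trans (≤-reflexive threshold-≡) ge) = ≤-refl

  heavy-elim : ∀ {S} → 1 ≤ heavy S → Profile S
  heavy-elim {S} 1≤ = foldn-ind (λ _ acc → 1 ≤ acc → Profile S) n {f = λ q acc → foldn n acc (choose S q)} (λ ()) (λ q acc q<n found →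
    foldn-ind (λ _ acc → 1 ≤ acc → Profile S) n found λ r acc r<n found → split q r acc q<n r<n found)
    (subst (1 ≤_) (heavy-≡ S) 1≤)
    where
    split : ∀ q r acc → q < n → r < n → (1 ≤ acc → Profile S) → 1 ≤ choose S q r acc → Profile S
    split q r acc q<n r<n found 1≤ with threshold ≤ᵇ profile₁ q r S in e₁ | threshold ≤ᵇ profile₂ q r S in e₂ | threshold ≤ᵇ profile₃ q r S in e₃
    ... | true  | _     | _     = q , r , q<n , r<n , inj₁ (≤-trans (≤-reflexive (sym threshold-≡)) (true⇒≤ e₁))
    ... | false | true  | _     = q , r , q<n , r<n , inj₂ (inj₁ (≤-trans (≤-reflexive (sym threshold-≡)) (true⇒≤ e₂)))
    ... | false | false | true  = q , r , q<n , r<n , inj₂ (inj₂ (≤-trans (≤-reflexive (sym threshold-≡)) (true⇒≤ e₃)))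
    ... | false | false | false = found 1≤

  mass : ℕ → ℕ
  mass S = ∑ n λ q → ∑ n λ r → profile₁ q r S + (profile₂ q r S + profile₃ q r S)

  heavy-mass : ∀ {S} → 1 ≤ heavy S → 400 ^ n ≤ mass S
  heavy-mass {S} 1≤ with heavy-elim 1≤
  ... | q , r , q<n , r<n , p = ≤-trans (part p)
        (≤-trans (term≤∑ n _ r r<n) (term≤∑ n (λ q → ∑ n λ r → profile₁ q r S + (profile₂ q r S + profile₃ q r S)) q q<n))
    where
    part : _ → 400 ^ n ≤ profile₁ q r S + (profile₂ q r S + profile₃ q r S)
    part (inj₁ ge)        = ≤-trans ge (m≤m+n _ _)
    part (inj₂ (inj₁ ge)) = ≤-trans ge (≤-trans (m≤m+n _ (profile₃ q r S)) (m≤n+m _ (profile₁ q r S)))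
    part (inj₂ (inj₂ ge)) = ≤-trans ge (≤-trans (m≤n+m _ (profile₂ q r S)) (m≤n+m _ (profile₁ q r S)))

  ∑-mass : ∑ (2 ^ n) mass ≡ n * (n * (756 ^ n + (756 ^ n + 756 ^ n)))
  ∑-mass = begin
    ∑ N mass
      ≡⟨ ∑-swap-left n N (λ q S → ∑ n λ r → profile₁ q r S + (profile₂ q r S + profile₃ q r S)) ⟩
    ∑ n (λ q → ∑ N λ S → ∑ n λ r → profile₁ q r S + (profile₂ q r S + profile₃ q r S))
      ≡⟨ Sumℕ.big-cong n (λ q _ → trans (∑-swap-left n N (λ r S → profile₁ q r S + (profile₂ q r S + profile₃ q r S)))
           (trans (Sumℕ.big-cong n (λ r _ → each q r)) (∑-const n _))) ⟩
    ∑ n (λ q → n * (756 ^ n + (756 ^ n + 756 ^ n)))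
      ≡⟨ ∑-const n _ ⟩
    n * (n * (756 ^ n + (756 ^ n + 756 ^ n))) ∎
    where
    open ≡-Reasoning
    N : ℕ
    N = 2 ^ n
    each : ∀ q r → ∑ N (λ S → profile₁ q r S + (profile₂ q r S + profile₃ q r S)) ≡ 756 ^ n + (756 ^ n + 756 ^ n)
    each q r = trans (Sumℕ.big-∙ N (profile₁ q r) _) (cong₂ _+_
      (∑-weight (λ x → suc x ≤ᵇ q) 756 252 (≤ᵇ⇒≤ _ _ tt) (≤ᵇ⇒≤ _ _ tt)) (trans (Sumℕ.big-∙ N (profile₂ q r) _) (cong₂ _+_
      (∑-weight (λ x → x ≤ᵇ q) 756 378 (≤ᵇ⇒≤ _ _ tt) (≤ᵇ⇒≤ _ _ tt))
      (∑-weight (λ x → dot (q * n + r) (suc (x + x))) 324 189 (≤ᵇ⇒≤ _ _ tt) (≤ᵇ⇒≤ _ _ tt)))))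

  -- Markov's inequality over all sets of points.
  few-heavy : ∀ p → (∀ S → p S ≡ true → 1 ≤ heavy S) →
    count (2 ^ n) p * 100 ^ n ≤ 189 ^ n * (3 * (n * n))
  few-heavy p p⇒heavy = *-cancelʳ-≤ _ _ (4 ^ n) {{m^n≢0 4 n}} (begin
    count N p * 100 ^ n * 4 ^ n                  ≡⟨ *-assoc (count N p) (100 ^ n) (4 ^ n) ⟩
    count N p * (100 ^ n * 4 ^ n)                ≡⟨ cong (count N p *_) (^-distribʳ-* 100 4 n) ⟨
    count N p * 400 ^ n                          ≡⟨ cong (_* 400 ^ n) (count-∑ N p) ⟩
    ∑ N (𝟙 ∘ p) * 400 ^ n                        ≡⟨ *-comm (∑ N (𝟙 ∘ p)) (400 ^ n) ⟩
    400 ^ n * ∑ N (𝟙 ∘ p)                        ≡⟨ ∑-*ˡ N (400 ^ n) (𝟙 ∘ p) ⟨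
    ∑ N (λ S → 400 ^ n * 𝟙 (p S))                ≤⟨ Sum≤.big-mono N (λ S _ → pointwise S) ⟩
    ∑ N mass                                     ≡⟨ ∑-mass ⟩
    n * (n * (756 ^ n + (756 ^ n + 756 ^ n)))    ≡⟨ collect n (756 ^ n) ⟩
    756 ^ n * (3 * (n * n))                      ≡⟨ cong (_* (3 * (n * n))) (^-distribʳ-* 189 4 n) ⟩
    189 ^ n * 4 ^ n * (3 * (n * n))              ≡⟨ swap-right (189 ^ n) (4 ^ n) (3 * (n * n)) ⟩
    189 ^ n * (3 * (n * n)) * 4 ^ n              ∎)
    where
    open ≤-Reasoning
    N : ℕ
    N = 2 ^ n
    collect : ∀ n z → n * (n * (z + (z + z))) ≡ z * (3 * (n * n))
    collect = solve-∀
    swap-right : ∀ a b c → a * b * c ≡ a * c * b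
    swap-right = solve-∀
    pointwise : ∀ S → 400 ^ n * 𝟙 (p S) ≤ mass S
    pointwise S with p S in eq
    ... | true  = ≤-trans (≤-reflexive (*-identityʳ (400 ^ n))) (heavy-mass (p⇒heavy S eq))
    ... | false = ≤-trans (≤-reflexive (*-zeroʳ (400 ^ n))) z≤n

  heavy-empty : 1 ≤ heavy 0
  heavy-empty = heavy-intro (0 , 0 , 1≤n , 1≤n , inj₁ (begin
    400 ^ n                                   ≤⟨ ^-monoˡ-≤ n (≤ᵇ⇒≤ 400 504 tt) ⟩
    504 ^ n                                   ≡⟨ ∏-const n 504 ⟨
    ∏ n (λ _ → 504)                           ≡⟨ Prodℕ.big-cong n (λ x _ → sym (cong (λ b → if b then 252 else 504) (bit-0 x))) ⟩
    ∏ n (factor (λ x → suc x ≤ᵇ 0) 756 252 0) ≡⟨ weight-∏ (λ x → suc x ≤ᵇ 0) 756 252 0 ⟨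
    profile₁ 0 0 0                            ∎))
    where open ≤-Reasoning

-- Costs along chains of heavy sets

module Costs {F : OrderedField 0ℓ 0ℓ 0ℓ} (I : Instance F) where
  open Instance I
  open Ordered F
  open Properties I
  open Choosing I

  cost-∑ : ∀ S m → cost S m ≈ ∑ᶠ n (λ x → [ bit x S ] dist m x)
  cost-∑ S m = ≈-trans (≈-trans (≈-reflexive (cost-≡ S m)) (sumIf-∑ n (λ x → has x S) (dist m)))
    (Sumᶠ.big-cong n λ x x<n → ≈-reflexive (cong (λ b → [ b ] dist m x) (has-bit S (<⇒≤ x<n))))

  cost-empty : ∀ m → cost 0 m ≈ 0#
  cost-empty m = ≈-trans (cost-∑ 0 m) (Sumᶠ.big-ε n λ x _ → ≈-reflexive (cong (λ b → [ b ] dist m x) (bit-0 x)))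

  cost-full : ∀ S m → (∀ x → x < n → x ∈ S) → cost S m ≈ total m
  cost-full S m full = ≈-trans (cost-∑ S m) (≈-trans
    (Sumᶠ.big-cong n λ x x<n → ≈-reflexive (cong (λ b → [ b ] dist m x) (full x x<n)))
    (≈-reflexive (sym (total-≡ m))))

  -- Only an inequality, since m may have a center nearer to y than c. The table may thus do better
  -- than the chains it is measured against.
  cost-add : ∀ {S y c} m → S < 2 ^ n → y < n → y ∉ S → c < n → c ∈ m → cost (S + 2 ^ y) m ≤ᶠ (cost S m +ᶠ V c y)
  cost-add {S} {y} {c} m S< y<n y∉S c<n c∈m = ≤ᶠ-respˡ (begin
    cost (S + 2 ^ y) m                                    ≈⟨ cost-∑ _ m ⟩
    ∑ᶠ n (λ x → [ bit x (S + 2 ^ y) ] dist m x)           ≈⟨ Sumᶠ.big-cong n split ⟩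
    ∑ᶠ n (λ x → ([ bit x S ] dist m x) +ᶠ ([ x ≡ᵇ y ] dist m x))
                                                          ≈⟨ Sumᶠ.big-∙ n _ _ ⟩
    ∑ᶠ n (λ x → [ bit x S ] dist m x) +ᶠ ∑ᶠ n (λ x → [ x ≡ᵇ y ] dist m x)
      ≈⟨ OrderedField.+-cong F (≈-sym (cost-∑ S m)) (≈-trans (Sumᶠ.big-single n y y<n
           (λ x _ x≢y → ≈-reflexive (cong (λ b → [ b ] dist m x) (≢⇒≡ᵇ x≢y))))
           (≈-reflexive (cong (λ b → [ b ] dist m y) (≡ᵇ-refl y)))) ⟩
    cost S m +ᶠ dist m y                                  ∎)
    (+ᶠ-mono ≤ᶠ-refl (dist≤ m y<n c c<n c∈m))
    where
    open import Relation.Binary.Reasoning.Setoid (OrderedField.setoid F)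
    split : ∀ x → x < n → ([ bit x (S + 2 ^ y) ] dist m x) ≈ (([ bit x S ] dist m x) +ᶠ ([ x ≡ᵇ y ] dist m x))
    split x x<n rewrite bit-add S< y<n y∉S x<n with x ≟ y
    ... | yes refl rewrite ≡ᵇ-refl x | y∉S = ≈-sym (OrderedField.+-identityˡ F _)
    ... | no x≢y rewrite ≢⇒≡ᵇ x≢y = ≈-sym (OrderedField.+-identityʳ F _)

  cost-⊆ : ∀ S {m m′} c → c < n → c ∈ m → m ⊆ m′ → cost S m′ ≤ᶠ cost S m
  cost-⊆ S {m} {m′} c c<n c∈m m⊆m′ = ≤ᶠ-respˡ (cost-∑ S m′) (≤ᶠ-respʳ
    (Sumᶠ≤.big-mono n λ x x<n → []-mono (bit x S) (dist-⊆ x<n m⊆m′ c c<n c∈m)) (≈-sym (cost-∑ S m)))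

  -- Heaviness alone does not get a set listed; every set on some way from the empty set to it has
  -- to be heavy as well.
  data Reached : ℕ → Set where
    empty : Reached 0
    grow  : ∀ {S y} → Reached S → y < n → y ∉ S → 1 ≤ heavy (S + 2 ^ y) → Reached (S + 2 ^ y)

  -- Clusters are completed one after the other: Reach S j c v says that S can be
  -- built point by point through heavy sets at cost v, with j + 1 clusters opened
  -- and the last one centered at c.
  data Reach : ℕ → ℕ → ℕ → Carrier → Set where
    origin : ∀ {c} → c < n → Reach 0 0 c 0#
    more  : ∀ {S j c v y} → Reach S j c v → y < n → y ∉ S → 1 ≤ heavy (S + 2 ^ y) →
      Reach (S + 2 ^ y) j c (v +ᶠ V c y)
    next  : ∀ {S j c c′ v y} → Reach S j c′ v → suc j < k → c < n → y < n → y ∉ S → 1 ≤ heavy (S + 2 ^ y) →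
      Reach (S + 2 ^ y) (suc j) c (v +ᶠ V c y)

  reached-< : ∀ {S} → Reached S → S < 2 ^ n
  reached-< empty              = m^n>0 2 n
  reached-< (grow R y<n y∉S _) = add-< (reached-< R) y<n y∉S

  reach-reached : ∀ {S j c v} → Reach S j c v → Reached S
  reach-reached (origin _)              = empty
  reach-reached (more R y<n y∉S h)     = grow (reach-reached R) y<n y∉S h
  reach-reached (next R _ _ y<n y∉S h) = grow (reach-reached R) y<n y∉S h

  reach-center : ∀ {S j c v} → Reach S j c v → c < n
  reach-center (origin c<n)          = c<n
  reach-center (more R _ _ _)       = reach-center R
  reach-center (next _ _ c<n _ _ _) = c<n

  reach-index : ∀ {S j c v} → Reach S j c v → j < k
  reach-index (origin _)           = 1≤k
  reach-index (more R _ _ _)      = reach-index R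
  reach-index (next _ j<k _ _ _ _) = j<k

  Optimum : (ℕ → ℕ) → ℕ → ℕ → ℕ → Carrier → Set
  Optimum t S j c v = c ∈ t (index S j c) × cost S (t (index S j c)) ≤ᶠ v

  entry-start : ∀ t {c} → c < n → entry t 0 0 c ≡ 2 ^ c
  entry-start t {c} c<n = trans (Entry.entry-≡ t 0 0 c c<n 1≤n) (foldn-ind (λ _ m → m ≡ 2 ^ c) n (pow-2^ (<⇒≤ c<n)) λ x acc x<n eq →
    ignore (trans (has-bit 0 (<⇒≤ x<n)) (bit-0 x)) eq)
    where
    ignore : ∀ {b} {z acc e : ℕ} → b ≡ false → acc ≡ e → (if b then z else acc) ≡ e
    ignore refl eq = eq

  -- Only the last step of the chain is inspected. `earlier` provides the entries of the sets with
  -- one point removed, which the breadth-first order completes before u.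
  entry-optimum : ∀ t → Sound t → ∀ {u j c v} → Reach u j c v → u < 2 ^ n →
    (∀ {S y j c v} → u ≡ S + 2 ^ y → y < n → y ∉ S → Reach S j c v → Optimum t S j c v) →
    c ∈ entry t u j c × cost u (entry t u j c) ≤ᶠ v
  entry-optimum t sound {c = c} (origin c<n) u< earlier = subst (λ m → c ∈ m × cost 0 m ≤ᶠ 0#)
    (sym (entry-start t c<n)) (∈-add (m^n>0 2 n) c<n (bit-0 c) , ≤ᶠ-reflexive (cost-empty (2 ^ c)))
  entry-optimum t sound {u} {j} {c} (more {S} {y = y} R y<n y∉S _) u< earlier =
    Entry.extend-entry t u j c c<n j<n y _ y<n (∈-add S< y<n y∉S)
      (subst (λ z → c ∈ t (index z j c) × cost u (t (index z j c)) ≤ᶠ _) (sym (m+n∸n≡m S (2 ^ y)))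
        (proj₁ o , ≤ᶠ-trans (cost-add _ S< y<n y∉S c<n (proj₁ o)) (+ᶠ-mono (proj₂ o) ≤ᶠ-refl)))
    where
    c<n : c < n
    c<n = reach-center R
    j<n : j < n
    j<n = ≤-trans (reach-index R) k≤n
    S< : S < 2 ^ n
    S< = reached-< (reach-reached R)
    o : Optimum t S j c _
    o = earlier refl y<n y∉S R
  entry-optimum t sound {u} {suc j} {c} (next {S} {c′ = c′} {y = y} R j<k c<n y<n y∉S _) u< earlier =
    Entry.open-entry t u (suc j) c c<n (≤-trans j<k k≤n) y c′ _ y<n (∈-add S< y<n y∉S) c′<n (s≤s z≤n)
      (subst (λ z → c′ ∈ t (index z j c′)) (sym (m+n∸n≡m S (2 ^ y))) (proj₁ o))
      (subst (λ z → c ∈ join c (t (index z j c′)) × cost u (join c (t (index z j c′))) ≤ᶠ _) (sym (m+n∸n≡m S (2 ^ y)))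
        -- Enlarging the set of centers by c cannot raise the cost of the points of S.
        (join-∈ c<n m< , ≤ᶠ-trans (cost-add _ S< y<n y∉S c<n (join-∈ c<n m<))
          (+ᶠ-mono (≤ᶠ-trans (cost-⊆ S c′ c′<n (proj₁ o) (join-⊆ c<n m<)) (proj₂ o)) ≤ᶠ-refl)))
    where
    c′<n : c′ < n
    c′<n = reach-center R
    S< : S < 2 ^ n
    S< = reached-< (reach-reached R)
    o : Optimum t S j c′ _
    o = earlier refl y<n y∉S R
    m< : t (index S j c′) < 2 ^ n
    m< = proj₁ (sound S j c′ c′<n (≤-trans (reach-index R) k≤n))

pair-< : ∀ {n a a′ c} c′ → a < a′ → c < n → a * n + c < a′ * n + c′
pair-< {n} {a} {a′} c′ a<a′ c<n = ≤-trans (≤-trans (+-monoʳ-< (a * n) c<n) (≤-reflexive (+-comm (a * n) n)))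
  (≤-trans (*-monoˡ-≤ n a<a′) (m≤m+n (a′ * n) c′))

pair-injective : ∀ {n a a′ c c′} → c < n → c′ < n → a * n + c ≡ a′ * n + c′ → a ≡ a′ × c ≡ c′
pair-injective {n} {a} {a′} {c} {c′} c<n c′<n eq with <-cmp a a′
... | tri< a<a′ _ _ = ⊥-elim (<⇒≢ (pair-< c′ a<a′ c<n) eq)
... | tri≈ _ refl _ = refl , +-cancelˡ-≡ (a * n) c c′ eq
... | tri> _ _ a>a′ = ⊥-elim (<⇒≢ (pair-< c a>a′ c′<n) (sym eq))

-- The invariant of the breadth-first search

module Searching {F : OrderedField 0ℓ 0ℓ 0ℓ} (I : Instance F) where
  open Instance I
  open Ordered F
  open Properties I
  open Choosing I
  open Heavy I
  open Costs I

  reached-heavy : ∀ {S} → Reached S → 1 ≤ heavy S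
  reached-heavy empty          = heavy-empty
  reached-heavy (grow _ _ _ h) = h

  -- `counted` excludes repetitions: the length of the queue is the number of marked sets, hence at
  -- most 2 ^ n and also at most the number of heavy sets. A set appended later has size `lim`, the
  -- maximum so far, which keeps the queue sorted.
  record Frontier (L sn : ℕ → ℕ) (tl lim : ℕ) : Set where
    field
      entries : ∀ i → i < tl → Reached (L i)
      marked  : ∀ i → i < tl → 1 ≤ sn (L i)
      listed  : ∀ S → 1 ≤ sn S → ∃[ i ] (i < tl × L i ≡ S)
      counted : count (2 ^ n) (λ S → 1 ≤ᵇ sn S) ≡ tl
      sorted  : ∀ i j → i ≤ j → j < tl → size (L i) ≤ size (L j)
      limit   : ∀ i → i < tl → size (L i) ≤ lim
      first   : 1 ≤ tl × L 0 ≡ 0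

  1≤ᵇ-update : ∀ (sn : ℕ → ℕ) S x → (1 ≤ᵇ update sn S 1 x) ≡ insert S (λ S → 1 ≤ᵇ sn S) x
  1≤ᵇ-update sn S x with x ≡ᵇ S
  ... | true  = refl
  ... | false = refl

  push : ∀ {L sn tl S lim} → Frontier L sn tl lim → Reached S → sn S ≡ 0 → size S ≡ lim →
    Frontier (update L tl S) (update sn S 1) (suc tl) lim
  push {L} {sn} {tl} {S} {lim} Fr R unseen S≡lim = record
    { entries = λ i i≤ → at (λ T → Reached T) i i≤ (entries i) R
    ; marked  = λ i i≤ → at (λ T → 1 ≤ update sn S 1 T) i i≤ (λ i<tl → mark (marked i i<tl)) (≤-reflexive (sym (update-≡ sn S 1)))
    ; listed  = list
    ; counted = trans (count-cong (2 ^ n) λ x _ → 1≤ᵇ-update sn S x)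
        (trans (count-insert (2 ^ n) S (reached-< R) (cong (1 ≤ᵇ_) unseen)) (cong suc counted))
    ; sorted  = λ i j i≤j j≤ → case j ≟ tl of λ where
        (yes refl) → at (λ T → size T ≤ size (update L tl S tl)) i (s≤s i≤j)
          (λ i<tl → ≤-trans (limit i i<tl) (≤-reflexive (trans (sym S≡lim) (cong size (sym (update-≡ L tl S))))))
          (≤-reflexive (cong size (sym (update-≡ L tl S))))
        (no j≢tl) → let j<tl = ≤∧≢⇒< (≤-pred j≤) j≢tl in
          ≤-trans (≤-reflexive (cong size (update-≢ L S (<⇒≢ (≤-trans (s≤s i≤j) j<tl)))))
            (≤-trans (sorted i j i≤j j<tl) (≤-reflexive (cong size (sym (update-≢ L S j≢tl)))))
    ; limit   = λ i i≤ → at (λ T → size T ≤ lim) i i≤ (limit i) (≤-reflexive S≡lim)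
    ; first   = s≤s z≤n , trans (update-≢ L S (<⇒≢ (proj₁ first))) (proj₂ first)
    }
    where
    open Frontier Fr
    at : ∀ (P : ℕ → Set) i → i < suc tl → (i < tl → P (L i)) → P S → P (update L tl S i)
    at P i i≤ old new with i ≟ tl
    ... | yes refl = subst P (sym (update-≡ L tl S)) new
    ... | no i≢tl = subst P (sym (update-≢ L S i≢tl)) (old (≤∧≢⇒< (≤-pred i≤) i≢tl))
    mark : ∀ {T} → 1 ≤ sn T → 1 ≤ update sn S 1 T
    mark {T} 1≤ with T ≡ᵇ S
    ... | true  = ≤-refl
    ... | false = 1≤
    list : ∀ T → 1 ≤ update sn S 1 T → ∃[ i ] (i < suc tl × update L tl S i ≡ T)
    list T 1≤ with T ≟ S
    ... | yes refl = tl , n<1+n tl , update-≡ L tl S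
    ... | no T≢S with listed T (subst (1 ≤_) (update-≢ sn 1 T≢S) 1≤)
    ...   | i , i<tl , Li = i , m<n⇒m<1+n i<tl , trans (update-≢ L S (<⇒≢ i<tl)) Li

  -- By `window` the sizes in the queue from the head on span at most two values. `closed` says that
  -- processed sets have had all their heavy extensions marked, and `small` lets every round start
  -- from numbers of at most n + 1 bits.
  record Inv (H : Heap) : Set where
    h : ℕ
    h = H glob 0
    tl : ℕ
    tl = H glob 1
    L : ℕ → ℕ
    L = H queue
    field
      lim       : ℕ
      frontier  : Frontier L (H seen) tl lim
      head≤     : h ≤ tl
      window    : h < tl → lim ≤ suc (size (L h))
      closed    : ∀ i y → i < h → y < n → y ∉ L i → 1 ≤ heavy (L i + 2 ^ y) → 1 ≤ H seen (L i + 2 ^ y)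
      sound     : Sound (H table)
      optimum   : ∀ {S j c v} → Reach S j c v → (∃[ i ] (i < h × L i ≡ S)) → Optimum (H table) S j c v
      candidate : Candidate (H glob 2)
      sets      : ∀ i → i < h → size (L i) ≤ k → score (H glob 2) ≤ᶠ score (L i)
      finals    : ∀ i c → i < h → c < n → size (H table (index (L i) (k ∸ 1) c)) ≤ k →
                  score (H glob 2) ≤ᶠ score (H table (index (L i) (k ∸ 1) c))
      small     : ∀ a i → H a i ≤ 2 ^ n
    open Frontier frontier public

  2^>0 : ∀ y → 0 < 2 ^ y
  2^>0 y = m^n>0 2 y

  module Step (H : Heap) (inv : Inv H) (h<tl : H glob 0 < H glob 1) where
    open Inv inv

    u : ℕ
    u = L h

    u< : u < 2 ^ n
    u< = reached-< (entries h h<tl)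

    -- The point of the breadth-first order. A nonempty reached set no larger than u extends a
    -- reached set smaller than u; that one has been processed by induction, so `closed` marks its
    -- extension. In a sorted queue the sets smaller than u come before the head.
    smaller-listed : ∀ {T} → Reached T → size T ≤ size u →
      1 ≤ H seen T × (size T < size u → ∃[ i ] (i < h × L i ≡ T))
    smaller-listed {T} R T≤u = found R , λ T<u → case listed T (found R) of λ where
        (i , i<tl , Li) → i , ≰⇒> (λ h≤i → <⇒≱ T<u (≤-trans (sorted h i h≤i i<tl) (≤-reflexive (cong size Li)))) , Li
      where
      found : Reached T → 1 ≤ H seen T
      found empty = subst (λ z → 1 ≤ H seen z) (proj₂ first) (marked 0 (proj₁ first))
      found (grow {S} {y} R y<n y∉S heavy) =
        let S<u = ≤-trans (≤-reflexive (sym (size-add (reached-< R) y<n y∉S))) T≤u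
            i , i<h , Li = proj₂ (smaller-listed R (<⇒≤ S<u)) S<u
        in subst (λ z → 1 ≤ H seen (z + 2 ^ y)) Li
             (closed i y i<h y<n (subst (y ∉_) (sym Li) y∉S) (subst (λ z → 1 ≤ heavy′ (z + 2 ^ y)) (sym Li) heavy))
        where
        heavy′ : ℕ → ℕ
        heavy′ = Properties.heavy I

    H₁ : Heap
    H₁ = visitedH H u

    best₁ : ℕ
    best₁ = better (H glob 2) u

    B₁ : Better (H glob 2) u best₁
    B₁ = better-works candidate u<

    -- The entries of u lexicographically before (j, c) are finished, and `old` protects those of
    -- all other sets. As the recurrence consults only sets with a point removed, the order within
    -- the row is immaterial to it.
    record Row (j c : ℕ) (H′ : Heap) : Set where
      field
        frame  : ∀ a → a ≢ table → H′ a ≡ H₁ a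
        sound′ : Sound (H′ table)
        old    : ∀ S j c → S ≢ u → j < n → c < n → H′ table (index S j c) ≡ H table (index S j c)
        done   : ∀ j′ c′ v → j′ < j ⊎ (j′ ≡ j × c′ < c) → Reach u j′ c′ v → Optimum (H′ table) u j′ c′ v
        small′ : ∀ i → H′ table i ≤ 2 ^ n

    fill : ∀ j c H′ → j < n → c < n → Row j c H′ → Row j (suc c) (store H′ table (index u j c) (entry (H′ table) u j c))
    fill j c H′ j<n c<n filled = record
      { frame  = λ { zero _ → frame zero λ () ; (suc zero) _ → frame (suc zero) λ ()
                   ; (suc (suc zero)) t≢t → ⊥-elim (t≢t refl) ; (suc (suc (suc zero))) _ → frame glob λ ()
                   ; (suc (suc (suc (suc zero)))) _ → frame out λ () }
      ; sound′ = λ S j′ c′ c′<n j′<n → at (λ m → m < 2 ^ n × (c′ ∈ m → size m ≤ suc j′)) (index S j′ c′)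
          (λ eq → case split {S} c′<n j′<n eq of λ { (refl , refl , refl) → e-sound }) λ _ → sound′ S j′ c′ c′<n j′<n
      ; old    = λ S j′ c′ S≢u j′<n c′<n → trans (update-≢ (H′ table) e λ eq → S≢u (proj₁ (split {S} c′<n j′<n eq))) (old S j′ c′ S≢u j′<n c′<n)
      ; done   = λ j′ c′ v ord R → at (λ m → c′ ∈ m × cost u m ≤ᶠ v) (index u j′ c′)
          (λ eq → case split {u} (reach-center R) (≤-trans (reach-index R) k≤n) eq of λ { (_ , refl , refl) →
             entry-optimum (H′ table) sound′ R u< earlier })
          (λ ne → done j′ c′ v (before ne ord) R)
      ; small′ = λ i → at (_≤ 2 ^ n) i (λ _ → <⇒≤ (proj₁ e-sound)) λ _ → small′ i
      }
      where
      open Row filled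
      e : ℕ
      e = entry (H′ table) u j c
      e-sound : e < 2 ^ n × (c ∈ e → size e ≤ suc j)
      e-sound = Entry.entry-sound (H′ table) u j c c<n j<n sound′
      split : ∀ {S j′ c′} → c′ < n → j′ < n → index S j′ c′ ≡ index u j c → S ≡ u × j′ ≡ j × c′ ≡ c
      split {S} {j′} {c′} c′<n j′<n eq =
        let eq₁ , c≡ = pair-injective {n} {S * n + j′} {u * n + j} c′<n c<n eq
            S≡ , j≡ = pair-injective {n} {S} {u} j′<n j<n eq₁ in S≡ , j≡ , c≡
      at : ∀ (P : ℕ → Set) i → (i ≡ index u j c → P e) → (i ≢ index u j c → P (H′ table i)) → P (update (H′ table) (index u j c) e i)
      at P i new old with i ≟ index u j c
      ... | yes refl = subst P (sym (update-≡ (H′ table) i e)) (new refl)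
      ... | no ne = subst P (sym (update-≢ (H′ table) e ne)) (old ne)
      before : ∀ {j′ c′} → index u j′ c′ ≢ index u j c → j′ < j ⊎ (j′ ≡ j × c′ < suc c) → j′ < j ⊎ (j′ ≡ j × c′ < c)
      before ne (inj₁ j′<j) = inj₁ j′<j
      before ne (inj₂ (refl , c′≤c)) = inj₂ (refl , ≤∧≢⇒< (≤-pred c′≤c) λ { refl → ne refl })
      earlier : ∀ {S y j′ c′ v} → u ≡ S + 2 ^ y → y < n → y ∉ S → Reach S j′ c′ v → Optimum (H′ table) S j′ c′ v
      earlier {S} {y} {j′} {c′} eq y<n y∉S R =
        subst (λ m → c′ ∈ m × cost S m ≤ᶠ _) (sym (old S j′ c′ S≢u (≤-trans (reach-index R) k≤n) (reach-center R)))
          (optimum R (proj₂ (smaller-listed (reach-reached R) (<⇒≤ S<u)) S<u))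
        where
        S≢u : S ≢ u
        S≢u S≡u = <⇒≢ (m<m+n S (2^>0 y)) (trans S≡u eq)
        S<u : size S < size u
        S<u = ≤-reflexive (trans (sym (size-add (reached-< (reach-reached R)) y<n y∉S)) (cong size (sym eq)))

    all-rows : Row n 0 (rowsH H₁ u)
    all-rows = foldn-ind (λ j → Row j 0) n start λ j H′ j<n filled →
      next-row (foldn-ind (λ c → Row j c) n filled λ c H″ c<n filled′ → fill j c H″ j<n c<n filled′)
      where
      start : Row 0 0 H₁
      start = record { frame = λ _ _ → refl ; sound′ = sound ; old = λ _ _ _ _ _ _ → refl
                     ; done = λ { _ _ _ (inj₁ ()) ; _ _ _ (inj₂ (_ , ())) } ; small′ = λ i → small table i }
      next-row : ∀ {j H′} → Row j n H′ → Row (suc j) 0 H′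
      next-row {j} filled = record { frame = frame ; sound′ = sound′ ; old = old ; small′ = small′
        ; done = λ { j′ c′ v (inj₁ j′≤j) R → done j′ c′ v (case j′ ≟ j of λ where
                       (yes j′≡j) → inj₂ (j′≡j , reach-center R)
                       (no j′≢j)  → inj₁ (≤∧≢⇒< (≤-pred j′≤j) j′≢j)) R
                   ; _ _ _ (inj₂ (_ , ())) _ } }
        where open Row filled

    module Rest (H₂ : Heap) (R₂ : Row n 0 H₂) where

      open Row R₂ renaming (frame to frame₂; sound′ to sound₂; old to old₂; done to done₂; small′ to small₂)

      H₃ : Heap
      H₃ = candidatesH H₂ u

      best₃ : ℕ
      best₃ = H₃ glob 2

      final : ℕ → ℕ
      final c = H₂ table (index u (k ∸ 1) c)

      k∸1<n : k ∸ 1 < n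
      k∸1<n = ≤-trans (≤-reflexive (m+[n∸m]≡n 1≤k)) k≤n

      best₃-props : Candidate best₃ × (score best₃ ≤ᶠ score best₁) ×
        (∀ c → c < n → size (final c) ≤ k → score best₃ ≤ᶠ score (final c))
      best₃-props = subst (λ g → P n (foldn n g λ c best → better best (final c))) (sym glob₂)
        (foldn-ind P n (Better.candidate B₁ , ≤ᶠ-refl , λ _ ()) λ c b c<n (cand , le , all) →
          let B = better-works cand (proj₁ (sound₂ u (k ∸ 1) c c<n k∸1<n)) in
          Better.candidate B , ≤ᶠ-trans (Better.≤-left B) le , λ c′ c′≤ small-enough → case c′ ≟ c of λ where
            (yes refl) → Better.≤-right B small-enough
            (no c′≢c)  → ≤ᶠ-trans (Better.≤-left B) (all c′ (≤∧≢⇒< (≤-pred c′≤) c′≢c) small-enough))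
        where
        P : ℕ → ℕ → Set
        P i b = Candidate b × (score b ≤ᶠ score best₁) × (∀ c → c < i → size (final c) ≤ k → score b ≤ᶠ score (final c))
        glob₂ : H₂ glob 2 ≡ best₁
        glob₂ = cong (λ f → f 2) (frame₂ glob λ ())

      record Expanded (x : ℕ) (H′ : Heap) : Set where
        field
          table≡    : H′ table ≡ H₂ table
          head≡     : H′ glob 0 ≡ h
          best≡     : H′ glob 2 ≡ best₃
          longer    : tl ≤ H′ glob 1
          frontier′ : Frontier (H′ queue) (H′ seen) (H′ glob 1) (suc (size u))
          prefix    : ∀ i → i < tl → H′ queue i ≡ L i
          stays     : ∀ S → 1 ≤ H seen S → 1 ≤ H′ seen S
          pushed    : ∀ y → y < x → y ∉ u → 1 ≤ heavy (u + 2 ^ y) → 1 ≤ H′ seen (u + 2 ^ y)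
          small″    : ∀ a i → H′ a i ≤ 2 ^ n

      E₃ : Expanded 0 H₃
      E₃ = record
        { table≡ = refl
        ; head≡ = cong (λ f → f 0) (frame₂ glob λ ())
        ; best≡ = refl
        ; longer = ≤-reflexive (sym tail≡)
        ; frontier′ = subst₂ (λ f g → Frontier f g (H₃ glob 1) (suc (size u))) (sym (frame₂ queue λ ())) (sym (frame₂ seen λ ()))
            (subst (λ t → Frontier L (H seen) t (suc (size u))) (sym tail≡) (record
              { entries = entries ; marked = marked ; listed = listed ; counted = counted ; sorted = sorted
              ; limit = λ i i<tl → ≤-trans (limit i i<tl) (window h<tl) ; first = first }))
        ; prefix = λ i _ → cong (λ f → f i) (frame₂ queue λ ())
        ; stays = λ S → subst (λ f → 1 ≤ f S) (sym (frame₂ seen λ ()))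
        ; pushed = λ _ ()
        ; small″ = store-≤ H₂ glob 2 best₃ bounded₂ (<⇒≤ (proj₁ (proj₁ best₃-props)))
        }
        where
        tail≡ : H₃ glob 1 ≡ tl
        tail≡ = cong (λ f → f 1) (frame₂ glob λ ())
        bounded₁ : ∀ a i → H₁ a i ≤ 2 ^ n
        bounded₁ = store-≤ H glob 2 best₁ small (<⇒≤ (proj₁ (Better.candidate B₁)))
        bounded₂ : ∀ a i → H₂ a i ≤ 2 ^ n
        bounded₂ a i with a Fin.≟ table
        ... | yes refl = small₂ i
        ... | no a≢t = subst (λ f → f i ≤ 2 ^ n) (sym (frame₂ a a≢t)) (bounded₁ a i)

      H₄ : Heap
      H₄ = expandH H₃ u

      pushing : ∀ x {H′} → x < n → x ∉ u → 1 ≤ heavy (u + 2 ^ x) → H′ seen (u + 2 ^ x) ≡ 0 →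
        Expanded x H′ → Expanded (suc x) (pushH H′ (u + 2 ^ x))
      pushing x {H′} x<n x∉u heavy-S unseen E = record
        { table≡ = table≡ ; head≡ = head≡ ; best≡ = best≡
        ; longer = m≤n⇒m≤1+n longer
        ; frontier′ = fr
        ; prefix = λ i i<tl → trans (update-≢ (H′ queue) S (<⇒≢ (≤-trans i<tl longer))) (prefix i i<tl)
        ; stays = λ T 1≤ → mark T (stays T 1≤)
        ; pushed = λ y y≤x y∉u hv → case y ≟ x of λ where
            (yes refl) → ≤-reflexive (sym (update-≡ (H′ seen) S 1))
            (no y≢x)   → mark _ (pushed y (≤∧≢⇒< (≤-pred y≤x) y≢x) y∉u hv)
        ; small″ = store-≤ _ glob 1 _ (store-≤ _ queue _ S (store-≤ H′ seen S 1 small″ (m^n>0 2 n)) (<⇒≤ (reached-< R)))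
            -- The tail is a heap cell too; it equals the number of marked masks below 2 ^ n.
            (≤-trans (≤-reflexive (sym (Frontier.counted fr))) (count≤n (2 ^ n) _))
        }
        where
        open Expanded E
        S : ℕ
        S = u + 2 ^ x
        R : Reached S
        R = grow (entries h h<tl) x<n x∉u heavy-S
        fr : Frontier (update (H′ queue) (H′ glob 1) S) (update (H′ seen) S 1) (suc (H′ glob 1)) (suc (size u))
        fr = push frontier′ R unseen (size-add u< x<n x∉u)
        mark : ∀ T → 1 ≤ H′ seen T → 1 ≤ update (H′ seen) S 1 T
        mark T 1≤ with T ≡ᵇ S
        ... | true  = ≤-refl
        ... | false = 1≤

      E₄ : Expanded n H₄
      E₄ = foldn-ind Expanded n E₃ step
        where
        keep : ∀ {x H′} → (x ∉ u → 1 ≤ heavy (u + 2 ^ x) → 1 ≤ H′ seen (u + 2 ^ x)) → Expanded x H′ → Expanded (suc x) H′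
        keep {x} here E = record
          { table≡ = table≡ ; head≡ = head≡ ; best≡ = best≡ ; longer = longer ; frontier′ = frontier′
          ; prefix = prefix ; stays = stays ; small″ = small″
          ; pushed = λ y y≤x → case y ≟ x of λ where
              (yes refl) → here
              (no y≢x)   → pushed y (≤∧≢⇒< (≤-pred y≤x) y≢x) }
          where open Expanded E
        step : ∀ x H′ → x < n → Expanded x H′ → Expanded (suc x) (if lacks x u then
          (if 1 ≤ᵇ heavy (u + pow x) then (if H′ seen (u + pow x) ≤ᵇ 0 then pushH H′ (u + pow x) else H′) else H′) else H′)
        step x H′ x<n E rewrite pow-2^ (<⇒≤ x<n) | lacks-bit u (<⇒≤ x<n) with bit x u in xu
        ... | true = keep (λ x∉u → ⊥-elim (false≢true (trans (sym x∉u) xu))) E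
        ... | false with 1 ≤ᵇ heavy (u + 2 ^ x) in hv
        ...   | false = keep (λ _ hv′ → ⊥-elim (<⇒≱ (false⇒> hv) hv′)) E
        ...   | true with H′ seen (u + 2 ^ x) in sn
        ...     | zero  = pushing x x<n xu (true⇒≤ hv) sn E
        ...     | suc m = keep (λ _ _ → subst (1 ≤_) (sym sn) (s≤s z≤n)) E

      advanced : Inv (advanceH H₄) × advanceH H₄ glob 0 ≡ suc h
      advanced = record
        { lim = suc (size u)
        ; frontier = frontier′
        ; head≤ = subst (_≤ H₄ glob 1) (cong suc (sym head≡)) (≤-trans h<tl longer)
        -- The next head is at least as large as u by sortedness, and all sizes are at most one
        -- above that of u.
        ; window = λ lt → s≤s (≤-trans (≤-reflexive (cong size (sym (prefix h h<tl))))
            (Frontier.sorted frontier′ h (suc (H₄ glob 0)) (≤-trans (≤-reflexive (sym head≡)) (n≤1+n _)) lt))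
        ; closed = λ i y i< y<n → at (λ i → y ∉ H₄ queue i → 1 ≤ heavy (H₄ queue i + 2 ^ y) → 1 ≤ H₄ seen (H₄ queue i + 2 ^ y)) i i<
            (λ i<h → subst (λ S → y ∉ S → 1 ≤ heavy (S + 2 ^ y) → 1 ≤ H₄ seen (S + 2 ^ y)) (sym (prefix i (≤-trans i<h head≤)))
              λ y∉ hv → stays _ (closed i y i<h y<n y∉ hv))
            (subst (λ S → y ∉ S → 1 ≤ heavy (S + 2 ^ y) → 1 ≤ H₄ seen (S + 2 ^ y)) (sym (prefix h h<tl)) (pushed y y<n))
        ; sound = subst Sound (sym table≡) sound₂
        ; optimum = λ {S} {j} {c} {v} R (i , i< , Li) → subst (λ t → Optimum t S j c v) (sym table≡)
            (at (λ i → H₄ queue i ≡ S → Optimum (H₂ table) S j c v) i i<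
              (λ i<h Li → processed R i i<h (trans (sym (prefix i (≤-trans i<h head≤))) Li))
              (λ Lh → current R (trans (sym (prefix h h<tl)) Lh)) Li)
        ; candidate = subst Candidate (sym best≡) (proj₁ best₃-props)
        ; sets = λ i i< → at (λ i → size (H₄ queue i) ≤ k → score (H₄ glob 2) ≤ᶠ score (H₄ queue i)) i i<
            (λ i<h → subst₂ (λ S b → size S ≤ k → score b ≤ᶠ score S) (sym (prefix i (≤-trans i<h head≤))) (sym best≡)
              λ S≤k → ≤ᶠ-trans best₃≤best₁ (≤ᶠ-trans (Better.≤-left B₁) (sets i i<h S≤k)))
            (subst₂ (λ S b → size S ≤ k → score b ≤ᶠ score S) (sym (prefix h h<tl)) (sym best≡)
              λ u≤k → ≤ᶠ-trans best₃≤best₁ (Better.≤-right B₁ u≤k))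
        ; finals = λ i c i< c<n → subst₂ (λ t b → size (t (index (H₄ queue i) (k ∸ 1) c)) ≤ k →
              score b ≤ᶠ score (t (index (H₄ queue i) (k ∸ 1) c))) (sym table≡) (sym best≡)
            (at (λ i → size (H₂ table (index (H₄ queue i) (k ∸ 1) c)) ≤ k → score best₃ ≤ᶠ score (H₂ table (index (H₄ queue i) (k ∸ 1) c))) i i<
              (λ i<h → subst (λ S → size (H₂ table (index S (k ∸ 1) c)) ≤ k → score best₃ ≤ᶠ score (H₂ table (index S (k ∸ 1) c)))
                (sym (prefix i (≤-trans i<h head≤))) (old-final i c i<h c<n))
              (subst (λ S → size (H₂ table (index S (k ∸ 1) c)) ≤ k → score best₃ ≤ᶠ score (H₂ table (index S (k ∸ 1) c)))
                (sym (prefix h h<tl)) (proj₂ (proj₂ best₃-props) c c<n)))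
        ; small = store-≤ H₄ glob 0 _ small″ (≤-trans (≤-reflexive (cong suc head≡)) (≤-trans h<tl
            (≤-trans longer (≤-trans (≤-reflexive (sym (Frontier.counted frontier′))) (count≤n (2 ^ n) _)))))
        } , cong suc head≡
        where
        open Expanded E₄
        at : ∀ (P : ℕ → Set) i → i < suc (H₄ glob 0) → (i < h → P i) → P h → P i
        at P i i≤ old new with i ≟ h
        ... | yes refl = new
        ... | no i≢h = old (≤∧≢⇒< (≤-trans (≤-pred i≤) (≤-reflexive head≡)) i≢h)
        best₃≤best₁ : score best₃ ≤ᶠ score best₁
        best₃≤best₁ = proj₁ (proj₂ best₃-props)
        current : ∀ {S j c v} → Reach S j c v → u ≡ S → Optimum (H₂ table) S j c v
        current R refl = done₂ _ _ _ (inj₁ (≤-trans (reach-index R) k≤n)) R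
        processed : ∀ {S j c v} → Reach S j c v → ∀ i → i < h → L i ≡ S → Optimum (H₂ table) S j c v
        processed {S} {j} {c} R i i<h Li with S ≟ u
        ... | yes refl = current R refl
        ... | no S≢u = subst (λ m → c ∈ m × cost S m ≤ᶠ _)
                (sym (old₂ S j c S≢u (≤-trans (reach-index R) k≤n) (reach-center R))) (optimum R (i , i<h , Li))
        old-final : ∀ i c → i < h → c < n → size (H₂ table (index (L i) (k ∸ 1) c)) ≤ k →
          score best₃ ≤ᶠ score (H₂ table (index (L i) (k ∸ 1) c))
        old-final i c i<h c<n with L i ≟ u
        ... | yes Li≡u rewrite Li≡u = proj₂ (proj₂ best₃-props) c c<n
        ... | no Li≢u rewrite old₂ (L i) (k ∸ 1) c Li≢u k∸1<n c<n = λ m≤k →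
                ≤ᶠ-trans best₃≤best₁ (≤ᶠ-trans (Better.≤-left B₁) (finals i c i<h c<n m≤k))

    searched : Inv (searchAt H u) × searchAt H u glob 0 ≡ suc h
    searched = Rest.advanced (rowsH H₁ u) all-rows

  start-inv : Inv startH
  start-inv = record
    { lim = 0
    ; frontier = record
        { entries = λ _ _ → empty
        ; marked = λ _ _ → ≤-refl
        ; listed = λ { zero _ → 0 , s≤s z≤n , refl ; (suc S) () }
        ; counted = trans (count-cong (2 ^ n) λ x _ → 1≤ᵇ-update (λ _ → 0) 0 x)
            (trans (count-insert (2 ^ n) 0 (m^n>0 2 n) refl) (cong suc (count-none (2 ^ n))))
        ; sorted = λ _ _ _ _ → ≤-refl
        ; limit = λ _ _ → ≤-reflexive size-0
        ; first = ≤-refl , refl }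
    ; head≤ = z≤n
    ; window = λ _ → z≤n
    ; closed = λ _ _ ()
    ; sound = λ S j c c<n j<n → m^n>0 2 n , λ _ → ≤-trans (≤-reflexive size-0) z≤n
    ; optimum = λ { _ (_ , () , _) }
    ; candidate = m^n>0 2 n , ≤-trans (≤-reflexive size-0) z≤n
    ; sets = λ _ ()
    ; finals = λ _ _ ()
    ; small = store-≤ _ seen 0 1 (store-≤ _ glob 1 1 (λ _ _ → z≤n) (m^n>0 2 n)) (m^n>0 2 n)
    }

  module Done (H : Heap) (inv : Inv H) (tl≤h : H glob 1 ≤ H glob 0) where
    open Inv inv

    all-listed : ∀ {S} → Reached S → ∃[ i ] (i < h × L i ≡ S)
    all-listed R with listed _ (found R)
      where
      found : ∀ {S} → Reached S → 1 ≤ H seen S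
      found empty = subst (λ z → 1 ≤ H seen z) (proj₂ first) (marked 0 (proj₁ first))
      found (grow {S} {y} R y<n y∉S hv) with listed S (found R)
      ... | i , i<tl , refl = closed i y (≤-trans i<tl tl≤h) y<n y∉S hv
    ... | i , i<tl , Li = i , ≤-trans i<tl tl≤h , Li

    beats-set : ∀ {S} → Reached S → size S ≤ k → score (H glob 2) ≤ᶠ score S
    beats-set R S≤k with all-listed R
    ... | i , i<h , refl = sets i i<h S≤k

    -- The table entry may have fewer than k centers; completing it greedily cannot raise its total
    -- cost.
    beats-chain : ∀ {S c v} → Reach S (k ∸ 1) c v → (∀ x → x < n → x ∈ S) → score (H glob 2) ≤ᶠ v
    beats-chain {S} {c} {v} R full with all-listed (reach-reached R)
    ... | i , i<h , refl =
      let o = optimum R (i , i<h , refl)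
          m = H table (index (L i) (k ∸ 1) c)
          m< , m≤ = sound (L i) (k ∸ 1) c (reach-center R) (≤-trans (reach-index R) k≤n)
          m≤k = ≤-trans (m≤ (proj₁ o)) (≤-reflexive (m+[n∸m]≡n 1≤k))
      in ≤ᶠ-trans (finals i c i<h (reach-center R) m≤k)
           (≤ᶠ-trans (Greedy.greedy-≤ m< m≤k c (reach-center R) (proj₁ o))
             (≤ᶠ-respˡ (≈-sym (cost-full (L i) m full)) (proj₂ o)))

-- Every clustering is matched by a heavy set or by a chain of heavy sets

≡ᵇ-true : ∀ {x y} → (x ≡ᵇ y) ≡ true → x ≡ y
≡ᵇ-true {x} {y} eq = ≡ᵇ⇒≡ x y (subst T (sym eq) tt)

∧-true : ∀ {a b} → (a ∧ b) ≡ true → a ≡ true × b ≡ true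
∧-true {true} {true} _ = refl , refl

∏-if : ∀ n p c → ∏ n (λ x → if p x then c else 1) ≡ c ^ count n p
∏-if zero    p c = refl
∏-if (suc n) p c with p n
... | true  = trans (cong (_* c) (∏-if n p c)) (*-comm (c ^ count n p) c)
... | false = trans (*-identityʳ _) (∏-if n p c)

-- Stands in for roots: estimates with exponents such as n / 3 or n / 10 are proved after raising
-- both sides to a fixed power.
^-cancel-≤ : ∀ m .{{_ : NonZero m}} {x y} → x ^ m ≤ y ^ m → x ≤ y
^-cancel-≤ m le = ≮⇒≥ λ y<x → <⇒≱ (^-monoˡ-< m y<x) le

count-last : ∀ n (p : ℕ → Bool) → 1 ≤ count n p → ∃[ b ] (b < n × p b ≡ true)
count-last (suc n) p 1≤ with p n in eq
... | true  = n , n<1+n n , eq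
... | false with count-last n p 1≤
...   | b , b<n , pb = b , m<n⇒m<1+n b<n , pb

count-remove : ∀ n {p} y → y < n → p y ≡ true → count n p ≡ suc (count n λ x → p x ∧ not (x ≡ᵇ y))
count-remove n {p} y y<n py = trans (count-cong n same) (count-insert n y y<n
  (trans (cong (λ b → p y ∧ not b) (≡ᵇ-refl y)) (Boolₚ.∧-zeroʳ (p y))))
  where
  same : ∀ x → x < n → p x ≡ insert y (λ x → p x ∧ not (x ≡ᵇ y)) x
  same x _ with x ≟ y
  ... | yes refl rewrite ≡ᵇ-refl x = py
  ... | no x≢y rewrite ≢⇒≡ᵇ x≢y = sym (Boolₚ.∧-identityʳ (p x))

count-two : ∀ n {p} x y → x < n → y < n → x ≢ y → p x ≡ true → p y ≡ true → 2 ≤ count n p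
count-two n {p} x y x<n y<n x≢y px py = ≤-trans (s≤s (≤-trans (s≤s z≤n) (≤-reflexive (sym (count-remove n y y<n
  (cong₂ (λ a b → a ∧ not b) py (≢⇒≡ᵇ (x≢y ∘ sym)))))))) (≤-reflexive (sym (count-remove n x x<n px)))

-- A solution, seen as the idempotent map that sends every point to its center.
record Grouping {F : OrderedField 0ℓ 0ℓ 0ℓ} (I : Instance F) : Set where
  open Instance I
  field
    a       : ℕ → ℕ
    a<      : ∀ x → x < n → a x < n
    idem    : ∀ x → x < n → a (a x) ≡ a x
    fixed-k : count n (λ x → a x ≡ᵇ x) ≡ k

-- Representatives of the clusters

module Clusters {F : OrderedField 0ℓ 0ℓ 0ℓ} {I : Instance F} (A : Grouping I) where
  open Grouping A
  open Instance I
  open Ordered F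
  open Properties I
  open Choosing I
  open Heavy I
  open Costs I

  fixed : ℕ → Bool
  fixed x = a x ≡ᵇ x

  csize : ℕ → ℕ
  csize c = count n λ y → a y ≡ᵇ c

  multi : ℕ → Bool
  multi c = fixed c ∧ (2 ≤ᵇ csize c)

  g : ℕ
  g = count n multi

  expense : Carrier
  expense = ∑ᶠ n λ x → V (a x) x

  term≥0 : ∀ {x} → x < n → 0# ≤ᶠ V (a x) x
  term≥0 x<n = V≥0 _ _ (a< _ x<n) x<n

  fixed-image : ∀ {x} → x < n → fixed (a x) ≡ true
  fixed-image {x} x<n = subst (λ z → (z ≡ᵇ a x) ≡ true) (sym (idem x x<n)) (≡ᵇ-refl (a x))

  moved-multi : ∀ {x} → x < n → a x ≢ x → 2 ≤ csize (a x)
  moved-multi {x} x<n ax≢x = count-two n (a x) x (a< x x<n) x<n ax≢x (fixed-image x<n) (≡ᵇ-refl (a x))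

  double-count : ∀ p → count n (p ∘ a) ≡ ∑ n λ c → if p c then csize c else 0
  double-count p = trans (count-∑ n (p ∘ a)) (trans (Sumℕ.big-fibers n a a< (𝟙 ∘ p ∘ a))
    (Sumℕ.big-cong n λ c _ → inner c))
    where
    inner : ∀ c → ∑ n (λ x → Sumℕ.pick (a x) c (𝟙 (p (a x)))) ≡ (if p c then csize c else 0)
    inner c with p c in pc
    ... | true = trans (Sumℕ.big-cong n λ x _ → each x) (sym (count-∑ n λ x → a x ≡ᵇ c))
      where
      each : ∀ x → Sumℕ.pick (a x) c (𝟙 (p (a x))) ≡ 𝟙 (a x ≡ᵇ c)
      each x with a x ≡ᵇ c in eq
      ... | true  = cong 𝟙 (trans (cong p (≡ᵇ-true eq)) pc)
      ... | false = refl
    ... | false = Sumℕ.big-ε n λ x _ → each x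
      where
      each : ∀ x → Sumℕ.pick (a x) c (𝟙 (p (a x))) ≡ 0
      each x with a x ≡ᵇ c in eq
      ... | true  = cong 𝟙 (trans (cong p (≡ᵇ-true eq)) pc)
      ... | false = refl

  paired : ℕ → Bool
  paired c = fixed c ∧ (csize c ≡ᵇ 2)

  record Partner (c b : ℕ) : Set where
    field
      b<n  : b < n
      b≢c  : b ≢ c
      ab≡c : a b ≡ c
      only : ∀ y → y < n → a y ≡ c → y ≢ c → y ≡ b

  others : ℕ → ℕ → Bool
  others c y = (a y ≡ᵇ c) ∧ not (y ≡ᵇ c)

  partner : ℕ → ℕ
  partner c = foldn n 0 λ y acc → if others c y then y else acc

  partner-works : ∀ {c} → c < n → paired c ≡ true → Partner c (partner c)
  partner-works {c} c<n pc with ∧-true {fixed c} pc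
  ... | fc , sc = record
    { b<n = proj₁ chosen
    ; b≢c = λ b≡c → false≢true (trans (cong not (sym (trans (cong (_≡ᵇ c) b≡c) (≡ᵇ-refl c)))) (proj₂ (∧-true {a b ≡ᵇ c} (proj₂ chosen))))
    ; ab≡c = ≡ᵇ-true (proj₁ (∧-true {a b ≡ᵇ c} (proj₂ chosen)))
    ; only = λ y y<n ay y≢c → unique y y<n (cong₂ (λ p q → p ∧ not q) (trans (cong (_≡ᵇ c) ay) (≡ᵇ-refl c)) (≢⇒≡ᵇ y≢c))
    }
    where
    b : ℕ
    b = partner c
    one : count n (others c) ≡ 1
    one = suc-injective (trans (sym (count-remove n {λ y → a y ≡ᵇ c} c c<n fc)) (≡ᵇ-true sc))
    chosen : b < n × others c b ≡ true
    chosen with count-last n (others c) (≤-reflexive (sym one))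
    ... | y , y<n , oy = foldn-ind (λ i z → ∀ y → y < i → others c y ≡ true → z < n × others c z ≡ true) n
            (λ _ ()) step y y<n oy
      where
      step : ∀ i z → i < n → (∀ y → y < i → others c y ≡ true → z < n × others c z ≡ true) →
        ∀ y → y < suc i → others c y ≡ true →
        (if others c i then i else z) < n × others c (if others c i then i else z) ≡ true
      step i z i<n found y y≤i oy with others c i in oi
      ... | true = i<n , oi
      ... | false = found y (≤∧≢⇒< (≤-pred y≤i) λ { refl → false≢true (trans (sym oi) oy) }) oy
    unique : ∀ y → y < n → others c y ≡ true → y ≡ b
    unique y y<n oy with y ≟ b
    ... | yes y≡b = y≡b
    ... | no y≢b = ⊥-elim (<⇒≱ (n<1+n 1) (≤-trans (count-two n y b y<n (proj₁ chosen) y≢b oy (proj₂ chosen)) (≤-reflexive one)))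

  module Fiber {ℓ ℓ′} (M : CommutativeMonoid ℓ ℓ′) where
    open CommutativeMonoid M using (_∙_; ε) renaming (Carrier to Carrierᵐ; _≈_ to _≈ᵐ_; trans to ≈-transᵐ)
    open BigOp M

    fiber : ℕ → (ℕ → Carrierᵐ) → Carrierᵐ
    fiber c f = big n λ x → pick (a x) c (f x)

    fiber-none : ∀ {c} f → fixed c ≡ false → fiber c f ≈ᵐ ε
    fiber-none {c} f fc = big-ε n λ x x<n → pick-≢ {a x} {c} (f x) λ { refl → false≢true (trans (sym fc) (fixed-image x<n)) }

    pick-at : ∀ {x c} v → a x ≡ c → pick (a x) c v ≈ᵐ v
    pick-at {x} v refl = pick-≡ (a x) v

    fiber-one : ∀ {c} f → c < n → fixed c ≡ true → (∀ x → x < n → a x ≡ c → x ≢ c → f x ≈ᵐ ε) → fiber c f ≈ᵐ f c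
    fiber-one {c} f c<n fc rest = ≈-transᵐ (big-single n c c<n off) (pick-at {c} (f c) (≡ᵇ-true fc))
      where
      off : ∀ x → x < n → x ≢ c → pick (a x) c (f x) ≈ᵐ ε
      off x x<n x≢c with a x ≟ c
      ... | yes refl = ≈-transᵐ (pick-≡ (a x) (f x)) (rest x x<n refl x≢c)
      ... | no ax≢c = pick-≢ {a x} {c} (f x) ax≢c

    fiber-pair : ∀ {c} f → c < n → paired c ≡ true → fiber c f ≈ᵐ f c ∙ f (partner c)
    fiber-pair {c} f c<n pc = ≈-transᵐ
      (big-pair n c (partner c) c<n b<n (b≢c ∘ sym) λ x x<n x≢c x≢b → pick-≢ {a x} {c} (f x) λ ax≡c → x≢b (only x x<n ax≡c x≢c))
      (CommutativeMonoid.∙-cong M (pick-at {c} (f c) (≡ᵇ-true (proj₁ (∧-true {fixed c} pc)))) (pick-at {partner c} _ ab≡c))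
      where open Partner (partner-works c<n pc)

  module Fiberℕ = Fiber +-0-commutativeMonoid
  module Fiberᶠ = Fiber +-commutativeMonoid

  -- A system of representatives of the clusters: the center, except that a
  -- crossing pair (crc) is represented by its point of color true.
  module Transversal (crc col : ℕ → Bool)
    (crossing : ∀ c → c < n → crc c ≡ true → paired c ≡ true × col (partner c) ≡ not (col c)) where

    -- `Tᵖ` drops the singletons from `E`. They are left to the greedy completion, which does at
    -- least as well as `E`.
    E Tᵖ : ℕ → Bool
    E x  = if crc (a x) then col x else fixed x
    Tᵖ x = E x ∧ (2 ≤ᵇ csize (a x))

    mT : ℕ
    mT = mask n Tᵖ

    E-center : ∀ {c} → crc c ≡ true → a c ≡ c → E c ≡ col c
    E-center {c} cc ac≡c = cong (λ b → if b then col c else fixed c) (trans (cong crc ac≡c) cc)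

    E-partner : ∀ {c b} → crc c ≡ true → a b ≡ c → E b ≡ col b
    E-partner {c} {b} cc ab≡c = cong (λ z → if z then col b else fixed b) (trans (cong crc ab≡c) cc)

    E-plain : ∀ {c x} → crc c ≡ false → a x ≡ c → E x ≡ fixed x
    E-plain {c} {x} cc ax≡c = cong (λ z → if z then col x else fixed x) (trans (cong crc ax≡c) cc)

    center-fixed : ∀ {c} → paired c ≡ true → a c ≡ c
    center-fixed {c} pc = ≡ᵇ-true (proj₁ (∧-true {fixed c} pc))

    csize-two : ∀ {c} → paired c ≡ true → csize c ≡ 2
    csize-two {c} pc = ≡ᵇ-true (proj₂ (∧-true {fixed c} pc))

    -- One representative per cluster: the points of a crossing pair have different colors, so
    -- exactly one of them is taken.
    count-E : count n E ≡ k
    count-E = begin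
      count n E                                              ≡⟨ count-∑ n E ⟩
      ∑ n (𝟙 ∘ E)                                            ≡⟨ Sumℕ.big-fibers n a a< (𝟙 ∘ E) ⟩
      ∑ n (λ c → Fiberℕ.fiber c (𝟙 ∘ E))                      ≡⟨ Sumℕ.big-cong n each ⟩
      ∑ n (𝟙 ∘ fixed)                                        ≡⟨ count-∑ n fixed ⟨
      count n fixed                                          ≡⟨ fixed-k ⟩
      k                                                      ∎
      where
      open ≡-Reasoning
      each : ∀ c → c < n → Fiberℕ.fiber c (𝟙 ∘ E) ≡ 𝟙 (fixed c)
      each c c<n with crc c in cc
      ... | false = plain (fixed c) refl
        where
        plain : ∀ b → fixed c ≡ b → Fiberℕ.fiber c (𝟙 ∘ E) ≡ 𝟙 (fixed c)
        plain false fc = trans (Fiberℕ.fiber-none (𝟙 ∘ E) fc) (cong 𝟙 (sym fc))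
        plain true  fc = trans (Fiberℕ.fiber-one (𝟙 ∘ E) c<n fc
            λ x x<n ax≡c x≢c → cong 𝟙 (trans (E-plain cc ax≡c) (≢⇒≡ᵇ λ ax≡x → x≢c (trans (sym ax≡x) ax≡c))))
          (cong 𝟙 (E-plain cc (≡ᵇ-true fc)))
      ... | true with crossing c c<n cc
      ...   | pc , differ = begin
        Fiberℕ.fiber c (𝟙 ∘ E)                ≡⟨ Fiberℕ.fiber-pair (𝟙 ∘ E) c<n pc ⟩
        𝟙 (E c) + 𝟙 (E (partner c))           ≡⟨ cong₂ (λ p q → 𝟙 p + 𝟙 q) (E-center cc (center-fixed pc))
                                                  (trans (E-partner cc (Partner.ab≡c (partner-works c<n pc))) differ) ⟩
        𝟙 (col c) + 𝟙 (not (col c))           ≡⟨ once (col c) ⟩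
        1                                     ≡⟨ cong 𝟙 (proj₁ (∧-true {fixed c} pc)) ⟨
        𝟙 (fixed c)                           ∎
        where
        once : ∀ b → 𝟙 b + 𝟙 (not b) ≡ 1
        once true  = refl
        once false = refl

    T⊆E : ∀ x → x < n → x ∈ mT → E x ≡ true
    T⊆E x x<n x∈T = proj₁ (∧-true {E x} (trans (sym (bit-mask n Tᵖ x x<n)) x∈T))

    in-T : ∀ {x} → x < n → E x ≡ true → 2 ≤ csize (a x) → x ∈ mT
    in-T {x} x<n Ex 2≤ = trans (bit-mask n Tᵖ x x<n) (cong₂ _∧_ Ex (≤ᵇ-true 2≤))

    pair-in-T : ∀ {c x} → paired c ≡ true → x < n → a x ≡ c → E x ≡ true → x ∈ mT
    pair-in-T pc x<n ax≡c Ex = in-T x<n Ex (≤-reflexive (sym (trans (cong csize ax≡c) (csize-two pc))))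

    center-in-T : ∀ {x} → x < n → a x ≢ x → crc (a x) ≡ false → a x ∈ mT
    center-in-T {x} x<n ax≢x cc = in-T (a< x x<n) (trans (E-plain cc (idem x x<n)) (fixed-image x<n))
      (≤-trans (moved-multi x<n ax≢x) (≤-reflexive (cong csize (sym (idem x x<n)))))

    T-size : size mT ≤ k
    T-size = ≤-trans (count-mono n T⊆E) (≤-reflexive count-E)

    -- A cluster of at least two points has its representative in `mT`, so `mT` is empty only if
    -- every cluster is a singleton.
    source : k ≡ n ⊎ (∃[ c ] (c < n × c ∈ mT))
    source with anyUpTo? (λ c → bit c mT Boolₚ.≟ true) n
    ... | yes found = inj₂ found
    ... | no none = inj₁ (trans (sym fixed-k) (count-all n all-fixed))
      where
      absent : ∀ {x} → x < n → x ∈ mT → ⊥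
      absent x<n x∈T = none (_ , x<n , x∈T)
      all-fixed : ∀ x → x < n → fixed x ≡ true
      all-fixed x x<n with a x ≟ x
      ... | yes ax≡x = trans (cong (_≡ᵇ x) ax≡x) (≡ᵇ-refl x)
      ... | no ax≢x with crc (a x) in cc
      ...   | false = ⊥-elim (absent (a< x x<n) (center-in-T x<n ax≢x cc))
      ...   | true with crossing (a x) (a< x x<n) cc
      ...     | pc , differ with col (a x) in colour
      ...       | true  = ⊥-elim (absent (a< x x<n) (pair-in-T pc (a< x x<n) (idem x x<n)
                    (trans (E-center cc (idem x x<n)) colour)))
      ...       | false = ⊥-elim (absent b<n (pair-in-T pc b<n ab≡c (trans (E-partner cc ab≡c) differ)))
        where open Partner (partner-works (a< x x<n) pc)

    left : ℕ → Carrier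
    left x = [ not (E x) ] dist mT x

    -- Compared cluster by cluster. Moved points of an uncrossed cluster still find their center in
    -- `mT`. In a crossing pair the representative pays nothing and the other point pays the
    -- distance of the pair, which is symmetric.
    cheap : ∑ᶠ n left ≤ᶠ expense
    cheap = ≤ᶠ-respˡ (Sumᶠ.big-fibers n a a< left) (≤ᶠ-respʳ
      (Sumᶠ≤.big-mono n each) (≈-sym (Sumᶠ.big-fibers n a a< λ x → V (a x) x)))
      where
      each : ∀ c → c < n → Fiberᶠ.fiber c left ≤ᶠ Fiberᶠ.fiber c (λ x → V (a x) x)
      each c c<n with crc c in cc
      ... | false = Sumᶠ≤.big-mono n pointwise
        where
        pointwise : ∀ x → x < n → Sumᶠ.pick (a x) c (left x) ≤ᶠ Sumᶠ.pick (a x) c (V (a x) x)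
        pointwise x x<n with a x ≡ᵇ c in eq
        ... | false = ≤ᶠ-refl
        ... | true with E x in Ex
        ...   | true = term≥0 x<n
        ...   | false = dist≤ mT x<n (a x) (a< x x<n) (center-in-T x<n
                  (λ ax≡x → false≢true (trans (sym Ex) (trans (E-plain cc (≡ᵇ-true eq)) (trans (cong (_≡ᵇ x) ax≡x) (≡ᵇ-refl x)))))
                  (trans (cong crc (≡ᵇ-true eq)) cc))
      ... | true with crossing c c<n cc
      ...   | pc , differ = ≤ᶠ-respˡ (Fiberᶠ.fiber-pair left c<n pc)
                (≤ᶠ-respʳ (pair (col c) refl) (≈-sym (Fiberᶠ.fiber-pair (λ x → V (a x) x) c<n pc)))
        where
        open Partner (partner-works c<n pc)
        b : ℕ
        b = partner c
        ac≡c : a c ≡ c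
        ac≡c = center-fixed pc
        Ec : E c ≡ col c
        Ec = E-center cc ac≡c
        Eb : E b ≡ not (col c)
        Eb = trans (E-partner cc ab≡c) differ
        left-≡ : ∀ {x β} → E x ≡ β → left x ≈ ([ not β ] dist mT x)
        left-≡ {x} eq = ≈-reflexive (cong (λ z → [ not z ] dist mT x) eq)
        pair : ∀ β → col c ≡ β → (left c +ᶠ left b) ≤ᶠ (V (a c) c +ᶠ V (a b) b)
        pair true colour = +ᶠ-mono (≤ᶠ-respˡ (left-≡ (trans Ec colour)) (term≥0 c<n)) (≤ᶠ-respˡ (left-≡ (trans Eb (cong not colour)))
              (≤ᶠ-respʳ (dist≤ mT b<n c c<n (pair-in-T pc c<n ac≡c (trans Ec colour)))
                (≈-reflexive (cong (λ z → V z b) (sym ab≡c)))))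
        pair false colour = ≤ᶠ-respˡ (OrderedField.+-comm F _ _) (+ᶠ-mono (≤ᶠ-respˡ (left-≡ (trans Eb (cong not colour))) (term≥0 c<n))
              (≤ᶠ-respˡ (left-≡ (trans Ec colour)) (≤ᶠ-respʳ (dist≤ mT c<n b b<n (pair-in-T pc b<n ab≡c (trans Eb (cong not colour))))
                (≈-trans (V-sym b c b<n c<n) (≈-reflexive (cong (λ z → V z b) (sym ab≡c)))))))

    score-T : score mT ≤ᶠ expense
    score-T = ≤ᶠ-trans (Greedy.greedy-optimal (mask<2^n n Tᵖ) T-size source E (≤-reflexive count-E) T⊆E) cheap

  -- If leaving a point out never costs weight, a set inherits its weight to all
  -- of its subsets, so it is reached by adding its points in increasing order.
  descend : ∀ p α β → (∀ x → x < n → (if p x then α else β) ≤ (if p x then 756 ∸ α else 756 ∸ β)) →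
    (∀ S → 400 ^ n ≤ weight p α β S → Profile S) →
    ∀ t → 400 ^ n ≤ weight p α β (mask n t) → Reached (mask n t)
  descend p α β in≤out profile t full = subst Reached (mask-cong n λ x x<n → cong (_∧ t x) (≤ᵇ-true x<n)) (prefix n ≤-refl)
    where
    upto : ℕ → ℕ → Bool
    upto i x = (suc x ≤ᵇ i) ∧ t x
    heavier : ∀ i → 400 ^ n ≤ weight p α β (mask n (upto i))
    heavier i = ≤-trans full (≤-trans (≤-reflexive (weight-∏ p α β (mask n t))) (≤-trans
      (Prod≤.big-mono n pointwise) (≤-reflexive (sym (weight-∏ p α β (mask n (upto i)))))))
      where
      pointwise : ∀ x → x < n → factor p α β (mask n t) x ≤ factor p α β (mask n (upto i)) x
      pointwise x x<n rewrite bit-mask n t x x<n | bit-mask n (upto i) x x<n with suc x ≤ᵇ i | t x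
      ... | true  | true  = ≤-refl
      ... | true  | false = ≤-refl
      ... | false | true  = in≤out x x<n
      ... | false | false = ≤-refl
    prefix : ∀ i → i ≤ n → Reached (mask n (upto i))
    prefix zero _ = subst Reached (sym (mask-none n)) empty
    prefix (suc i) i<n with t i in ti
    ... | true = subst Reached (sym step) (grow (prefix i (<⇒≤ i<n)) i<n fresh
            (subst (λ S → 1 ≤ heavy S) step (heavy-intro (profile _ (heavier (suc i))))))
      where
      at-i : upto i i ≡ false
      at-i = cong (_∧ t i) (≤ᵇ-false (n<1+n i))
      fresh : i ∉ mask n (upto i)
      fresh = trans (bit-mask n (upto i) i i<n) at-i
      same : ∀ x → x < n → upto (suc i) x ≡ insert i (upto i) x
      same x x<n with x ≟ i
      ... | yes refl rewrite ≡ᵇ-refl x | ≤ᵇ-true (n<1+n x) = ti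
      ... | no x≢i rewrite ≢⇒≡ᵇ x≢i = cong (_∧ t x) (step≤ x i x≢i)
        where
        step≤ : ∀ x i → x ≢ i → (suc x ≤ᵇ suc i) ≡ (suc x ≤ᵇ i)
        step≤ x i x≢i with <-cmp x i
        ... | tri< x<i _ _ = trans (≤ᵇ-true {suc x} {suc i} (m<n⇒m<1+n x<i)) (sym (≤ᵇ-true x<i))
        ... | tri≈ _ x≡i _ = ⊥-elim (x≢i x≡i)
        ... | tri> _ _ x>i = trans (≤ᵇ-false {suc x} {suc i} (s≤s x>i)) (sym (≤ᵇ-false (m<n⇒m<1+n x>i)))
      step : mask n (upto (suc i)) ≡ mask n (upto i) + 2 ^ i
      step = trans (mask-cong n same) (mask-insert n (upto i) i i<n at-i)
    ... | false = subst Reached (mask-cong n same) (prefix i (<⇒≤ i<n))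
      where
      same : ∀ x → x < n → upto i x ≡ upto (suc i) x
      same x x<n with <-cmp x i
      ... | tri< x<i _ _ rewrite ≤ᵇ-true x<i | ≤ᵇ-true {suc x} {suc i} (m<n⇒m<1+n x<i) = refl
      ... | tri≈ _ refl _ rewrite ≤ᵇ-false (n<1+n x) | ≤ᵇ-true (n<1+n x) = sym ti
      ... | tri> _ _ x>i rewrite ≤ᵇ-false (m<n⇒m<1+n x>i) | ≤ᵇ-false {suc x} {suc i} (s≤s x>i) = refl

∨-split : ∀ {a b} → (a ∨ b) ≡ true → a ≡ true ⊎ b ≡ true
∨-split {true}  _  = inj₁ refl
∨-split {false} eq = inj₂ eq

∏-*ˡ : ∀ n (f h : ℕ → ℕ) → ∏ n f * ∏ n h ≡ ∏ n (λ x → f x * h x)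
∏-*ˡ n f h = sym (Prodℕ.big-∙ n f h)

count-below : ∀ n i → i ≤ n → count n (λ x → suc x ≤ᵇ i) ≡ i
count-below n i i≤n = go n i≤n
  where
  go : ∀ m → i ≤ m → count m (λ x → suc x ≤ᵇ i) ≡ i
  go m i≤m with i ≟ m
  ... | yes refl = count-all m λ x x<m → ≤ᵇ-true x<m
  go zero i≤0 | no i≢0 = ⊥-elim (i≢0 (n≤0⇒n≡0 i≤0))
  go (suc m) i≤sm | no i≢sm rewrite ≤ᵇ-false {suc m} {i} (s≤s (≤-pred (≤∧≢⇒< i≤sm i≢sm))) =
    go m (≤-pred (≤∧≢⇒< i≤sm i≢sm))

^-swap : ∀ c m i → (c ^ m) ^ i ≡ (c ^ i) ^ m
^-swap c m i = trans (^-*-assoc c m i) (trans (cong (c ^_) (*-comm m i)) (sym (^-*-assoc c i m)))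

-- Completing the clusters in the order of their first points

module Chains {F : OrderedField 0ℓ 0ℓ 0ℓ} {I : Instance F} (A : Grouping I) where
  open Grouping A
  open Clusters A
  open Instance I
  open Ordered F
  open Properties I
  open Choosing I
  open Heavy I
  open Costs I

  covered : ℕ → ℕ → Bool
  covered zero    c = false
  covered (suc i) c = (a i ≡ᵇ c) ∨ covered i c

  touched : ℕ → ℕ → Bool
  touched i y = covered i (a y)

  U D : ℕ → ℕ
  U i = count n (touched i)
  D i = count n λ c → fixed c ∧ covered i c

  covered-self : ∀ i x → x < i → covered i (a x) ≡ true
  covered-self (suc i) x x≤i with x ≟ i
  ... | yes refl = cong (_∨ covered x (a x)) (≡ᵇ-refl (a x))
  ... | no x≢i = trans (cong ((a i ≡ᵇ a x) ∨_) (covered-self i x (≤∧≢⇒< (≤-pred x≤i) x≢i))) (Boolₚ.∨-zeroʳ _)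

  covered-skip : ∀ i c → covered i (a i) ≡ true → covered (suc i) c ≡ covered i c
  covered-skip i c ci with a i ≡ᵇ c in eq
  ... | false = refl
  ... | true  = sym (subst (λ z → covered i z ≡ true) (≡ᵇ-true eq) ci)

  D-step : ∀ i → i < n → covered i (a i) ≡ false → D (suc i) ≡ suc (D i)
  D-step i i<n ci = trans (count-cong n same) (count-insert n (a i) (a< i i<n)
    (trans (cong (fixed (a i) ∧_) ci) (Boolₚ.∧-zeroʳ _)))
    where
    same : ∀ c → c < n → (fixed c ∧ covered (suc i) c) ≡ insert (a i) (λ c → fixed c ∧ covered i c) c
    same c c<n with c ≟ a i
    ... | yes refl rewrite ≡ᵇ-refl (a i) | fixed-image i<n = refl
    ... | no c≢ai rewrite ≢⇒≡ᵇ c≢ai | ≢⇒≡ᵇ {a i} {c} (c≢ai ∘ sym) = refl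

  D-skip : ∀ i → covered i (a i) ≡ true → D (suc i) ≡ D i
  D-skip i ci = count-cong n λ c _ → cong (fixed c ∧_) (covered-skip i c ci)

  D≤ : ∀ i → i ≤ n → D i ≤ i
  D≤ zero _ = ≤-reflexive (trans (count-cong n λ c _ → Boolₚ.∧-zeroʳ (fixed c)) (count-none n))
  D≤ (suc i) i<n with covered i (a i) in ci
  ... | true  = ≤-trans (≤-reflexive (D-skip i ci)) (m≤n⇒m≤1+n (D≤ i (<⇒≤ i<n)))
  ... | false = ≤-trans (≤-reflexive (D-step i i<n ci)) (s≤s (D≤ i (<⇒≤ i<n)))

  D≤k : ∀ i → D i ≤ k
  D≤k i = ≤-trans (count-mono n λ c _ eq → proj₁ (∧-true {fixed c} eq)) (≤-reflexive fixed-k)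

  D-full : D n ≡ k
  D-full = trans (count-cong n λ c c<n → whole c c<n) fixed-k
    where
    whole : ∀ c → c < n → (fixed c ∧ covered n c) ≡ fixed c
    whole c c<n with fixed c in fc
    ... | false = refl
    ... | true  = subst (λ z → covered n z ≡ true) (≡ᵇ-true fc) (covered-self n c c<n)

  -- The hypothesis under which clusters can be completed in the order of their
  -- first points without leaving the heavy sets.
  module _ (tame : ∀ i → i ≤ n → 10 * i < n → 6 * U i ≤ 2 * n + 9 * i) where

    -- For 10 i < n a set of s points has weight w with w * 2 ^ s = 504 ^ n * 3 ^ i. The part n / 3
    -- of the bound on s is paid by 504 / 400 as in the case of few clusters, the part 3 i / 2 by
    -- the factor 3 per prefix point: in sixth powers 512 ≤ 729. For 10 i ≥ n all supersets of the
    -- prefix get the same weight 378 ^ n * 2 ^ i, and 400 ^ 10 ≤ 2 * 378 ^ 10 is enough.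
    between-heavy : ∀ i p → 1 ≤ i → i ≤ n → (∀ x → x < i → p x ≡ true) →
      (∀ x → x < n → p x ≡ true → touched i x ≡ true) → 1 ≤ heavy (mask n p)
    between-heavy i p 1≤i i≤n below p⊆ with 10 * i <? n
    ... | yes 10i<n = heavy-intro (i , 0 , ≤-trans (s≤s (m≤n*m i 10)) 10i<n , 1≤n , inj₁
            (^-cancel-≤ 6 (*-cancelʳ-≤ _ _ ((2 ^ 6) ^ s) {{m^n≢0 (2 ^ 6) s}} (begin
      (400 ^ n) ^ 6 * 64 ^ s              ≤⟨ *-monoʳ-≤ ((400 ^ n) ^ 6) sixfold ⟩
      (400 ^ n) ^ 6 * (4 ^ n * 512 ^ i)   ≡⟨ cong (_* (4 ^ n * 512 ^ i)) (^-swap 400 n 6) ⟩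
      (400 ^ 6) ^ n * (4 ^ n * 512 ^ i)   ≡⟨ *-assoc ((400 ^ 6) ^ n) (4 ^ n) (512 ^ i) ⟨
      (400 ^ 6) ^ n * 4 ^ n * 512 ^ i     ≡⟨ cong (_* 512 ^ i) (^-distribʳ-* (400 ^ 6) 4 n) ⟨
      (400 ^ 6 * 4) ^ n * 512 ^ i         ≤⟨ *-mono-≤ (^-monoˡ-≤ n (≤ᵇ⇒≤ (400 ^ 6 * 4) (504 ^ 6) tt))
                                                      (^-monoˡ-≤ i (≤ᵇ⇒≤ 512 (3 ^ 6) tt)) ⟩
      (504 ^ 6) ^ n * (3 ^ 6) ^ i         ≡⟨ cong₂ _*_ (^-swap 504 n 6) (^-swap 3 i 6) ⟨
      (504 ^ n) ^ 6 * (3 ^ i) ^ 6         ≡⟨ ^-distribʳ-* (504 ^ n) (3 ^ i) 6 ⟨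
      (504 ^ n * 3 ^ i) ^ 6               ≡⟨ cong (_^ 6) value ⟨
      (w * 2 ^ s) ^ 6                     ≡⟨ ^-distribʳ-* w (2 ^ s) 6 ⟩
      w ^ 6 * (2 ^ s) ^ 6                 ≡⟨ cong (w ^ 6 *_) (^-swap 2 s 6) ⟩
      w ^ 6 * 64 ^ s                      ∎))))
      where
      open ≤-Reasoning
      s w : ℕ
      s = count n p
      w = profile₁ i 0 (mask n p)
      sixfold : 64 ^ s ≤ 4 ^ n * 512 ^ i
      sixfold = begin
        64 ^ s                            ≡⟨ ^-*-assoc 2 6 s ⟩
        2 ^ (6 * s)                       ≤⟨ ^-monoʳ-≤ 2 (≤-trans (*-monoʳ-≤ 6 (count-mono n p⊆)) (tame i i≤n 10i<n)) ⟩
        2 ^ (2 * n + 9 * i)               ≡⟨ ^-distribˡ-+-* 2 (2 * n) (9 * i) ⟩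
        2 ^ (2 * n) * 2 ^ (9 * i)         ≡⟨ cong₂ _*_ (^-*-assoc 2 2 n) (^-*-assoc 2 9 i) ⟨
        4 ^ n * 512 ^ i                   ∎
      value : w * 2 ^ s ≡ 504 ^ n * 3 ^ i
      value = begin-equality
        w * 2 ^ s                                         ≡⟨ cong₂ _*_ (weight-∏ (λ x → suc x ≤ᵇ i) 756 252 (mask n p)) (sym (∏-if n p 2)) ⟩
        ∏ n (factor (λ x → suc x ≤ᵇ i) 756 252 (mask n p)) * ∏ n (λ x → if p x then 2 else 1)
                                                          ≡⟨ ∏-*ˡ n _ _ ⟩
        ∏ n (λ x → factor (λ x → suc x ≤ᵇ i) 756 252 (mask n p) x * (if p x then 2 else 1))
                                                          ≡⟨ Prodℕ.big-cong n pointwise ⟩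
        ∏ n (λ x → 504 * (if suc x ≤ᵇ i then 3 else 1))   ≡⟨ Prodℕ.big-∙ n (λ _ → 504) _ ⟩
        ∏ n (λ _ → 504) * ∏ n (λ x → if suc x ≤ᵇ i then 3 else 1)
                                                          ≡⟨ cong₂ _*_ (∏-const n 504) (trans (∏-if n (λ x → suc x ≤ᵇ i) 3) (cong (3 ^_) (count-below n i i≤n))) ⟩
        504 ^ n * 3 ^ i                                   ∎
        where
        pointwise : ∀ x → x < n → factor (λ x → suc x ≤ᵇ i) 756 252 (mask n p) x * (if p x then 2 else 1) ≡
          504 * (if suc x ≤ᵇ i then 3 else 1)
        pointwise x x<n rewrite bit-mask n p x x<n with suc x ≤ᵇ i in lt | p x in px
        ... | true  | true  = refl
        ... | true  | false = ⊥-elim (false≢true (trans (sym px) (below x (true⇒≤ lt))))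
        ... | false | true  = refl
        ... | false | false = refl
    -- The prefix `x ≤ q` has suc q points, so an index q < n also covers the prefix of all n
    -- points.
    between-heavy (suc q) p 1≤i i≤n below p⊆ | no 10i≮n = heavy-intro (q , 0 , i≤n , 1≤n , inj₂ (inj₁
            (^-cancel-≤ 10 (begin
      (400 ^ n) ^ 10                      ≡⟨ ^-swap 400 n 10 ⟩
      (400 ^ 10) ^ n                      ≤⟨ ^-monoˡ-≤ n (≤ᵇ⇒≤ (400 ^ 10) (378 ^ 10 * 2) tt) ⟩
      (378 ^ 10 * 2) ^ n                  ≡⟨ ^-distribʳ-* (378 ^ 10) 2 n ⟩
      (378 ^ 10) ^ n * 2 ^ n              ≤⟨ *-monoʳ-≤ ((378 ^ 10) ^ n) (^-monoʳ-≤ 2 (≮⇒≥ 10i≮n)) ⟩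
      (378 ^ 10) ^ n * 2 ^ (10 * suc q)   ≡⟨ cong₂ _*_ (sym (^-swap 378 n 10)) (trans (cong (2 ^_) (*-comm 10 (suc q))) (sym (^-*-assoc 2 (suc q) 10))) ⟩
      (378 ^ n) ^ 10 * (2 ^ suc q) ^ 10   ≡⟨ ^-distribʳ-* (378 ^ n) (2 ^ suc q) 10 ⟨
      (378 ^ n * 2 ^ suc q) ^ 10          ≡⟨ cong (_^ 10) value ⟨
      profile₂ q 0 (mask n p) ^ 10        ∎))))
      where
      open ≤-Reasoning
      value : profile₂ q 0 (mask n p) ≡ 378 ^ n * 2 ^ suc q
      value = begin-equality
        profile₂ q 0 (mask n p)                              ≡⟨ weight-∏ (λ x → x ≤ᵇ q) 756 378 (mask n p) ⟩
        ∏ n (factor (λ x → x ≤ᵇ q) 756 378 (mask n p))       ≡⟨ Prodℕ.big-cong n pointwise ⟩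
        ∏ n (λ x → 378 * (if suc x ≤ᵇ suc q then 2 else 1))  ≡⟨ Prodℕ.big-∙ n (λ _ → 378) _ ⟩
        ∏ n (λ _ → 378) * ∏ n (λ x → if suc x ≤ᵇ suc q then 2 else 1)
          ≡⟨ cong₂ _*_ (∏-const n 378) (trans (∏-if n (λ x → suc x ≤ᵇ suc q) 2) (cong (2 ^_) (count-below n (suc q) i≤n))) ⟩
        378 ^ n * 2 ^ suc q                                  ∎
        where
        ≤ᵇ-suc : ∀ x q → (suc x ≤ᵇ suc q) ≡ (x ≤ᵇ q)
        ≤ᵇ-suc zero    q = refl
        ≤ᵇ-suc (suc x) q = refl
        pointwise : ∀ x → x < n → factor (λ x → x ≤ᵇ q) 756 378 (mask n p) x ≡ 378 * (if suc x ≤ᵇ suc q then 2 else 1)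
        pointwise x x<n rewrite bit-mask n p x x<n | ≤ᵇ-suc x q with x ≤ᵇ q in le | p x in px
        ... | true  | true  = refl
        ... | true  | false = ⊥-elim (false≢true (trans (sym px) (below x (s≤s (true⇒≤ le)))))
        ... | false | true  = refl
        ... | false | false = refl

    spent : (ℕ → Bool) → Carrier
    spent p = ∑ᶠ n λ y → [ p y ] V (a y) y

    spent-cong : ∀ {p q} → (∀ y → y < n → p y ≡ q y) → spent p ≈ spent q
    spent-cong p≡q = Sumᶠ.big-cong n λ y y<n → ≈-reflexive (cong (λ b → [ b ] V (a y) y) (p≡q y y<n))

    spent-insert : ∀ {p} y → y < n → p y ≡ false → spent (insert y p) ≈ (spent p +ᶠ V (a y) y)
    spent-insert {p} y y<n py = ≈-trans (Sumᶠ.big-cong n split) (≈-trans (Sumᶠ.big-∙ n _ _)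
      (OrderedField.+-congˡ F (≈-trans (Sumᶠ.big-single n y y<n
          (λ x _ x≢y → ≈-reflexive (cong (λ b → [ b ] V (a x) x) (≢⇒≡ᵇ x≢y))))
        (≈-reflexive (cong (λ b → [ b ] V (a y) y) (≡ᵇ-refl y))))))
      where
      split : ∀ x → x < n → ([ insert y p x ] V (a x) x) ≈ (([ p x ] V (a x) x) +ᶠ ([ x ≡ᵇ y ] V (a x) x))
      split x x<n with x ≟ y
      ... | yes refl rewrite ≡ᵇ-refl x | py = ≈-sym (OrderedField.+-identityˡ F _)
      ... | no x≢y rewrite ≢⇒≡ᵇ x≢y = ≈-sym (OrderedField.+-identityʳ F _)

    Built : (ℕ → Bool) → ℕ → ℕ → Set
    Built p j c = Σ[ v ∈ Carrier ] (Reach (mask n p) j c v × v ≤ᶠ spent p)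

    built-cong : ∀ {p q j c} → (∀ y → y < n → p y ≡ q y) → Built p j c → Built q j c
    built-cong p≡q (v , R , v≤) = v , subst (λ S → Reach S _ _ v) (mask-cong n p≡q) R , ≤ᶠ-respʳ v≤ (spent-cong p≡q)

    build : ∀ {p q j j′ c c′} y → y < n → p y ≡ false → a y ≡ c′ → (∀ x → x < n → q x ≡ insert y p x) →
      1 ≤ heavy (mask n q) →
      (∀ {S v} → Reach S j c v → y ∉ S → 1 ≤ heavy (S + 2 ^ y) → Reach (S + 2 ^ y) j′ c′ (v +ᶠ V c′ y)) →
      Built p j c → Built q j′ c′
    build {p} {q} y y<n py refl q≡ hv extend (v , R , v≤) =
      _ , subst (λ S → Reach S _ _ (v +ᶠ V (a y) y)) (sym mask≡)
            (extend R (trans (bit-mask n p y y<n) py) (subst (λ S → 1 ≤ heavy S) mask≡ hv))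
        , ≤ᶠ-respʳ (+ᶠ-mono v≤ ≤ᶠ-refl) (≈-sym (≈-trans (spent-cong q≡) (spent-insert y y<n py)))
      where
      mask≡ : mask n q ≡ mask n p + 2 ^ y
      mask≡ = trans (mask-cong n q≡) (mask-insert n p y y<n py)

    -- `Reach` counts the opened clusters minus one, which has no value before the first cluster;
    -- hence the separate case of i = 0.
    Progress : ℕ → Set
    Progress i = i ≡ 0 ⊎ (1 ≤ D i × (∃[ c ] Built (touched i) (D i ∸ 1) c))

    -- If the cluster of i has been met, neither the union nor the number of clusters changes.
    -- Otherwise i opens its cluster and a sweep over all points adds the rest of it; the sets on
    -- the way contain the first i + 1 points and lie in `touched (suc i)`, so they are heavy.
    advance : ∀ i → i < n → Progress i → Progress (suc i)
    advance i i<n prog with covered i (a i) in ci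
    advance .0 i<n (inj₁ refl) | true = ⊥-elim (false≢true ci)
    advance i i<n (inj₂ (1≤D , c , built)) | true =
      inj₂ (≤-trans 1≤D (≤-reflexive (sym (D-skip i ci))) , c ,
            subst (λ d → Built (touched (suc i)) (d ∸ 1) c) (sym (D-skip i ci))
              (built-cong (λ y _ → sym (covered-skip i (a y) ci)) built))
    advance i i<n prog | false = inj₂ (≤-trans (s≤s z≤n) (≤-reflexive (sym D≡)) , a i ,
        subst (λ d → Built (touched (suc i)) (d ∸ 1) (a i)) (sym D≡) (built-cong complete (filled n ≤-refl)))
      where
      D≡ : D (suc i) ≡ suc (D i)
      D≡ = D-step i i<n ci
      part : ℕ → ℕ → Bool
      part t y = insert i (touched i) y ∨ ((suc y ≤ᵇ t) ∧ (a y ≡ᵇ a i))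
      part-heavy : ∀ t → 1 ≤ heavy (mask n (part t))
      part-heavy t = between-heavy (suc i) (part t) (s≤s z≤n) i<n below inside
        where
        below : ∀ x → x < suc i → part t x ≡ true
        below x x≤i with x ≟ i
        ... | yes refl rewrite ≡ᵇ-refl x = refl
        ... | no x≢i rewrite ≢⇒≡ᵇ x≢i | covered-self i x (≤∧≢⇒< (≤-pred x≤i) x≢i) = refl
        inside : ∀ x → x < n → part t x ≡ true → touched (suc i) x ≡ true
        inside x x<n px with ∨-split {insert i (touched i) x} px
        ... | inj₂ both = cong (_∨ touched i x) (trans (cong (a i ≡ᵇ_) (≡ᵇ-true (proj₂ (∧-true {suc x ≤ᵇ t} both)))) (≡ᵇ-refl (a i)))
        ... | inj₁ ins with ∨-split {x ≡ᵇ i} ins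
        ...   | inj₁ x≡i = cong (_∨ touched i x) (trans (cong (λ z → a i ≡ᵇ a z) (≡ᵇ-true x≡i)) (≡ᵇ-refl (a i)))
        ...   | inj₂ tx = trans (cong ((a i ≡ᵇ a x) ∨_) tx) (Boolₚ.∨-zeroʳ _)
      opened : Built (part 0) (D i) (a i)
      opened = first prog
        where
        q≡ : ∀ x → x < n → part 0 x ≡ insert i (touched i) x
        q≡ x _ = Boolₚ.∨-identityʳ _
        first : Progress i → Built (part 0) (D i) (a i)
        -- The first cluster is not opened by `next`: `origin` has already committed to its center.
        first (inj₁ refl) = subst (λ d → Built (part 0) d (a 0)) (sym D₀)
          (build 0 i<n refl refl q≡ (part-heavy 0) (λ R → more R i<n)
            (0# , subst (λ S → Reach S 0 (a 0) 0#) (sym (mask-none n)) (origin (a< 0 i<n)) ,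
             ∑ᶠ-nonneg n λ _ _ → ≤ᶠ-refl))
          where
          D₀ : D 0 ≡ 0
          D₀ = n≤0⇒n≡0 (D≤ 0 z≤n)
        first (inj₂ (1≤D , c , built)) = subst (λ d → Built (part 0) d (a i)) (m+[n∸m]≡n 1≤D)
          (build i i<n ci refl q≡ (part-heavy 0)
            (λ R → next R (≤-trans (≤-reflexive (trans (cong suc (m+[n∸m]≡n 1≤D)) (sym D≡))) (D≤k (suc i))) (a< i i<n) i<n) built)
      filled : ∀ t → t ≤ n → Built (part t) (D i) (a i)
      filled zero _ = opened
      filled (suc t) t<n with part t t in pt | a t ≡ᵇ a i in at
      ... | false | true = build t t<n pt (≡ᵇ-true at) same (part-heavy (suc t)) (λ R → more R t<n) (filled t (<⇒≤ t<n))
        where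
        same : ∀ x → x < n → part (suc t) x ≡ insert t (part t) x
        same x _ with <-cmp x t
        ... | tri< x<t x≢t _ rewrite ≤ᵇ-true x<t | ≤ᵇ-true {suc x} {suc t} (m<n⇒m<1+n x<t) | ≢⇒≡ᵇ x≢t = refl
        ... | tri≈ _ refl _ rewrite ≤ᵇ-true (n<1+n x) | ≡ᵇ-refl x | at = Boolₚ.∨-zeroʳ _
        ... | tri> _ x≢t x>t rewrite ≤ᵇ-false (m<n⇒m<1+n x>t) | ≤ᵇ-false {suc x} {suc t} (s≤s x>t) | ≢⇒≡ᵇ x≢t = refl
      ... | true | _ = built-cong same (filled t (<⇒≤ t<n))
        where
        same : ∀ x → x < n → part t x ≡ part (suc t) x
        same x _ with <-cmp x t
        ... | tri< x<t _ _ rewrite ≤ᵇ-true x<t | ≤ᵇ-true {suc x} {suc t} (m<n⇒m<1+n x<t) = refl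
        ... | tri≈ _ refl _ = trans pt (sym (case ∨-split {insert i (touched i) x} pt of λ where
                (inj₁ old) → cong (_∨ ((suc x ≤ᵇ suc x) ∧ (a x ≡ᵇ a i))) old
                (inj₂ new) → ⊥-elim (false≢true (trans (sym (≤ᵇ-false (n<1+n x))) (proj₁ (∧-true {suc x ≤ᵇ x} new))))))
        ... | tri> _ _ x>t rewrite ≤ᵇ-false (m<n⇒m<1+n x>t) | ≤ᵇ-false {suc x} {suc t} (s≤s x>t) = refl
      ... | false | false = built-cong same (filled t (<⇒≤ t<n))
        where
        same : ∀ x → x < n → part t x ≡ part (suc t) x
        same x _ with <-cmp x t
        ... | tri< x<t _ _ rewrite ≤ᵇ-true x<t | ≤ᵇ-true {suc x} {suc t} (m<n⇒m<1+n x<t) = refl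
        ... | tri≈ _ refl _ rewrite at = cong (insert i (touched i) x ∨_) (trans (Boolₚ.∧-zeroʳ _) (sym (Boolₚ.∧-zeroʳ _)))
        ... | tri> _ _ x>t rewrite ≤ᵇ-false (m<n⇒m<1+n x>t) | ≤ᵇ-false {suc x} {suc t} (s≤s x>t) = refl
      complete : ∀ y → y < n → part n y ≡ touched (suc i) y
      complete y y<n rewrite ≤ᵇ-true y<n with y ≟ i
      ... | yes refl rewrite ≡ᵇ-refl y | ≡ᵇ-refl (a y) = refl
      ... | no y≢i rewrite ≢⇒≡ᵇ y≢i = trans (Boolₚ.∨-comm (touched i y) _) (cong (_∨ touched i y) (flip (a y) (a i)))
        where
        flip : ∀ x y → (x ≡ᵇ y) ≡ (y ≡ᵇ x)
        flip zero    zero    = refl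
        flip zero    (suc y) = refl
        flip (suc x) zero    = refl
        flip (suc x) (suc y) = flip x y

    chain : ∃[ S ] ∃[ c ] ∃[ v ] (Reach S (k ∸ 1) c v × (∀ x → x < n → x ∈ S) × v ≤ᶠ expense)
    chain = finish (climb n ≤-refl)
      where
      climb : ∀ i → i ≤ n → Progress i
      climb zero    _   = inj₁ refl
      climb (suc i) i<n = advance i i<n (climb i (<⇒≤ i<n))
      finish : Progress n → _
      finish (inj₁ n≡0) = ⊥-elim (<⇒≢ 1≤n (sym n≡0))
      finish (inj₂ (_ , c , v , R , v≤)) = mask n (touched n) , c , v ,
        subst (λ d → Reach (mask n (touched n)) (d ∸ 1) c v) D-full R ,
        (λ x x<n → trans (bit-mask n (touched n) x x<n) (covered-self n x x<n)) ,
        ≤ᶠ-trans v≤ (Sumᶠ≤.big-mono n λ y y<n → []-≤ (touched n y) (term≥0 y<n))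

-- The Hadamard code

infixr 5 _xor_
_xor_ : Bool → Bool → Bool
true  xor b = not b
false xor b = b

odd-suc : ∀ v → odd (suc v) ≡ not (odd v)
odd-suc v = trans (cong (odd ∘ suc) (sym (double-half v))) (trans (go (odd v)) (cong (not ∘ odd) (double-half v)))
  where
  h : ℕ
  h = ⌊ v /2⌋
  go : ∀ b → odd (suc (𝟙 b + (h + h))) ≡ not (odd (𝟙 b + (h + h)))
  go false = trans (odd-2* true h) (cong not (sym (odd-2* false h)))
  go true  = trans (trans (cong (odd ∘ suc) (sym (+-suc h h))) (odd-2* false (suc h))) (cong not (sym (odd-2* true h)))

odd-+ : ∀ b v → odd (𝟙 b + v) ≡ b xor odd v
odd-+ true  v = odd-suc v
odd-+ false v = refl

-- The scalar product over the field with two elements of the L lowest bits of M and x, in the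
-- recursive form that suits the induction in `hadamard`.
inner : ℕ → ℕ → ℕ → Bool
inner zero    M x = false
inner (suc L) M x = (odd M ∧ odd x) xor inner L ⌊ M /2⌋ ⌊ x /2⌋

inner-count : ∀ L M x → odd (count L λ b → bit b M ∧ bit b x) ≡ inner L M x
inner-count zero    M x = refl
inner-count (suc L) M x = trans
  (cong odd (trans (count-∑ (suc L) p) (trans (Sumℕ.big-head L (𝟙 ∘ p)) (cong (𝟙 (p 0) +_) (sym (count-∑ L (p ∘ suc)))))))
  (trans (odd-+ (p 0) (count L (p ∘ suc))) (cong (p 0 xor_)
    (trans (cong odd (count-cong L λ b _ → cong₂ _∧_ (cong odd (shift-half b M)) (cong odd (shift-half b x))))
           (inner-count L ⌊ M /2⌋ ⌊ x /2⌋))))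
  where
  p : ℕ → Bool
  p b = bit b M ∧ bit b x

inner-0 : ∀ L x → inner L 0 x ≡ false
inner-0 zero    x = refl
inner-0 (suc L) x = inner-0 L ⌊ x /2⌋

inner-high : ∀ L d M x → M < 2 ^ L → inner (L + d) M x ≡ inner L M x
inner-high zero    d zero x _ = inner-0 d x
inner-high zero    d (suc M) x (s≤s ())
inner-high (suc L) d M x M< = cong ((odd M ∧ odd x) xor_) (inner-high L d ⌊ M /2⌋ ⌊ x /2⌋ (half-< L M<))

-- M is extended by a new lowest bit. If x and y agree in their lowest bit, it cancels and the count
-- for the halves, which then differ, is doubled. If they disagree, the new bit flips the
-- comparison, so exactly one of the two extensions of each M tells x and y apart.
hadamard : ∀ L x y → x < 2 ^ L → y < 2 ^ L → x ≢ y →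
  ∑ (2 ^ L) (λ M → 𝟙 (inner L M x xor inner L M y)) + ∑ (2 ^ L) (λ M → 𝟙 (inner L M x xor inner L M y)) ≡ 2 ^ L
hadamard zero zero zero _ _ x≢y = ⊥-elim (x≢y refl)
hadamard zero zero (suc y) _ (s≤s ()) x≢y
hadamard zero (suc x) y (s≤s ()) _ x≢y
hadamard (suc L) x y x< y< x≢y = trans (cong (λ z → z + z) sum≡) (split (odd x) (odd y) refl refl)
  where
  N : ℕ
  N = 2 ^ L
  x′ y′ : ℕ
  x′ = ⌊ x /2⌋
  y′ = ⌊ y /2⌋
  d : ℕ → Bool
  d M = inner L M x′ xor inner L M y′
  both : Bool → Bool → ℕ → ℕ
  both p q M = 𝟙 (d M) + 𝟙 ((p xor inner L M x′) xor (q xor inner L M y′))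
  at : ∀ c M z → inner (suc L) (𝟙 c + (M + M)) z ≡ (c ∧ odd z) xor inner L M ⌊ z /2⌋
  at c M z = cong₂ (λ p q → (p ∧ odd z) xor inner L q ⌊ z /2⌋) (odd-2* c M) (half-2* c M)
  sum≡ : ∑ (2 ^ suc L) (λ M → 𝟙 (inner (suc L) M x xor inner (suc L) M y)) ≡ ∑ N (both (odd x) (odd y))
  sum≡ = trans (cong (λ z → ∑ (N + z) (λ M → 𝟙 (inner (suc L) M x xor inner (suc L) M y))) (+-identityʳ N))
    (trans (∑-double N _) (Sumℕ.big-cong N λ M _ → cong₂ _+_
      (cong₂ (λ p q → 𝟙 (p xor q)) (at false M x) (at false M y))
      (cong₂ (λ p q → 𝟙 (p xor q)) (at true M x) (at true M y))))
  same : x′ ≢ y′ → ∀ p → ∑ N (both p p) + ∑ N (both p p) ≡ 2 ^ suc L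
  same x′≢y′ p = trans (cong (λ z → z + z) (trans (Sumℕ.big-cong N λ M _ → cong (λ b → 𝟙 (d M) + 𝟙 b) (twice p (inner L M x′) (inner L M y′)))
      (trans (Sumℕ.big-∙ N _ _) (hadamard L x′ y′ (half-< L x<) (half-< L y<) x′≢y′))))
    (cong (N +_) (sym (+-identityʳ N)))
    where
    twice : ∀ p q r → (p xor q) xor (p xor r) ≡ q xor r
    twice false q     r     = refl
    twice true  true  r     = refl
    twice true  false true  = refl
    twice true  false false = refl
  opposite : ∀ p q → p xor q ≡ true → ∑ N (both p q) + ∑ N (both p q) ≡ 2 ^ suc L
  opposite p q pq = trans (cong (λ z → z + z) (trans (Sumℕ.big-cong N λ M _ → one (inner L M x′) (inner L M y′) p q pq)
    (∑-ones N))) (cong (N +_) (sym (+-identityʳ N)))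
    where
    ∑-ones : ∀ m → ∑ m (λ _ → 1) ≡ m
    ∑-ones m = trans (∑-const m 1) (*-identityʳ m)
    one : ∀ u v p q → p xor q ≡ true → 𝟙 (u xor v) + 𝟙 ((p xor u) xor (q xor v)) ≡ 1
    one true  true  true  false _ = refl
    one true  true  false true  _ = refl
    one true  false true  false _ = refl
    one true  false false true  _ = refl
    one false true  true  false _ = refl
    one false true  false true  _ = refl
    one false false true  false _ = refl
    one false false false true  _ = refl
  split : ∀ p q → odd x ≡ p → odd y ≡ q → ∑ N (both (odd x) (odd y)) + ∑ N (both (odd x) (odd y)) ≡ 2 ^ suc L
  split p q ox oy rewrite ox | oy with p Boolₚ.≟ q
  ... | yes refl = same (λ x′≡y′ → x≢y (trans (sym (double-half x)) (trans (cong₂ (λ b h → 𝟙 b + (h + h)) (trans ox (sym oy)) x′≡y′) (double-half y)))) p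
  ... | no p≢q = opposite p q (differ p q p≢q)
    where
    differ : ∀ p q → p ≢ q → p xor q ≡ true
    differ true  true  p≢q = ⊥-elim (p≢q refl)
    differ true  false _   = refl
    differ false true  _   = refl
    differ false false p≢q = ⊥-elim (p≢q refl)

∑-exists : ∀ N f m → N * m ≤ ∑ N f → 1 ≤ N → ∃[ i ] (i < N × m ≤ f i)
∑-exists (suc N) f m le _ with m ≤? f N
... | yes m≤ = N , n<1+n N , m≤
... | no m≰ with N
...   | zero = ⊥-elim (m≰ (≤-trans (m≤m+n m 0) le))
...   | suc N′ with ∑-exists (suc N′) f m (+-cancelʳ-≤ m _ _ (≤-trans (≤-reflexive (+-comm (suc N′ * m) m))
                (≤-trans le (+-monoʳ-≤ (∑ (suc N′) f) (<⇒≤ (≰⇒> m≰)))))) (s≤s z≤n)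
...     | i , i< , m≤ = i , m<n⇒m<1+n i< , m≤

-- The length of the code: n ≤ 2 ^ L gives all points different codes, and 2 ^ L < n + n keeps the
-- number of words linear.
log-between : ∀ n → 1 ≤ n → ∃[ L ] (n ≤ 2 ^ L × 2 ^ L < n + n)
log-between (suc zero) _ = 0 , ≤-refl , s≤s (s≤s z≤n)
log-between (suc (suc m)) _ with log-between (suc m) (s≤s z≤n)
... | L , ge , lt with suc (suc m) ≤? 2 ^ L
...   | yes ge′ = L , ge′ , ≤-trans lt (+-mono-≤ (n≤1+n (suc m)) (n≤1+n (suc m)))
...   | no ¬ge = suc L , ≤-trans (s≤s (s≤s (m≤n+m m m))) (≤-reflexive (sym eq)) ,
        ≤-trans (s≤s (≤-reflexive eq)) (s≤s (s≤s (≤-trans (≤-reflexive (sym (+-suc m m))) (+-monoʳ-≤ m (n≤1+n (suc m))))))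
  where
  pow≡ : 2 ^ L ≡ suc m
  pow≡ = ≤-antisym (≤-pred (≰⇒> ¬ge)) ge
  eq : 2 ^ suc L ≡ suc (suc (m + m))
  eq = trans (cong (λ z → z + (z + 0)) pow≡) (cong suc (trans (cong (m +_) (cong suc (+-identityʳ m))) (+-suc m m)))

count-not : ∀ n p → count n p + count n (not ∘ p) ≡ n
count-not zero    p = refl
count-not (suc n) p with p n
... | true  = cong suc (count-not n p)
... | false = trans (+-suc _ _) (cong suc (count-not n p))

count-≤-+ : ∀ n {p q r : ℕ → Bool} → (∀ c → c < n → 𝟙 (p c) ≤ 𝟙 (q c) + 𝟙 (r c)) → count n p ≤ count n q + count n r
count-≤-+ n {p} {q} {r} le = ≤-trans (≤-reflexive (count-∑ n p)) (≤-trans (Sum≤.big-mono n le)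
  (≤-reflexive (trans (Sumℕ.big-∙ n (𝟙 ∘ q) (𝟙 ∘ r)) (sym (cong₂ _+_ (count-∑ n q) (count-∑ n r))))))

-- A certificate by linear combination: 24 times 3 t ≤ R + P, 6 times 2 t ≤ R, and 5 times 6 R + 9 i
-- ≤ 4 n, which is the wildness in terms of the untouched points R. The remaining 39 i is absorbed
-- by 10 i < n.
linear : ∀ {n i U R g t P X} → 2 * n + 9 * i < 6 * U → U + R ≡ n → g ≤ t + i → 3 * t ≤ R + P → 2 * t ≤ R →
  10 * i < n → P ≤ X + X → 7 * g ≤ 2 * n + 4 * X
linear {n} {i} {U} {R} {g} {t} {P} {X} big refl g≤ 3t≤ 2t≤ 10i<n P≤ = *-cancelˡ-≤ 12 (begin
  12 * (7 * g)                                  ≤⟨ *-monoʳ-≤ 12 (*-monoʳ-≤ 7 g≤) ⟩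
  12 * (7 * (t + i))                            ≡⟨ r₁ t i ⟩
  24 * (3 * t) + 6 * (2 * t) + 84 * i           ≤⟨ +-monoˡ-≤ (84 * i) (+-mono-≤ (*-monoʳ-≤ 24 (≤-trans 3t≤ (+-monoʳ-≤ R P≤))) (*-monoʳ-≤ 6 2t≤)) ⟩
  24 * (R + (X + X)) + 6 * R + 84 * i           ≡⟨ r₂ R X i ⟩
  5 * (6 * R + 9 * i) + 39 * i + 48 * X         ≤⟨ +-monoˡ-≤ (48 * X) (+-mono-≤ (*-monoʳ-≤ 5 small) 39i≤) ⟩
  5 * (4 * n) + 4 * n + 48 * X                  ≡⟨ r₃ n X ⟩
  12 * (2 * n + 4 * X)                          ∎)
  where
  open ≤-Reasoning
  r₁ : ∀ t i → 12 * (7 * (t + i)) ≡ 24 * (3 * t) + 6 * (2 * t) + 84 * i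
  r₁ = solve-∀
  r₂ : ∀ R X i → 24 * (R + (X + X)) + 6 * R + 84 * i ≡ 5 * (6 * R + 9 * i) + 39 * i + 48 * X
  r₂ = solve-∀
  r₃ : ∀ n X → 5 * (4 * n) + 4 * n + 48 * X ≡ 12 * (2 * n + 4 * X)
  r₃ = solve-∀
  r₄ : ∀ U R i → 2 * (U + R) + (6 * R + 9 * i) ≡ 2 * (U + R) + 9 * i + 6 * R
  r₄ = solve-∀
  r₅ : ∀ U R → 6 * U + 6 * R ≡ 2 * (U + R) + 4 * (U + R)
  r₅ = solve-∀
  small : 6 * R + 9 * i ≤ 4 * n
  small = +-cancelˡ-≤ (2 * n) _ _ (≤-trans (≤-reflexive (r₄ U R i)) (≤-trans (+-monoˡ-≤ (6 * R) (<⇒≤ big)) (≤-reflexive (r₅ U R))))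
  39i≤ : 39 * i ≤ 4 * n
  39i≤ = ≤-trans (*-monoˡ-≤ i (≤ᵇ⇒≤ 39 40 tt)) (≤-trans (≤-reflexive (*-assoc 4 10 i)) (*-monoʳ-≤ 4 (<⇒≤ 10i<n)))

*-square-cancel : ∀ {x u v} → x * x ≤ u * v → x ≤ u ⊎ x ≤ v
*-square-cancel {x} {u} {v} le with x ≤? u | x ≤? v
... | yes x≤u | _       = inj₁ x≤u
... | no _    | yes x≤v = inj₂ x≤v
... | no x≰u  | no x≰v  = ⊥-elim (<⇒≱ (*-mono-< (≰⇒> x≰u) (≰⇒> x≰v)) le)

-- The case distinction on the number of clusters

module Cases {F : OrderedField 0ℓ 0ℓ 0ℓ} {I : Instance F} (A : Grouping I) where
  open Grouping A
  open Clusters A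
  open Chains A
  open Instance I
  open Ordered F
  open Properties I
  open Choosing I
  open Heavy I
  open Costs I

  -- No pair is crossed here, so `mT` is the set of centers of the g clusters with at least two
  -- points, of weight 504 ^ n / 2 ^ g. The constants leave hardly any slack: 2 * 400 ^ 3 =
  -- 128000000 and 504 ^ 3 = 128024064.
  few-clusters : 3 * g ≤ n → ∃[ S ] (Reached S × size S ≤ k × score S ≤ᶠ expense)
  few-clusters 3g≤n = mT , descend (λ x → suc x ≤ᵇ 0) 756 252 (λ _ _ → ≤ᵇ⇒≤ 252 504 tt)
      (λ S ge → 0 , 0 , 1≤n , 1≤n , inj₁ ge) Tᵖ enough , T-size , score-T
    where
    open Transversal (λ _ → false) (λ _ → false) (λ _ _ ())
    count-T : count n Tᵖ ≡ g
    count-T = count-cong n λ x _ → same x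
      where
      same : ∀ x → Tᵖ x ≡ multi x
      same x with fixed x in fx
      ... | true  = cong (λ z → 2 ≤ᵇ csize z) (≡ᵇ-true fx)
      ... | false = refl
    w : ℕ
    w = weight (λ x → suc x ≤ᵇ 0) 756 252 mT
    value : w * 2 ^ g ≡ 504 ^ n
    value = begin
      w * 2 ^ g                                          ≡⟨ cong₂ _*_ (weight-∏ (λ x → suc x ≤ᵇ 0) 756 252 mT)
                                                              (trans (cong (2 ^_) (sym count-T)) (sym (∏-if n Tᵖ 2))) ⟩
      ∏ n (factor (λ x → suc x ≤ᵇ 0) 756 252 mT) * ∏ n (λ x → if Tᵖ x then 2 else 1)
                                                         ≡⟨ ∏-*ˡ n _ _ ⟩
      ∏ n (λ x → factor (λ x → suc x ≤ᵇ 0) 756 252 mT x * (if Tᵖ x then 2 else 1))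
                                                         ≡⟨ Prodℕ.big-cong n pointwise ⟩
      ∏ n (λ _ → 504)                                    ≡⟨ ∏-const n 504 ⟩
      504 ^ n                                            ∎
      where
      open ≡-Reasoning
      pointwise : ∀ x → x < n → factor (λ x → suc x ≤ᵇ 0) 756 252 mT x * (if Tᵖ x then 2 else 1) ≡ 504
      pointwise x x<n rewrite bit-mask n Tᵖ x x<n with Tᵖ x
      ... | true  = refl
      ... | false = refl
    enough : 400 ^ n ≤ w
    enough = *-cancelʳ-≤ _ _ (2 ^ g) {{m^n≢0 2 g}} (≤-trans (^-cancel-≤ 3 (begin
      (400 ^ n * 2 ^ g) ^ 3            ≡⟨ ^-distribʳ-* (400 ^ n) (2 ^ g) 3 ⟩
      (400 ^ n) ^ 3 * (2 ^ g) ^ 3      ≡⟨ cong₂ _*_ (^-swap 400 n 3) (trans (^-*-assoc 2 g 3) (cong (2 ^_) (*-comm g 3))) ⟩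
      (400 ^ 3) ^ n * 2 ^ (3 * g)      ≤⟨ *-monoʳ-≤ ((400 ^ 3) ^ n) (^-monoʳ-≤ 2 3g≤n) ⟩
      (400 ^ 3) ^ n * 2 ^ n            ≡⟨ ^-distribʳ-* (400 ^ 3) 2 n ⟨
      (400 ^ 3 * 2) ^ n                ≤⟨ ^-monoˡ-≤ n (≤ᵇ⇒≤ (400 ^ 3 * 2) (504 ^ 3) tt) ⟩
      (504 ^ 3) ^ n                    ≡⟨ ^-swap 504 n 3 ⟨
      (504 ^ n) ^ 3                    ∎)) (≤-reflexive (sym value)))
      where open ≤-Reasoning

  P : ℕ
  P = count n paired

  -- Some early prefix touches clusters with too many points: then almost all of the
  -- other clusters are pairs.
  module ManyPairs (i : ℕ) (i≤n : i ≤ n) (10i<n : 10 * i < n) (wild : 2 * n + 9 * i < 6 * U i) where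

    R : ℕ
    R = count n λ y → not (touched i y)

    untouched : ℕ → Bool
    untouched c = multi c ∧ not (covered i c)

    t : ℕ
    t = count n untouched

    R-sum : R ≡ ∑ n λ c → if not (covered i c) then csize c else 0
    R-sum = double-count λ c → not (covered i c)

    g≤ : g ≤ t + i
    g≤ = ≤-trans (count-≤-+ n {multi} {untouched} {λ c → fixed c ∧ covered i c} pointwise) (+-monoʳ-≤ t (D≤ i i≤n))
      where
      pointwise : ∀ c → c < n → 𝟙 (multi c) ≤ 𝟙 (untouched c) + 𝟙 (fixed c ∧ covered i c)
      pointwise c _ with fixed c | 2 ≤ᵇ csize c | covered i c
      ... | true  | true  | true  = ≤-refl
      ... | true  | true  | false = ≤-refl
      ... | true  | false | _     = z≤n
      ... | false | _     | _     = z≤n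

    2t≤ : 2 * t ≤ R
    2t≤ = ≤-trans (≤-reflexive (trans (cong (2 *_) (count-∑ n untouched)) (sym (∑-*ˡ n 2 (𝟙 ∘ untouched)))))
      (≤-trans (Sum≤.big-mono n pointwise) (≤-reflexive (sym R-sum)))
      where
      pointwise : ∀ c → c < n → 2 * 𝟙 (untouched c) ≤ (if not (covered i c) then csize c else 0)
      pointwise c _ with fixed c | 2 ≤ᵇ csize c in 2≤ | covered i c
      ... | true  | true  | true  = ≤-refl
      ... | true  | true  | false = true⇒≤ 2≤
      ... | true  | false | _     = z≤n
      ... | false | _     | _     = z≤n

    -- Every untouched cluster counted by t has three untouched points, or is a pair and takes the
    -- missing unit from P.
    3t≤ : 3 * t ≤ R + P
    3t≤ = ≤-trans (≤-reflexive (trans (cong (3 *_) (count-∑ n untouched)) (sym (∑-*ˡ n 3 (𝟙 ∘ untouched)))))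
      (≤-trans (Sum≤.big-mono n pointwise) (≤-reflexive (trans (Sumℕ.big-∙ n _ (𝟙 ∘ paired))
        (sym (cong₂ _+_ R-sum (count-∑ n paired))))))
      where
      three : ∀ s → 2 ≤ s → 3 ≤ s + 𝟙 (s ≡ᵇ 2)
      three (suc zero) (s≤s ())
      three (suc (suc zero)) _ = ≤-refl
      three (suc (suc (suc s))) _ = s≤s (s≤s (s≤s z≤n))
      pointwise : ∀ c → c < n → 3 * 𝟙 (untouched c) ≤ (if not (covered i c) then csize c else 0) + 𝟙 (paired c)
      pointwise c _ with fixed c | 2 ≤ᵇ csize c in 2≤ | covered i c
      ... | true  | true  | true  = z≤n
      ... | true  | true  | false = three (csize c) (true⇒≤ 2≤)
      ... | true  | false | _     = z≤n
      ... | false | _     | _     = z≤n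

    many : ∀ X → P ≤ X + X → 7 * g ≤ 2 * n + 4 * X
    many X P≤ = linear {n} {i} {U i} {R} {g} {t} {P} {X} wild (count-not n (touched i)) g≤ 3t≤ 2t≤ 10i<n P≤

  paired⇒ : ∀ {c} → paired c ≡ true → a c ≡ c × csize c ≡ 2
  paired⇒ {c} pc = ≡ᵇ-true (proj₁ (∧-true {fixed c} pc)) , ≡ᵇ-true (proj₂ (∧-true {fixed c} pc))

  module Coloring (L : ℕ) (n≤2^L : n ≤ 2 ^ L) (2^L<2n : 2 ^ L < n + n) (4≤n : 4 ≤ n) where

    crossed : ℕ → ℕ → Bool
    crossed M c = paired c ∧ (inner L M c xor inner L M (partner c))

    X : ℕ → ℕ
    X M = count n (crossed M)

    -- By averaging over all words: each pair is split by exactly half of them, so the mean of `X M`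
    -- is P / 2.
    half-cross : ∃[ M ] (M < 2 ^ L × P ≤ X M + X M)
    half-cross = ∑-exists (2 ^ L) (λ M → X M + X M) P (≤-reflexive (sym average)) (m^n>0 2 L)
      where
      open ≡-Reasoning
      N : ℕ
      N = 2 ^ L
      column : ∀ c → c < n → ∑ N (λ M → 𝟙 (crossed M c)) + ∑ N (λ M → 𝟙 (crossed M c)) ≡ N * 𝟙 (paired c)
      column c c<n with paired c in pc
      ... | false = trans (cong (λ z → z + z) (trans (∑-const N 0) (*-zeroʳ N))) (sym (*-zeroʳ N))
      ... | true  = trans (hadamard L c (partner c) (≤-trans c<n n≤2^L) (≤-trans b<n n≤2^L) (b≢c ∘ sym)) (sym (*-identityʳ N))
        where open Partner (partner-works c<n pc)
      average : ∑ N (λ M → X M + X M) ≡ N * P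
      average = begin
        ∑ N (λ M → X M + X M)                                     ≡⟨ Sumℕ.big-∙ N X X ⟩
        ∑ N X + ∑ N X                                             ≡⟨ cong (λ z → z + z) (trans (Sumℕ.big-cong N λ M _ → count-∑ n (crossed M))
                                                                       (Sumℕ.big-swap N n λ M c → 𝟙 (crossed M c))) ⟩
        ∑ n (λ c → ∑ N λ M → 𝟙 (crossed M c)) + ∑ n (λ c → ∑ N λ M → 𝟙 (crossed M c))
                                                                  ≡⟨ Sumℕ.big-∙ n _ _ ⟨
        ∑ n (λ c → ∑ N (λ M → 𝟙 (crossed M c)) + ∑ N (λ M → 𝟙 (crossed M c)))
                                                                  ≡⟨ Sumℕ.big-cong n column ⟩
        ∑ n (λ c → N * 𝟙 (paired c))                              ≡⟨ ∑-*ˡ n N (𝟙 ∘ paired) ⟩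
        N * ∑ n (𝟙 ∘ paired)                                      ≡⟨ cong (N *_) (count-∑ n paired) ⟨
        N * P                                                     ∎

    module Pick (M : ℕ) (M<N : M < 2 ^ L) (enough : 7 * g ≤ 2 * n + 4 * X M) where

      color : Bool → ℕ → Bool
      color σ x = σ xor inner L M x

      cross-color : ∀ σ c → c < n → crossed M c ≡ true → paired c ≡ true × color σ (partner c) ≡ not (color σ c)
      cross-color σ c c<n cr with ∧-true {paired c} cr
      ... | pc , differ = pc , flip σ (inner L M c) (inner L M (partner c)) differ
        where
        flip : ∀ σ p q → p xor q ≡ true → σ xor q ≡ not (σ xor p)
        flip true  true  false _ = refl
        flip true  false true  _ = refl
        flip false true  false _ = refl
        flip false false true  _ = refl

      module Tr (σ : Bool) = Transversal (crossed M) (color σ) (cross-color σ)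

      fac : Bool → ℕ → ℕ
      fac σ x = if Tr.Tᵖ σ x then (if color σ x then 324 else 189) else (if color σ x then 432 else 567)

      cr plain : ℕ → Bool
      cr x = crossed M (a x)
      plain x = not (cr x) ∧ (fixed x ∧ (2 ≤ᵇ csize (a x)))

      Y : ℕ
      Y = X M

      count-cr : count n cr ≡ Y + Y
      count-cr = trans (double-count (crossed M)) (trans (Sumℕ.big-cong n λ c _ → two c)
        (trans (Sumℕ.big-∙ n (𝟙 ∘ crossed M) (𝟙 ∘ crossed M)) (sym (cong₂ _+_ (count-∑ n (crossed M)) (count-∑ n (crossed M))))))
        where
        two : ∀ c → (if crossed M c then csize c else 0) ≡ 𝟙 (crossed M c) + 𝟙 (crossed M c)
        two c with crossed M c in cc
        ... | true  = proj₂ (paired⇒ (proj₁ (∧-true {paired c} cc)))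
        ... | false = refl

      count-plain : count n plain + Y ≡ g
      count-plain = trans (cong₂ _+_ (count-∑ n plain) (count-∑ n (crossed M))) (trans (sym (Sumℕ.big-∙ n (𝟙 ∘ plain) (𝟙 ∘ crossed M)))
        (trans (Sumℕ.big-cong n λ c _ → each c) (sym (count-∑ n multi))))
        where
        each : ∀ c → 𝟙 (plain c) + 𝟙 (crossed M c) ≡ 𝟙 (multi c)
        each c with a c ≟ c
        ... | no ac≢c rewrite ≢⇒≡ᵇ ac≢c = trans (+-identityʳ _) (cong 𝟙 (Boolₚ.∧-zeroʳ (not (crossed M (a c)))))
        ... | yes ac≡c = trans (cong (λ z → 𝟙 (not (crossed M z) ∧ (fixed c ∧ (2 ≤ᵇ csize z))) + 𝟙 (crossed M c)) ac≡c) (go (crossed M c) refl)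
          where
          go : ∀ b → crossed M c ≡ b → 𝟙 (not b ∧ multi c) + 𝟙 b ≡ 𝟙 (multi c)
          go false _ = +-identityʳ _
          go true cc = sym (cong 𝟙 (cong₂ _∧_ (proj₁ (∧-true {fixed c} (proj₁ (∧-true {paired c} cc))))
            (≤ᵇ-true (≤-reflexive (sym (proj₂ (paired⇒ (proj₁ (∧-true {paired c} cc)))))))))

      w : Bool → ℕ
      w σ = ∏ n (fac σ)

      -- In an uncrossed cluster, the center contributes 324 * 189 if the cluster has at least two
      -- points, and every other point 432 * 567 = 244944 = 4 * (324 * 189); a singleton also
      -- contributes 244944. A point of a crossing pair is in exactly one of the two sets, namely
      -- where its factor is 324, and contributes 324 * 567, which is 3 / 4 of 244944. The power of
      -- 4 clears the denominators.
      product : w false * w true * 4 ^ (Y + g) ≡ 244944 ^ n * 3 ^ (Y + Y)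
      product = begin
        w false * w true * 4 ^ (Y + g)                          ≡⟨ cong (λ z → w false * w true * 4 ^ z) (exponent (count n plain) Y g count-plain) ⟩
        w false * w true * 4 ^ ((Y + Y) + count n plain)        ≡⟨ cong (λ z → w false * w true * 4 ^ (z + count n plain)) count-cr ⟨
        w false * w true * 4 ^ (count n cr + count n plain)     ≡⟨ cong (w false * w true *_) (trans (^-distribˡ-+-* 4 (count n cr) (count n plain))
                                                                     (cong₂ _*_ (sym (∏-if n cr 4)) (sym (∏-if n plain 4)))) ⟩
        w false * w true * (∏ n (λ x → if cr x then 4 else 1) * ∏ n (λ x → if plain x then 4 else 1))
          ≡⟨ cong₂ _*_ (∏-*ˡ n (fac false) (fac true)) (∏-*ˡ n _ _) ⟩
        ∏ n (λ x → fac false x * fac true x) * ∏ n (λ x → (if cr x then 4 else 1) * (if plain x then 4 else 1))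
          ≡⟨ ∏-*ˡ n _ _ ⟩
        ∏ n (λ x → fac false x * fac true x * ((if cr x then 4 else 1) * (if plain x then 4 else 1)))
          ≡⟨ Prodℕ.big-cong n pointwise ⟩
        ∏ n (λ x → (if cr x then 3 else 1) * 244944)            ≡⟨ Prodℕ.big-∙ n _ (λ _ → 244944) ⟩
        ∏ n (λ x → if cr x then 3 else 1) * ∏ n (λ _ → 244944)  ≡⟨ *-comm (∏ n (λ x → if cr x then 3 else 1)) _ ⟩
        ∏ n (λ _ → 244944) * ∏ n (λ x → if cr x then 3 else 1)  ≡⟨ cong₂ _*_ (∏-const n 244944) (trans (∏-if n cr 3) (cong (3 ^_) count-cr)) ⟩
        244944 ^ n * 3 ^ (Y + Y)                                ∎
        where
        open ≡-Reasoning
        exponent : ∀ p Y g → p + Y ≡ g → Y + g ≡ Y + Y + p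
        exponent p Y .(p + Y) refl = ex p Y
          where
          ex : ∀ p Y → Y + (p + Y) ≡ Y + Y + p
          ex = solve-∀
        pointwise : ∀ x → x < n → fac false x * fac true x * ((if cr x then 4 else 1) * (if plain x then 4 else 1)) ≡
          (if cr x then 3 else 1) * 244944
        pointwise x x<n with crossed M (a x) in cc
        ... | false with fixed x ∧ (2 ≤ᵇ csize (a x))
        ...   | true with inner L M x
        ...     | true  = refl
        ...     | false = refl
        pointwise x x<n | false | false with inner L M x
        ...     | true  = refl
        ...     | false = refl
        pointwise x x<n | true rewrite proj₂ (paired⇒ {a x} (proj₁ (∧-true {paired (a x)} cc))) with inner L M x
        ...   | true  = refl
        ...   | false = refl

      -- After `product`, squaring clears the remaining halves. Since 244944 / 160000 exceeds 3 / 2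
      -- (480000 ≤ 489888), it suffices that 2 ^ (4 g) is at most (3 / 2) to the power 2 n + 4 Y.
      -- This exponent is at least 7 g, and 2 ^ 4 < (3 / 2) ^ 7 because 2 ^ 11 = 2048 < 2187 = 3 ^
      -- 7.
      large : 400 ^ n * 400 ^ n ≤ w false * w true
      large = *-cancelʳ-≤ _ _ (4 ^ (Y + g)) {{m^n≢0 4 (Y + g)}} (≤-trans (^-cancel-≤ 2 (*-cancelʳ-≤ _ _ (3 ^ (2 * n)) {{m^n≢0 3 (2 * n)}} (begin
        (400 ^ n * 400 ^ n * 4 ^ (Y + g)) ^ 2 * 3 ^ (2 * n)   ≡⟨ cong (_* 3 ^ (2 * n)) (^-distribʳ-* (400 ^ n * 400 ^ n) (4 ^ (Y + g)) 2) ⟩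
        (400 ^ n * 400 ^ n) ^ 2 * (4 ^ (Y + g)) ^ 2 * 3 ^ (2 * n)
          ≡⟨ cong₂ (λ x y → x ^ 2 * y * 3 ^ (2 * n)) (sym (^-distribʳ-* 400 400 n)) (trans (^-*-assoc 4 (Y + g) 2) (^-*-assoc 2 2 ((Y + g) * 2))) ⟩
        (160000 ^ n) ^ 2 * 2 ^ (2 * ((Y + g) * 2)) * 3 ^ (2 * n)
          ≡⟨ cong₂ (λ x y → x * 2 ^ (2 * ((Y + g) * 2)) * y) (trans (^-*-assoc 160000 n 2) (cong (160000 ^_) (*-comm n 2))) refl ⟩
        160000 ^ (2 * n) * 2 ^ (2 * ((Y + g) * 2)) * 3 ^ (2 * n)
          ≡⟨ rearrange (160000 ^ (2 * n)) (2 ^ (2 * ((Y + g) * 2))) (3 ^ (2 * n)) ⟩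
        160000 ^ (2 * n) * 3 ^ (2 * n) * 2 ^ (2 * ((Y + g) * 2))
          ≡⟨ cong (_* 2 ^ (2 * ((Y + g) * 2))) (^-distribʳ-* 160000 3 (2 * n)) ⟨
        480000 ^ (2 * n) * 2 ^ (2 * ((Y + g) * 2))
          ≤⟨ *-monoˡ-≤ _ (^-monoˡ-≤ (2 * n) (≤ᵇ⇒≤ 480000 489888 tt)) ⟩
        489888 ^ (2 * n) * 2 ^ (2 * ((Y + g) * 2))
          ≡⟨ cong (_* 2 ^ (2 * ((Y + g) * 2))) (^-distribʳ-* 244944 2 (2 * n)) ⟩
        244944 ^ (2 * n) * 2 ^ (2 * n) * 2 ^ (2 * ((Y + g) * 2))
          ≡⟨ *-assoc (244944 ^ (2 * n)) _ _ ⟩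
        244944 ^ (2 * n) * (2 ^ (2 * n) * 2 ^ (2 * ((Y + g) * 2)))
          ≡⟨ cong (244944 ^ (2 * n) *_) (trans (sym (^-distribˡ-+-* 2 (2 * n) (2 * ((Y + g) * 2)))) (cong (2 ^_) (exps n Y g))) ⟩
        244944 ^ (2 * n) * 2 ^ ((2 * n + 4 * Y) + 4 * g)
          ≤⟨ *-monoʳ-≤ (244944 ^ (2 * n)) (powers (2 * n + 4 * Y) g enough) ⟩
        244944 ^ (2 * n) * 3 ^ (2 * n + 4 * Y)
          ≡⟨ cong₂ _*_ (trans (cong (244944 ^_) (*-comm 2 n)) (sym (^-*-assoc 244944 n 2))) (^-distribˡ-+-* 3 (2 * n) (4 * Y)) ⟩
        (244944 ^ n) ^ 2 * (3 ^ (2 * n) * 3 ^ (4 * Y))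
          ≡⟨ cong (λ z → (244944 ^ n) ^ 2 * (3 ^ (2 * n) * z)) (trans (cong (3 ^_) (four Y)) (sym (^-*-assoc 3 (Y + Y) 2))) ⟩
        (244944 ^ n) ^ 2 * (3 ^ (2 * n) * (3 ^ (Y + Y)) ^ 2)
          ≡⟨ rearrange′ ((244944 ^ n) ^ 2) (3 ^ (2 * n)) ((3 ^ (Y + Y)) ^ 2) ⟩
        (244944 ^ n) ^ 2 * (3 ^ (Y + Y)) ^ 2 * 3 ^ (2 * n)
          ≡⟨ cong (_* 3 ^ (2 * n)) (^-distribʳ-* (244944 ^ n) (3 ^ (Y + Y)) 2) ⟨
        (244944 ^ n * 3 ^ (Y + Y)) ^ 2 * 3 ^ (2 * n) ∎))) (≤-reflexive (sym product)))
        where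
        open ≤-Reasoning
        rearrange : ∀ x y z → x * y * z ≡ x * z * y
        rearrange = solve-∀
        rearrange′ : ∀ x y z → x * (y * z) ≡ x * z * y
        rearrange′ = solve-∀
        exps : ∀ n Y g → 2 * n + 2 * ((Y + g) * 2) ≡ (2 * n + 4 * Y) + 4 * g
        exps = solve-∀
        four : ∀ Y → 4 * Y ≡ (Y + Y) * 2
        four = solve-∀
        powers : ∀ m g → 7 * g ≤ m → 2 ^ (m + 4 * g) ≤ 3 ^ m
        powers m g 7g≤m = begin
          2 ^ (m + 4 * g)                        ≡⟨ cong (λ z → 2 ^ (z + 4 * g)) (m+[n∸m]≡n 7g≤m) ⟨
          2 ^ (7 * g + e + 4 * g)                ≡⟨ cong (2 ^_) (regroup g e) ⟩
          2 ^ (11 * g + e)                       ≡⟨ ^-distribˡ-+-* 2 (11 * g) e ⟩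
          2 ^ (11 * g) * 2 ^ e                   ≡⟨ cong (_* 2 ^ e) (^-*-assoc 2 11 g) ⟨
          (2 ^ 11) ^ g * 2 ^ e                   ≤⟨ *-mono-≤ (^-monoˡ-≤ g (≤ᵇ⇒≤ (2 ^ 11) (3 ^ 7) tt)) (^-monoˡ-≤ e (≤ᵇ⇒≤ 2 3 tt)) ⟩
          (3 ^ 7) ^ g * 3 ^ e                    ≡⟨ cong (_* 3 ^ e) (^-*-assoc 3 7 g) ⟩
          3 ^ (7 * g) * 3 ^ e                    ≡⟨ ^-distribˡ-+-* 3 (7 * g) e ⟨
          3 ^ (7 * g + e)                        ≡⟨ cong (3 ^_) (m+[n∸m]≡n 7g≤m) ⟩
          3 ^ m                                  ∎
          where
          e : ℕ
          e = m ∸ 7 * g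
          regroup : ∀ g e → 7 * g + e + 4 * g ≡ 11 * g + e
          regroup = solve-∀

      -- M preceded by σ as the lowest bit. As points are encoded by odd numbers, this bit adds σ to
      -- the color of every point.
      word : Bool → ℕ
      word σ = 𝟙 σ + (M + M)

      -- The words lie below 4 n, and 4 ≤ n fits them into the n * n numbers of the form q * n + r.
      word-< : ∀ σ → word σ < n * n
      word-< σ = begin-strict
        𝟙 σ + (M + M)          ≤⟨ +-monoˡ-≤ (M + M) (𝟙≤ σ) ⟩
        1 + (M + M)            ≤⟨ +-mono-≤ M<N (<⇒≤ M<N) ⟩
        2 ^ L + 2 ^ L          <⟨ +-mono-< 2^L<2n 2^L<2n ⟩
        (n + n) + (n + n)      ≡⟨ four n ⟩
        4 * n                  ≤⟨ *-monoˡ-≤ n 4≤n ⟩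
        n * n                  ∎
        where
        open ≤-Reasoning
        𝟙≤ : ∀ b → 𝟙 b ≤ 1
        𝟙≤ true  = ≤-refl
        𝟙≤ false = z≤n
        four : ∀ n → (n + n) + (n + n) ≡ 4 * n
        four = solve-∀

      L<n : L < n
      L<n = ≰⇒> λ n≤L → <⇒≱ 2^L<2n (≤-trans (twice n 1≤n) (^-monoʳ-≤ 2 n≤L))
        where
        twice : ∀ n → 1 ≤ n → n + n ≤ 2 ^ n
        twice (suc m) _ = ≤-trans (+-mono-≤ (n<2^n m) (n<2^n m)) (≤-reflexive (cong (2 ^ m +_) (sym (+-identityʳ _))))

      -- `dot` runs over n bits. `L<n` makes room for the extra lowest bit, and the bits beyond the
      -- L bits of M contribute nothing by `inner-high`.
      dot-color : ∀ σ x → x < n → dot (word σ) (suc (x + x)) ≡ color σ x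
      dot-color σ x x<n = trans (cong odd (foldn-cong n refl each))
        (trans (inner-count n (word σ) (suc (x + x))) (levels n L<n))
        where
        each : ∀ b acc → b < n → (if has b (word σ) then (if has b (suc (x + x)) then suc acc else acc) else acc) ≡
          (if bit b (word σ) ∧ bit b (suc (x + x)) then suc acc else acc)
        each b acc b<n rewrite has-bit (word σ) (<⇒≤ b<n) | has-bit (suc (x + x)) (<⇒≤ b<n) with bit b (word σ)
        ... | true  = refl
        ... | false = refl
        levels : ∀ m → L < m → inner m (word σ) (suc (x + x)) ≡ color σ x
        levels (suc m) (s≤s L≤m) = cong₂ _xor_
          (trans (cong₂ _∧_ (odd-2* σ M) (odd-2* true x)) (Boolₚ.∧-identityʳ σ))
          (trans (cong₂ (inner m) (half-2* σ M) (half-2* true x))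
            (trans (cong (λ z → inner z M x) (sym (m+[n∸m]≡n L≤m))) (inner-high L (m ∸ L) M x M<N)))

      conclude : ∀ σ → 400 ^ n ≤ w σ → ∃[ S ] (Reached S × size S ≤ k × score S ≤ᶠ expense)
      conclude σ ge = mT , descend p 324 189 in≤out
          (λ S ge → q , r , m<n*o⇒m/o<n (word-< σ) , m%n<n (word σ) n , inj₂ (inj₂ ge)) Tᵖ heavy-T , T-size , score-T
        where
        open Transversal (crossed M) (color σ) (cross-color σ)
        instance
          n≢0 : NonZero n
          n≢0 = >-nonZero 1≤n
        q r : ℕ
        q = word σ / n
        r = word σ % n
        p : ℕ → Bool
        p x = dot (q * n + r) (suc (x + x))
        in≤out : ∀ x → x < n → (if p x then 324 else 189) ≤ (if p x then 756 ∸ 324 else 756 ∸ 189)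
        in≤out x _ with p x
        ... | true  = ≤ᵇ⇒≤ 324 432 tt
        ... | false = ≤ᵇ⇒≤ 189 567 tt
        p-color : ∀ x → x < n → p x ≡ color σ x
        p-color x x<n = trans (cong (λ z → dot z (suc (x + x))) (trans (+-comm (q * n) r) (sym (m≡m%n+[m/n]*n (word σ) n)))) (dot-color σ x x<n)
        heavy-T : 400 ^ n ≤ weight p 324 189 mT
        heavy-T = ≤-trans ge (≤-reflexive (sym (trans (weight-∏ p 324 189 mT) (Prodℕ.big-cong n pointwise))))
          where
          pointwise : ∀ x → x < n → factor p 324 189 mT x ≡ fac σ x
          pointwise x x<n rewrite bit-mask n Tᵖ x x<n | p-color x x<n = refl

      found : ∃[ S ] (Reached S × size S ≤ k × score S ≤ᶠ expense)
      found with *-square-cancel large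
      ... | inj₁ ge = conclude false ge
      ... | inj₂ ge = conclude true ge

  dichotomy : (∃[ S ] (Reached S × size S ≤ k × score S ≤ᶠ expense)) ⊎
    (∃[ S ] ∃[ c ] ∃[ v ] (Reach S (k ∸ 1) c v × (∀ x → x < n → x ∈ S) × v ≤ᶠ expense))
  dichotomy with 3 * g ≤? n
  ... | yes 3g≤n = inj₁ (few-clusters 3g≤n)
  ... | no _ with anyUpTo? (λ i → (10 * i <? n) ×-dec (2 * n + 9 * i <? 6 * U i)) n
  ...   | no tame = inj₂ (chain λ i i≤n 10i<n → ≮⇒≥ λ wild →
            tame (i , ≤-trans (s≤s (m≤n*m i 10)) 10i<n , 10i<n , wild))
  ...   | yes (i , i<n , 10i<n , wild) with log-between n 1≤n
  ...     | L , n≤2^L , 2^L<2n = inj₁ (search (Coloring.half-cross L n≤2^L 2^L<2n 4≤n))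
    where
    -- No point is touched for i = 0, so that prefix cannot be wild; then n exceeds 10 and the code
    -- words fit.
    1≤i : 1 ≤ i
    1≤i = n≢0⇒n>0 λ { refl → <⇒≱ wild (≤-trans (≤-reflexive (cong (6 *_) (count-none n))) z≤n) }
    4≤n : 4 ≤ n
    4≤n = ≤-trans (≤ᵇ⇒≤ 4 10 tt) (≤-trans (*-monoʳ-≤ 10 1≤i) (<⇒≤ 10i<n))
    search : _ → ∃[ S ] (Reached S × size S ≤ k × score S ≤ᶠ expense)
    search (M , M<N , P≤) = Coloring.Pick.found L n≤2^L 2^L<2n 4≤n M M<N
      (ManyPairs.many i (<⇒≤ i<n) 10i<n wild (Coloring.X L n≤2^L 2^L<2n 4≤n M) P≤)

-- Reading off the solution

count-at : ∀ n p i → i < count n p → ∃[ y ] (y < n × p y ≡ true × count y p ≡ i)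
count-at (suc n) p i i< with p n in pn
... | false with count-at n p i i<
...   | y , y<n , py , eq = y , m<n⇒m<1+n y<n , py , eq
count-at (suc n) p i i< | true with i ≟ count n p
...   | yes refl = n , n<1+n n , pn , refl
...   | no i≢ with count-at n p i (≤∧≢⇒< (≤-pred i<) i≢)
...     | y , y<n , py , eq = y , m<n⇒m<1+n y<n , py , eq

count-strict : ∀ p {y y′} → y < y′ → p y ≡ true → count y p < count y′ p
count-strict p {y} {suc y′} y≤y′ py with y ≟ y′
... | yes refl rewrite py = ≤-refl
... | no y≢y′ with p y′
...   | true  = m≤n⇒m≤1+n (count-strict p (≤∧≢⇒< (≤-pred y≤y′) y≢y′) py)
...   | false = count-strict p (≤∧≢⇒< (≤-pred y≤y′) y≢y′) py

module Ranking {F : OrderedField 0ℓ 0ℓ 0ℓ} (I : Instance F) (C : ℕ) where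
  open Instance I
  open Properties I

  rank-count : ∀ y → y ≤ n → rank y C ≡ count y (λ z → bit z C)
  rank-count y y≤n = trans (foldn-cong n refl λ z acc z<n → cong (λ b → if suc z ≤ᵇ y then (if b then suc acc else acc) else acc) (has-bit C (<⇒≤ z<n)))
    (trans (capped n) (cong (λ z → count z (λ z → bit z C)) (m≤n⇒m⊓n≡m y≤n)))
    where
    capped : ∀ m → foldn m 0 (λ z acc → if suc z ≤ᵇ y then (if bit z C then suc acc else acc) else acc) ≡ count (y ⊓ m) (λ z → bit z C)
    capped zero = cong (λ z → count z (λ z → bit z C)) (sym (⊓-zeroʳ y))
    capped (suc m) with suc m ≤ᵇ y in eq
    ... | true rewrite m≥n⇒m⊓n≡n (true⇒≤ {suc m} {y} eq) =
      cong (λ z → if bit m C then suc z else z) (trans (capped m) (cong (λ z → count z (λ z → bit z C)) (m≥n⇒m⊓n≡n (<⇒≤ (true⇒≤ {suc m} {y} eq)))))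
    ... | false rewrite m≤n⇒m⊓n≡m (<⇒≤ (false⇒> {suc m} {y} eq)) =
      trans (capped m) (cong (λ z → count z (λ z → bit z C)) (m≤n⇒m⊓n≡m (≤-pred (false⇒> {suc m} {y} eq))))

  rank-< : ∀ {y} → y < n → y ∈ C → rank y C < size C
  rank-< {y} y<n y∈C = ≤-trans (s≤s (≤-reflexive (rank-count y (<⇒≤ y<n)))) (count-strict (λ z → bit z C) y<n y∈C)

  rank-mono : ∀ {y y′} → y < y′ → y′ < n → y ∈ C → rank y C < rank y′ C
  rank-mono {y} {y′} y<y′ y′<n y∈C = ≤-trans (s≤s (≤-reflexive (rank-count y (<⇒≤ (≤-trans y<y′ (<⇒≤ y′<n))))))
    (≤-trans (count-strict (λ z → bit z C) y<y′ y∈C) (≤-reflexive (sym (rank-count y′ (<⇒≤ y′<n)))))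

  nth-rank : ∀ {y} → y < n → y ∈ C → nth (rank y C) C ≡ y
  nth-rank {y} y<n y∈C = foldn-ind (λ t z → y < t → z ≡ y) n (λ ()) step y<n
    where
    step : ∀ i z → i < n → (y < i → z ≡ y) → y < suc i →
      (if has i C then (if rank i C ≤ᵇ rank y C then i else z) else z) ≡ y
    step i z i<n ih y≤i with y ≟ i
    ... | yes refl rewrite has-bit C (<⇒≤ i<n) | y∈C | ≤ᵇ-true (≤-refl {rank y C}) = refl
    ... | no y≢i with has i C in hi
    ...   | false = ih (≤∧≢⇒< (≤-pred y≤i) y≢i)
    ...   | true rewrite ≤ᵇ-false (rank-mono (≤∧≢⇒< (≤-pred y≤i) y≢i) i<n y∈C) = ih (≤∧≢⇒< (≤-pred y≤i) y≢i)

  nth-props : ∀ {i} → i < size C → nth i C < n × nth i C ∈ C × rank (nth i C) C ≡ i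
  nth-props {i} i< with count-at n (λ z → bit z C) i i<
  ... | y , y<n , y∈C , eq = subst (λ z → z < n × z ∈ C × rank z C ≡ i) (sym (trans (cong (λ j → nth j C) (sym rank≡)) (nth-rank y<n y∈C))) (y<n , y∈C , rank≡)
    where
    rank≡ : rank y C ≡ i
    rank≡ = trans (rank-count y (<⇒≤ y<n)) eq

weightOf : Bool → Weight
weightOf sq F x = if sq then OrderedField._*_ F x x else x

program : Bool → Program
program sq = driver sq starting searching finishing

-- Correctness on a given metric space

module Correct (F : OrderedField 0ℓ 0ℓ 0ℓ) (sq : Bool) {n : ℕ} (X : Clustering.FiniteMetricSpace F n) (k : ℕ)
               (1≤k : 1 ≤ k) (k≤n : k ≤ n) where
  open Ordered F
  open Clustering F renaming (cost to costᵒ)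
  open FiniteMetricSpace X
  open IsGeneralMetric isMetric using (nonNegative; ≈⇒0) renaming (sym to d-sym)
  open Machine F

  1≤n : 1 ≤ n
  1≤n = ≤-trans 1≤k k≤n

  D : ℕ → Carrier
  D = real (input X k)

  open Semantics F sq n k D using (lookupᵈ; weigh; exec)

  V : ℕ → ℕ → Carrier
  V c x = lookupᵈ (c * n + x)

  pair< : ∀ (c x : Fin n) → toℕ c * n + toℕ x < n * n
  pair< c x = ≤-trans (pair-< 0 (Finₚ.toℕ<n c) (Finₚ.toℕ<n x)) (≤-reflexive (+-identityʳ (n * n)))

  D-d : ∀ c x → D (toℕ c * n + toℕ x) ≡ d c x
  D-d c x with toℕ c * n + toℕ x <? n * n
  ... | no ≮ = ⊥-elim (≮ (pair< c x))
  ... | yes lt = cong (uncurry d) (trans (cong (Fin.remQuot {n} n) (Finₚ.toℕ-injective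
          (trans (Finₚ.toℕ-fromℕ< lt) (trans (cong (_+ toℕ x) (*-comm (toℕ c) n)) (sym (Finₚ.toℕ-combine c x))))))
          (Finₚ.remQuot-combine c x))

  V-d : ∀ c x → V (toℕ c) (toℕ x) ≡ weigh (d c x)
  V-d c x = cong weigh (trans (cong D (clamp-id (pair< c x))) (D-d c x))
    where
    clamp-id : ∀ {i} → i < n * n → clamp n i ≡ i
    clamp-id {i} i< = cong (i ∸_) (m≤n⇒m∸n≡0 (m+n≤o⇒m≤o∸n i (≤-trans (≤-reflexive (+-comm i 1)) i<)))

  weigh-cases : (P : Carrier → Carrier → Set) → (∀ x → P x x) → (∀ x → P x (x *ᶠ x)) → ∀ x → P x (weigh x)
  weigh-cases P same square x = go sq
    where
    go : ∀ b → P x (if b then x *ᶠ x else x)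
    go false = same x
    go true  = square x

  at : ∀ {c} → c < n → Fin n
  at c<n = fromℕ< c<n

  V-at : ∀ {c x} (c<n : c < n) (x<n : x < n) → V c x ≡ weigh (d (at c<n) (at x<n))
  V-at c<n x<n = trans (cong₂ V (sym (Finₚ.toℕ-fromℕ< c<n)) (sym (Finₚ.toℕ-fromℕ< x<n))) (V-d (at c<n) (at x<n))

  weigh-cong : ∀ {x y} → x ≈ y → weigh x ≈ weigh y
  weigh-cong {x} {y} x≈y = go sq
    where
    go : ∀ b → (if b then x *ᶠ x else x) ≈ (if b then y *ᶠ y else y)
    go false = x≈y
    go true  = OrderedField.*-cong F x≈y x≈y

  I : Instance F
  I = record
    { n = n ; k = k ; V = V ; 1≤n = 1≤n ; 1≤k = 1≤k ; k≤n = k≤n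
    ; V≥0 = λ c x c<n x<n → subst (0# ≤ᶠ_) (sym (V-at c<n x<n))
        (weigh-cases (λ x y → 0# ≤ᶠ x → 0# ≤ᶠ y) (λ _ 0≤x → 0≤x) (λ _ 0≤x → *-nonNegative 0≤x 0≤x) _ nonNegative)
    ; V≈0 = λ x x<n → ≈-trans (≈-reflexive (V-at x<n x<n))
        (weigh-cases (λ x y → x ≈ 0# → y ≈ 0#) (λ _ x≈0 → x≈0)
          (λ x x≈0 → ≈-trans (OrderedField.*-congʳ F x≈0) (OrderedField.zeroˡ F x)) _ (≈⇒0 refl))
    ; V-sym = λ c x c<n x<n → ≈-trans (≈-reflexive (V-at c<n x<n))
        (≈-trans (weigh-cong (d-sym (at c<n) (at x<n))) (≈-reflexive (sym (V-at x<n c<n))))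
    }

  open Properties I
  open Choosing I
  open Heavy I
  open Costs I
  open Searching I

  open RawMonoidDefs (Monoid.rawMonoid (OrderedField.+-monoid F)) using (sum)

  sum-∑ : ∀ {m} (f : Fin m → Carrier) (h : ℕ → Carrier) → (∀ i → f i ≈ h (toℕ i)) → sum f ≈ ∑ᶠ m h
  sum-∑ {zero}  f h f≈h = ≈-refl
  sum-∑ {suc m} f h f≈h = ≈-trans (OrderedField.+-cong F (f≈h zero) (sum-∑ (f ∘ suc) (h ∘ suc) (f≈h ∘ suc)))
    (≈-sym (Sumᶠ.big-head m h))

  module Sol (S : Solution n k) where
    open Solution S

    ctr : ℕ → ℕ
    ctr i with i <? k
    ... | yes i<k = toℕ (center (fromℕ< i<k))
    ... | no _    = 0

    cl : ℕ → ℕ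
    cl x with x <? n
    ... | yes x<n = toℕ (cluster (fromℕ< x<n))
    ... | no _    = 0

    ctr-toℕ : ∀ i → ctr (toℕ i) ≡ toℕ (center i)
    ctr-toℕ i with toℕ i <? k
    ... | yes i<k = cong (toℕ ∘ center) (Finₚ.fromℕ<-toℕ i i<k)
    ... | no i≮k = ⊥-elim (i≮k (Finₚ.toℕ<n i))

    cl-toℕ : ∀ x → cl (toℕ x) ≡ toℕ (cluster x)
    cl-toℕ x with toℕ x <? n
    ... | yes x<n = cong (toℕ ∘ cluster) (Finₚ.fromℕ<-toℕ x x<n)
    ... | no x≮n = ⊥-elim (x≮n (Finₚ.toℕ<n x))

    ctr-< : ∀ {i} → i < k → ctr i < n
    ctr-< {i} i<k = subst (_< n) (trans (sym (ctr-toℕ (fromℕ< i<k))) (cong ctr (Finₚ.toℕ-fromℕ< i<k))) (Finₚ.toℕ<n _)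

    cl-< : ∀ {x} → x < n → cl x < k
    cl-< {x} x<n = subst (_< k) (trans (sym (cl-toℕ (fromℕ< x<n))) (cong cl (Finₚ.toℕ-fromℕ< x<n))) (Finₚ.toℕ<n _)

    cost-≈ : costᵒ (weightOf sq F) X S ≈ ∑ᶠ n (λ x → V (ctr (cl x)) x)
    cost-≈ = ≈-trans (sum-∑ _ (λ i → ∑ᶠ n λ x → Sumᶠ.pick (cl x) i (V (ctr i) x))
          λ i → sum-∑ _ (λ x → Sumᶠ.pick (cl x) (toℕ i) (V (ctr (toℕ i)) x)) λ x → item i x)
      (≈-trans (Sumᶠ.big-swap k n λ i x → Sumᶠ.pick (cl x) i (V (ctr i) x))
        (Sumᶠ.big-cong n λ x x<n → ≈-trans
          (Sumᶠ.big-single k (cl x) (cl-< x<n) λ i _ i≢ → Sumᶠ.pick-≢ {cl x} {i} (V (ctr i) x) (i≢ ∘ sym))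
          (Sumᶠ.pick-≡ (cl x) (V (ctr (cl x)) x))))
      where
      item : ∀ i x → (if ⌊ cluster x Fin.≟ i ⌋ then weigh (d (center i) x) else 0#) ≈
        Sumᶠ.pick (cl (toℕ x)) (toℕ i) (V (ctr (toℕ i)) (toℕ x))
      item i x rewrite cl-toℕ x | ctr-toℕ i | V-d (center i) x with cluster x Fin.≟ i
      ... | yes refl = ≈-reflexive (cong (λ b → if b then weigh (d (center (cluster x)) x) else 0#) (sym (≡ᵇ-refl (toℕ (cluster x)))))
      ... | no ne = ≈-reflexive (cong (λ b → if b then weigh (d (center i) x) else 0#) (sym (≢⇒≡ᵇ (ne ∘ Finₚ.toℕ-injective))))

    centers : ℕ → ℕ → Bool
    centers zero    x = false
    centers (suc j) x = insert (ctr j) (centers j) x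

    fresh : ∀ j → j < k → centers j (ctr j) ≡ false
    fresh j j<k = go j ≤-refl
      where
      ctr-injective : ∀ {i j} → i < k → j < k → ctr i ≡ ctr j → i ≡ j
      ctr-injective {i} {j} i<k j<k eq = trans (sym (Finₚ.toℕ-fromℕ< i<k)) (trans (cong toℕ (center-injective
        (Finₚ.toℕ-injective (trans (sym (at-ctr i<k)) (trans eq (at-ctr j<k)))))) (Finₚ.toℕ-fromℕ< j<k))
        where
        at-ctr : ∀ {i} (i<k : i < k) → ctr i ≡ toℕ (center (fromℕ< i<k))
        at-ctr i<k = trans (cong ctr (sym (Finₚ.toℕ-fromℕ< i<k))) (ctr-toℕ (fromℕ< i<k))
      go : ∀ i → i ≤ j → centers i (ctr j) ≡ false
      go zero    _   = refl
      go (suc i) i<j = cong₂ _∨_ (≢⇒≡ᵇ λ eq → <⇒≢ i<j (sym (ctr-injective j<k (≤-trans i<j (<⇒≤ j<k)) eq)))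
        (go i (<⇒≤ i<j))

    count-centers : ∀ j → j ≤ k → count n (centers j) ≡ j
    count-centers zero _ = count-none n
    count-centers (suc j) j<k = trans (count-insert n (ctr j) (ctr-< j<k) (fresh j j<k)) (cong suc (count-centers j (<⇒≤ j<k)))

    is-center : ∀ {i} → i < k → centers k (ctr i) ≡ true
    is-center {i} i<k = go k i<k
      where
      go : ∀ j → i < j → centers j (ctr i) ≡ true
      go (suc j) i≤j with i ≟ j
      ... | yes refl = cong (_∨ centers i (ctr i)) (≡ᵇ-refl (ctr i))
      ... | no i≢j = trans (cong ((ctr i ≡ᵇ ctr j) ∨_) (go j (≤∧≢⇒< (≤-pred i≤j) i≢j))) (Boolₚ.∨-zeroʳ _)

    -- A center may lie in the cluster of another one. Moving every center to itself makes the fixed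
    -- points exactly the k centers and cannot raise the cost, as V x x is zero.
    grouping : Grouping I
    grouping = record { a = a ; a< = a< ; idem = idem ; fixed-k = trans (count-cong n fixed≡) (count-centers k ≤-refl) }
      where
      a : ℕ → ℕ
      a x = if centers k x then x else ctr (cl x)
      a< : ∀ x → x < n → a x < n
      a< x x<n with centers k x
      ... | true  = x<n
      ... | false = ctr-< (cl-< x<n)
      idem : ∀ x → x < n → a (a x) ≡ a x
      idem x x<n with centers k x in cx
      ... | true  rewrite cx = refl
      ... | false rewrite is-center (cl-< x<n) = refl
      fixed≡ : ∀ x → x < n → (a x ≡ᵇ x) ≡ centers k x
      fixed≡ x x<n with centers k x in cx
      ... | true  = ≡ᵇ-refl x
      ... | false = ≢⇒≡ᵇ λ eq → false≢true (trans (sym cx) (subst (λ z → centers k z ≡ true) eq (is-center (cl-< x<n))))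

    expense-≤ : Clusters.expense grouping ≤ᶠ costᵒ (weightOf sq F) X S
    expense-≤ = ≤ᶠ-respʳ (Sumᶠ≤.big-mono n pointwise) (≈-sym cost-≈)
      where
      pointwise : ∀ x → x < n → V (if centers k x then x else ctr (cl x)) x ≤ᶠ V (ctr (cl x)) x
      pointwise x x<n with centers k x
      ... | true  = ≤ᶠ-respˡ (Instance.V≈0 I x x<n) (Instance.V≥0 I _ _ (ctr-< (cl-< x<n)) x<n)
      ... | false = ≤ᶠ-refl

  Hs : ℕ → Heap
  Hs zero    = startH
  Hs (suc i) = searchH (Hs i)

  record Halts : Set where
    field
      N       : ℕ
      inv     : ∀ i → i ≤ N → Inv (Hs i)
      running : ∀ i → i < N → Hs i glob 0 < Hs i glob 1
      halted  : Hs N glob 1 ≤ Hs N glob 0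
      head≡   : Hs N glob 0 ≡ N

  tail≤ : ∀ {H} → Inv H → H glob 1 ≤ 2 ^ n
  tail≤ inv = ≤-trans (≤-reflexive (sym (Inv.counted inv))) (count≤n (2 ^ n) _)

  opaque
    -- The head advances by one in each round and is below the tail, hence below 2 ^ n, whenever a
    -- round starts; fuel 2 ^ n therefore suffices.
    halts : Halts
    halts = go (2 ^ n) 0 (m≤m+n (2 ^ n) 0) (λ { zero _ → start-inv }) (λ _ ()) refl
      where
      go : ∀ fuel i → 2 ^ n ≤ fuel + i → (∀ j → j ≤ i → Inv (Hs j)) → (∀ j → j < i → Hs j glob 0 < Hs j glob 1) →
        Hs i glob 0 ≡ i → Halts
      go fuel i enough inv running head≡ with Hs i glob 0 <? Hs i glob 1
      ... | no h≮t = record { N = i ; inv = inv ; running = running ; halted = ≮⇒≥ h≮t ; head≡ = head≡ }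
      go zero i enough inv running head≡ | yes h<t =
        ⊥-elim (<⇒≱ h<t (≤-trans (tail≤ (inv i ≤-refl)) (≤-trans enough (≤-reflexive (sym head≡)))))
      go (suc fuel) i enough inv running head≡ | yes h<t =
        go fuel (suc i) (≤-trans enough (≤-reflexive (sym (+-suc fuel i))))
          (λ j j≤ → case j ≟ suc i of λ where
            (yes refl) → proj₁ step
            (no j≢)    → inv j (≤-pred (≤∧≢⇒< j≤ j≢)))
          (λ j j≤i → case j ≟ i of λ where
            (yes refl) → h<t
            (no j≢i)   → running j (≤∧≢⇒< (≤-pred j≤i) j≢i))
          (trans (proj₂ step) (cong suc head≡))
        where
        step : Inv (searchH (Hs i)) × searchH (Hs i) glob 0 ≡ suc (Hs i glob 0)
        step = Step.searched (Hs i) (inv i ≤-refl) h<t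

  open Halts halts

  final-inv : Inv (Hs N)
  final-inv = inv N ≤-refl

  -- Each round consumes one queue entry, and the entries are distinct heavy sets.
  few-rounds : N * 100 ^ n ≤ 189 ^ n * (3 * (n * n))
  few-rounds = ≤-trans (*-monoˡ-≤ (100 ^ n) (≤-trans (≤-reflexive (sym head≡))
      (≤-trans (Inv.head≤ final-inv) (≤-reflexive (sym (Inv.counted final-inv))))))
    (few-heavy (λ S → 1 ≤ᵇ Hs N seen S) λ S marked → case Inv.listed final-inv S (true⇒≤ marked) of λ where
      (i , i<tl , refl) → reached-heavy (Inv.entries final-inv i i<tl))

  C : ℕ
  C = greedy (Hs N glob 2)

  module G = Greedy (proj₁ (Inv.candidate final-inv)) (proj₂ (Inv.candidate final-inv))
  open Ranking I C

  optimal-score : ∀ S′ → score (Hs N glob 2) ≤ᶠ costᵒ (weightOf sq F) X S′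
  optimal-score S′ = ≤ᶠ-trans (below (Cases.dichotomy (Sol.grouping S′))) (Sol.expense-≤ S′)
    where
    module Fin′ = Done (Hs N) final-inv halted
    below : _ → score (Hs N glob 2) ≤ᶠ Clusters.expense (Sol.grouping S′)
    below (inj₁ (S , R , S≤k , le)) = ≤ᶠ-trans (Fin′.beats-set R S≤k) le
    below (inj₂ (S , c , v , R , full , le)) = ≤ᶠ-trans (Fin′.beats-chain R full) le

  some-center : ∃[ c ] (c < n × c ∈ C)
  some-center = count-last n (λ x → bit x C) (≤-trans 1≤k (≤-reflexive (sym G.size≡k)))

  near : ∀ {x} (x<n : x < n) → nearest C x < n × nearest C x ∈ C
  near x<n = Nearest.nearest-< C x<n , proj₁ (Nearest.nearest-best C x<n _ (proj₁ (proj₂ some-center)) (proj₂ (proj₂ some-center)))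

  nth< : ∀ (i : Fin k) → nth (toℕ i) C < n × nth (toℕ i) C ∈ C × rank (nth (toℕ i) C) C ≡ toℕ i
  nth< i = nth-props (≤-trans (Finₚ.toℕ<n i) (≤-reflexive (sym G.size≡k)))

  rank< : ∀ {x} → x < n → rank (nearest C x) C < k
  rank< x<n = ≤-trans (rank-< (proj₁ (near x<n)) (proj₂ (near x<n))) (≤-reflexive G.size≡k)

  solution : Solution n k
  solution = record
    { center = λ i → fromℕ< (proj₁ (nth< i))
    ; center-injective = λ {i} {j} eq → Finₚ.toℕ-injective (trans (sym (proj₂ (proj₂ (nth< i))))
        (trans (cong (λ z → rank z C) (trans (sym (Finₚ.toℕ-fromℕ< (proj₁ (nth< i)))) (trans (cong toℕ eq) (Finₚ.toℕ-fromℕ< (proj₁ (nth< j))))))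
          (proj₂ (proj₂ (nth< j)))))
    ; cluster = λ x → fromℕ< (rank< (Finₚ.toℕ<n x))
    -- The i-th center is its own nearest center, so cluster i contains it.
    ; cluster-surjective = λ i → fromℕ< (proj₁ (nth< i)) , λ { refl → Finₚ.toℕ-injective (trans (Finₚ.toℕ-fromℕ< (rank< (Finₚ.toℕ<n _)))
        (trans (cong (λ z → rank (nearest C z) C) (Finₚ.toℕ-fromℕ< (proj₁ (nth< i))))
          (trans (cong (λ z → rank z C) (Nearest.nearest-self C (proj₁ (nth< i)) (proj₁ (proj₂ (nth< i))))) (proj₂ (proj₂ (nth< i)))))) }
    }

  solution-cost : costᵒ (weightOf sq F) X solution ≈ score (Hs N glob 2)
  solution-cost = ≈-trans (Sol.cost-≈ solution) (≈-trans (Sumᶠ.big-cong n λ x x<n → ≈-reflexive (cong (λ c → V c x) (assigned x<n)))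
    (≈-reflexive (sym (total-≡ C))))
    where
    open Sol solution
    assigned : ∀ {x} → x < n → ctr (cl x) ≡ nearest C x
    assigned {x} x<n = begin
      ctr (cl x)                                     ≡⟨ cong (ctr ∘ cl) (Finₚ.toℕ-fromℕ< x<n) ⟨
      ctr (cl (toℕ (fromℕ< x<n)))                    ≡⟨ cong ctr (cl-toℕ (fromℕ< x<n)) ⟩
      ctr (toℕ (Solution.cluster solution (fromℕ< x<n))) ≡⟨ ctr-toℕ _ ⟩
      toℕ (Solution.center solution (Solution.cluster solution (fromℕ< x<n))) ≡⟨ Finₚ.toℕ-fromℕ< _ ⟩
      nth (toℕ (Solution.cluster solution (fromℕ< x<n))) C ≡⟨ cong (λ z → nth z C) (Finₚ.toℕ-fromℕ< _) ⟩
      nth (rank (nearest C (toℕ (fromℕ< x<n))) C) C  ≡⟨ cong (λ z → nth (rank (nearest C z) C) C) (Finₚ.toℕ-fromℕ< x<n) ⟩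
      nth (rank (nearest C x) C) C                   ≡⟨ nth-rank (proj₁ (near x<n)) (proj₂ (near x<n)) ⟩
      nearest C x                                    ∎
      where open ≡-Reasoning

  optimal : Optimal (weightOf sq F) X solution
  optimal S′ = ≤ᶠ-respˡ solution-cost (optimal-score S′)

  written : ℕ → ℕ
  written a = finishH (Hs N) out (n + n + a)

  H′ : Heap
  H′ = foldn n (Hs N) λ i H → if suc i ≤ᵇ k then store H out (n + n + i) (nth i C) else H

  first-half : ∀ i → i < k → H′ out (n + n + i) ≡ nth i C
  first-half i i<k = foldn-ind (λ t H → ∀ i → i < k → i < t → H out (n + n + i) ≡ nth i C) n (λ _ _ ()) step i i<k (≤-trans i<k k≤n)
    where
    step : ∀ t H → t < n → (∀ i → i < k → i < t → H out (n + n + i) ≡ nth i C) → ∀ i → i < k → i < suc t →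
      (if suc t ≤ᵇ k then store H out (n + n + t) (nth t C) else H) out (n + n + i) ≡ nth i C
    step t H t<n ih i i<k i≤t with i ≟ t
    ... | yes refl rewrite ≤ᵇ-true i<k = store-hit H out (n + n + i) (nth i C)
    ... | no i≢t with suc t ≤ᵇ k
    ...   | true  = trans (store-miss H out (n + n + t) (nth t C) (i≢t ∘ +-cancelˡ-≡ (n + n) i t)) (ih i i<k (≤∧≢⇒< (≤-pred i≤t) i≢t))
    ...   | false = ih i i<k (≤∧≢⇒< (≤-pred i≤t) i≢t)

  both-halves : (∀ i → i < k → written i ≡ nth i C) × (∀ x → x < n → written (k + x) ≡ rank (nearest C x) C)
  both-halves = (λ i i<k → trans (proj₁ result i i<k) (first-half i i<k)) , λ x x<n → proj₂ result x x<n
    where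
    P : ℕ → Heap → Set
    P t H = (∀ i → i < k → H out (n + n + i) ≡ H′ out (n + n + i)) × (∀ x → x < t → H out (n + n + (k + x)) ≡ rank (nearest C x) C)
    step : ∀ t H → t < n → P t H → P (suc t) (store H out (n + n + (k + t)) (rank (nearest C t) C))
    step t H t<n (keep , done) =
      (λ i i<k → trans (store-miss H out (n + n + (k + t)) _ λ eq → <⇒≢ (≤-trans i<k (m≤m+n k t)) (+-cancelˡ-≡ (n + n) i (k + t) eq)) (keep i i<k)) ,
      λ x x≤t → case x ≟ t of λ where
        (yes refl) → store-hit H out (n + n + (k + x)) _
        (no x≢t)   → trans (store-miss H out (n + n + (k + t)) _ λ eq → x≢t (+-cancelˡ-≡ k x t (+-cancelˡ-≡ (n + n) (k + x) (k + t) eq)))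
                       (done x (≤∧≢⇒< (≤-pred x≤t) x≢t))
    result : P n (finishH (Hs N))
    result = foldn-ind P n ((λ _ _ → refl) , λ _ ()) step

  open Simulation F sq n k 1≤n D
  open Running F sq n k 1≤n D
  open Hoare F using (Outcome)
  open Meaning F sq n k D
  open Cost sq

  context : ∀ i → i ≤ N → Ctx n (Hs i) []
  context i i≤N = ctx ≤-refl k≤n (Inv.small (inv i i≤N)) []

  run : Outcome (program sq) (input X k) (λ s′ → ∀ a → a < k + n → nat s′ a ≡ written a)
    (⟪ costᶜ starting [] 0 ⟫ n + ((⟪ timeᵗP pending ⟫ n + N * (⟪ timeᵗP pending ⟫ n + ⟪ costᶜ searching [] 0 ⟫ n)) +
      (⟪ costᶜ finishing [] 0 ⟫ n + ⟪ copyP :∘ (:X :+ growthᶜ finishing) ⟫ n)))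
  run = relax (λ s′ post a a< → trans (post a a<) (cong (λ H → H out (n + n + a)) (finish-spec (Hs N)))) ≤-refl
    (run-driver 1≤k k≤n starting searching finishing {H = λ _ _ → 0} Hs N
      (sim refl refl (λ _ _ → refl) (λ _ _ → refl)) (ctx ≤-refl k≤n (λ _ _ → z≤n) [])
      (sym start-spec) (λ i → sym (search-spec (Hs i))) context running halted)
    where open Hoare F using (relax)

-- The time bound

module Timing (A T W E : Poly) where

  private
    overhead : Poly
    overhead = (A :+ (T :+ E)) :+ (:c 3 :* (:X :* :X)) :* (T :+ W)

    K d : ℕ
    K = proj₁ (⟪⟫-bound overhead)
    d = proj₁ (proj₂ (⟪⟫-bound overhead))

  -- A single number has to serve as coefficient and as degree, and K + d bounds both.
  exponent : ℕ
  exponent = K + d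

  in-time : ∀ n t N → 1 ≤ n → t ≤ ⟪ A ⟫ n + ((⟪ T ⟫ n + N * (⟪ T ⟫ n + ⟪ W ⟫ n)) + ⟪ E ⟫ n) →
    N * 100 ^ n ≤ 189 ^ n * (3 * (n * n)) → t * 100 ^ n ≤ 189 ^ n * (exponent * n ^ exponent)
  in-time n t N 1≤n t≤ few = begin
    t * p                                           ≤⟨ *-monoˡ-≤ p t≤ ⟩
    (a + ((b + N * (b + w)) + e)) * p               ≡⟨ expand₁ a b N w e p ⟩
    (a + (b + e)) * p + N * p * (b + w)             ≤⟨ +-mono-≤ (*-monoʳ-≤ (a + (b + e)) (^-monoˡ-≤ n (≤ᵇ⇒≤ 100 189 tt))) (*-monoˡ-≤ (b + w) few) ⟩
    (a + (b + e)) * q + q * (3 * (n * n)) * (b + w) ≡⟨ expand₂ (a + (b + e)) q (3 * (n * n)) (b + w) ⟩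
    q * (a + (b + e) + 3 * (n * n) * (b + w))       ≤⟨ *-monoʳ-≤ q (proj₂ (proj₂ (proj₂ (⟪⟫-bound overhead))) n 1≤n) ⟩
    q * (K * n ^ d)                                 ≤⟨ *-monoʳ-≤ q (*-mono-≤ (m≤m+n K d) (^-monoʳ-≤ n (m≤n+m d K))) ⟩
    q * (exponent * n ^ exponent)                   ∎
    where
    open ≤-Reasoning
    instance
      n≢0 : NonZero n
      n≢0 = >-nonZero 1≤n
    p q a b w e : ℕ
    p = 100 ^ n
    q = 189 ^ n
    a = ⟪ A ⟫ n
    b = ⟪ T ⟫ n
    w = ⟪ W ⟫ n
    e = ⟪ E ⟫ n
    expand₁ : ∀ A B N W E p → (A + ((B + N * (B + W)) + E)) * p ≡ (A + (B + E)) * p + N * p * (B + W)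
    expand₁ = solve-∀
    expand₂ : ∀ A q m W → A * q + q * m * W ≡ q * (A + m * W)
    expand₂ = solve-∀

-- The polynomials come from the program text alone, so the exponent is fixed before the field, n,
-- the metric space and k are given.
solves : ∀ sq → SolvesInTime (weightOf sq) 189 100 (program sq)
solves sq = exponent , λ F n X k 1≤k k≤n →
  let open Correct F sq X k 1≤k k≤n
      open Halts halts
      s , t , run-p , post , t≤ = run
  in s , t , solution , run-p ,
     ((λ i → trans (post (toℕ i) (≤-trans (Finₚ.toℕ<n i) (m≤m+n k n)))
        (trans (proj₁ both-halves (toℕ i) (Finₚ.toℕ<n i)) (sym (Finₚ.toℕ-fromℕ< (proj₁ (nth< i)))))) ,
      (λ x → trans (post (k + toℕ x) (+-monoʳ-< k (Finₚ.toℕ<n x)))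
        (trans (proj₂ both-halves (toℕ x) (Finₚ.toℕ<n x)) (sym (Finₚ.toℕ-fromℕ< (rank< (Finₚ.toℕ<n x))))))) ,
     optimal ,
     in-time n t N 1≤n t≤ few-rounds
  where
  open Cost sq
  open Timing (costᶜ starting [] 0) (timeᵗP pending) (costᶜ searching [] 0)
    (costᶜ finishing [] 0 :+ copyP :∘ (:X :+ growthᶜ finishing))

theorem1 : (∃[ p ] SolvesInTime medianWeight 189 100 p) ×
    (∃[ p ] SolvesInTime meansWeight 189 100 p)
theorem1 = (program false , solves false) , (program true , solves true)
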